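{- Let $k\ge3$ and let $G$ be a connected $k$-CS-transitive graph with more than one end. Then every end of $G$ is either local or global. The automorphism group of $G$ acts transitively on the set of local ends and transitively on the set of global ends. Moreover, $G$ is end-transitive if and only if it has no local end.
   Context: A graph $G$ is $k$-CS-transitive if for every two connected isomorphic induced subgraphs of $G$ on $k$ vertices, some isomorphism between them extends to an automorphism of $G$. Ends are equivalence classes of rays (one-way infinite paths), two rays being equivalent if there is no finite vertex set $S$ such that they eventually lie in distinct components of $G-S$. Call a ray bounded-recurrent if there is a vertex set $S$ of finite diameter (with respect to the distance in $G$) that the ray meets infinitely often. An end is local if all of its rays are bounded-recurrent, and global if none of its rays is bounded-recurrent. $G$ is end-transitive if $\mathrm{Aut}(G)$ acts transitively on the ends of $G$. -}

module Defs where

open import Data.Nat using (ℕ; zero; suc; _≤_)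
open import Data.Fin using (Fin)
open import Data.List using (List)
open import Data.List.Membership.Propositional using (_∈_)
open import Data.Product using (Σ; ∃; _×_; _,_)
open import Data.Sum using (_⊎_)
open import Data.Unit using (⊤)
open import Data.Empty using (⊥)
open import Relation.Nullary using (¬_)
open import Relation.Binary.PropositionalEquality using (_≡_)
open import Function using (_∘_)

record Graph : Set₁ where
  field
    V     : Set
    E     : V → V → Set
    E-sym : ∀ {u v} → E u v → E v u
    E-irr : ∀ {v} → ¬ E v v

module _ (G : Graph) where
  open Graph G

  data ConnIn (P : V → Set) : V → V → Set where
    here : ∀ {u} → P u → ConnIn P u u
    step : ∀ {u v w} → P u → E u v → ConnIn P v w → ConnIn P u w

  data WalkLen : ℕ → V → V → Set where
    nil  : ∀ {u} → WalkLen zero u u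
    cons : ∀ {n u v w} → E u v → WalkLen n v w → WalkLen (suc n) u w

  DistLE : V → V → ℕ → Set
  DistLE u v d = Σ ℕ λ n → n ≤ d × WalkLen n u v

  Connected : Set
  Connected = ∀ u v → ConnIn (λ _ → ⊤) u v

  record Aut : Set where
    field
      to      : V → V
      from    : V → V
      to-from : ∀ v → to (from v) ≡ v
      from-to : ∀ v → from (to v) ≡ v
      pres    : ∀ u v → E u v → E (to u) (to v)
      refl'   : ∀ u v → E (to u) (to v) → E u v
  open Aut public

  record Ray : Set where
    field
      seq : ℕ → V
      inj : ∀ i j → seq i ≡ seq j → i ≡ j
      adj : ∀ i → E (seq i) (seq (suc i))
  open Ray public

  Avoid : List V → V → Set
  Avoid S v = ¬ (v ∈ S)

  -- two sequences eventually lie in the same component of G - S, for every finite S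
  -- (the classical negation of "eventually in distinct components of G - S for some S")
  EquivSeq : (ℕ → V) → (ℕ → V) → Set
  EquivSeq r₁ r₂ = (S : List V) → Σ ℕ λ N → ∀ i j → N ≤ i → N ≤ j →
                     ConnIn (Avoid S) (r₁ i) (r₂ j)

  EquivRay : Ray → Ray → Set
  EquivRay ρ₁ ρ₂ = EquivSeq (seq ρ₁) (seq ρ₂)

  FiniteDiam : (V → Set) → Set
  FiniteDiam S = Σ ℕ λ d → ∀ u v → S u → S v → DistLE u v d

  BoundedRecurrent : Ray → Set₁
  BoundedRecurrent ρ = Σ (V → Set) λ S → FiniteDiam S ×
                         (∀ N → Σ ℕ λ n → N ≤ n × S (seq ρ n))

  LocalEnd : Ray → Set₁
  LocalEnd ρ = ∀ ρ' → EquivRay ρ ρ' → BoundedRecurrent ρ'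

  GlobalEnd : Ray → Set₁
  GlobalEnd ρ = ∀ ρ' → EquivRay ρ ρ' → ¬ BoundedRecurrent ρ'

  MapsEnd : Aut → Ray → Ray → Set
  MapsEnd φ ρ ρ' = EquivSeq (to φ ∘ seq ρ) (seq ρ')

  MoreThanOneEnd : Set
  MoreThanOneEnd = Σ Ray λ ρ₁ → Σ Ray λ ρ₂ → ¬ EquivRay ρ₁ ρ₂

  EndTransitive : Set
  EndTransitive = ∀ ρ ρ' → Σ Aut λ φ → MapsEnd φ ρ ρ'

  -- induced subgraphs on k vertices, given by injective labellings f : Fin k → V
  InjectiveFin : ∀ {k} → (Fin k → V) → Set
  InjectiveFin {k} f = ∀ i j → f i ≡ f j → i ≡ j

  data ConnInduced {k} (f : Fin k → V) : Fin k → Fin k → Set where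
    here : ∀ {i} → ConnInduced f i i
    step : ∀ {i j l} → E (f i) (f j) → ConnInduced f j l → ConnInduced f i l

  InducedConnected : ∀ {k} → (Fin k → V) → Set
  InducedConnected {k} f = ∀ i j → ConnInduced f i j

  -- σ is an isomorphism from the induced subgraph on im f to that on im g
  -- (the vertex map f i ↦ g (σ i))
  IsIsoInduced : ∀ {k} → (Fin k → V) → (Fin k → V) → (Fin k → Fin k) → Set
  IsIsoInduced {k} f g σ =
    (Σ (Fin k → Fin k) λ τ → (∀ i → τ (σ i) ≡ i) × (∀ i → σ (τ i) ≡ i)) ×
    (∀ i j → E (f i) (f j) → E (g (σ i)) (g (σ j))) ×
    (∀ i j → E (g (σ i)) (g (σ j)) → E (f i) (f j))

  CSTransitive : ℕ → Set
  CSTransitive k = (f g : Fin k → V) → InjectiveFin f → InjectiveFin g →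
    InducedConnected f → InducedConnected g →
    (Σ (Fin k → Fin k) λ σ → IsIsoInduced f g σ) →
    Σ (Fin k → Fin k) λ σ → IsIsoInduced f g σ ×
      Σ Aut λ φ → ∀ i → to φ (f i) ≡ g (σ i)

{-# OPTIONS --safe #-}
-- Let n be the least size of a finite set separating two ends. Among the separators of size n those
-- crossed by the fewest others are pairwise nested, by submodularity, and permuted by Aut G. Each component
-- they leave that contains a ray contains another of them, since otherwise a clique, a star or a path on k
-- vertices could be moved off its distance to them; so long induced paths cross them. All induced paths on
-- k vertices form one orbit, so the number of separators between the ends of such a path is constant, and
-- this prevents an induced path from leaving a separator and returning to it. Hence the separators are
-- disjoint modules. If some vertices lie in no separator, they split into finite modules in the same way.
-- These modules are arranged like the vertices of a tree of blocks, any two modules of a block being joined.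
-- A ray stays in a block (its end is local) or runs through infinitely many (its end is global). A local end
-- determines an infinite block, which contains a clique on k vertices. Two global ends lie on double lines of
-- modules; along a line the types of successive pieces have period at most two, so after a shift the pieces
-- match, and since modules are interchangeable the automorphisms matching them can be glued.
module Submission where

open import Defs
open import Data.Nat using (ℕ; zero; suc; _+_; _∸_; _≤_; _<_; z≤n; s≤s; _⊔_)
open import Data.Nat.Properties
open import Data.Product using (Σ; ∃; _×_; _,_; proj₁; proj₂)
open import Data.Sum using (_⊎_; inj₁; inj₂; [_,_]′)
open import Data.Unit using (⊤; tt)
open import Data.Empty using (⊥; ⊥-elim)
open import Data.List using (List; []; _∷_; _++_; length; map; filter; reverse)
open import Data.List.Properties using (length-++; length-map)
open import Data.List.Membership.Propositional using (_∈_; _∉_)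
open import Data.List.Membership.Propositional.Properties using (∈-++⁺ˡ; ∈-++⁺ʳ; ∈-++⁻; ∈-map⁺; ∈-map⁻)
open import Data.List.Relation.Unary.Any using (here; there; Any)
open import Relation.Nullary using (¬_; Dec; yes; no)
open import Relation.Binary.Definitions using (tri<; tri≈; tri>)
open import Relation.Binary.PropositionalEquality
open import Function using (_∘_)
open import Function.Bundles using (_⇔_; mk⇔)
open import Axiom.ExcludedMiddle using (ExcludedMiddle)
open import Level using (0ℓ)

-- Transitivity extends some isomorphism between two copies, never a prescribed one. So each step
-- exhibits two copies of a k-vertex graph with so few symmetries that no isomorphism between them
-- can respect a given invariant; hence cliques, stars and induced paths. For paths the invariant is
-- a count. Suppose an induced path leaves a separator S at t, returns to S at s and goes on behind
-- s. An arm with equally many vertices that comes to s from another component can replace the part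
-- before s. Every separator between t and the last vertex still lies between the new ends, and so
-- does S, which contained t: the constant number would grow. A return too long for k vertices
-- contains a shorter one to another separator. In the gluing, a piece may be reversed while its
-- neighbour is not. This does no harm: a piece around a module is attached through this module
-- only, and a vertex between consecutive modules that is joined to one of them is joined to both.
-- The parity of k matters because reversal preserves only the middle of a path: three modules for
-- odd k make all triples alike, four for even k all pairs, and only the other kind has to be
-- aligned.

module Classical (em : ExcludedMiddle (Level.suc 0ℓ)) where
  open import Data.Bool using (Bool; true; false)
  open import Data.Vec using (Vec; []; _∷_)
  open import Data.Fin using (Fin; zero; suc)
  open import Data.List.Membership.Propositional.Properties using (∈-filter⁺; ∈-filter⁻)
  open import Data.List.Properties using (filter-notAll)
  open import Relation.Nullary.Decidable using (map′)
  open import Level using (Lift; lift; lower)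

  abstract
    dec : (A : Set) → Dec A
    dec A = map′ lower lift (em {Lift _ A})

  dne : {A : Set} → ¬ ¬ A → A
  dne {A} h with dec A
  ... | yes a = a
  ... | no ¬a = ⊥-elim (h ¬a)

  least : (P : ℕ → Set) → ∃ P → ∃ λ n → P n × (∀ m → P m → n ≤ m)
  least P (n , p) = go n 0 (+-identityʳ n) (λ m m<0 → ⊥-elim (n≮0 m<0))
    where
    go : ∀ d a → d + a ≡ n → (∀ m → m < a → ¬ P m) → ∃ λ n → P n × (∀ m → P m → n ≤ m)
    go zero a refl low = a , p , λ m pm → ≮⇒≥ λ m<a → low m m<a pm
    go (suc d) a eq low with dec (P a)
    ... | yes pa = a , pa , λ m pm → ≮⇒≥ λ m<a → low m m<a pm
    ... | no ¬pa = go d (suc a) (trans (+-suc d a) eq) low′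
      where
      low′ : ∀ m → m < suc a → ¬ P m
      low′ m (s≤s m≤a) pm with m≤n⇒m<n∨m≡n m≤a
      ... | inj₁ m<a = low m m<a pm
      ... | inj₂ refl = ¬pa pm

  -- Counting in lists, infinite sets, bounds over finite types

  module _ {A : Set} where

    keep : (A → Set) → List A → List A
    keep P = filter (λ x → dec (P x))

    ∈-keep⁺ : {P : A → Set} {xs : List A} {x : A} → x ∈ xs → P x → x ∈ keep P xs
    ∈-keep⁺ {P} = ∈-filter⁺ (λ x → dec (P x))

    ∈-keep⁻ : (P : A → Set) {xs : List A} {x : A} → x ∈ keep P xs → x ∈ xs × P x
    ∈-keep⁻ P = ∈-filter⁻ (λ x → dec (P x))

    keep-drops : (P : A → Set) {xs : List A} {x : A} → x ∈ xs → ¬ P x → length (keep P xs) < length xs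
    keep-drops P {xs} x∈ ¬p = filter-notAll (λ x → dec (P x)) xs (lose x∈)
      where
      lose : ∀ {ys} → _ ∈ ys → Any (λ y → ¬ P y) ys
      lose (here refl) = here ¬p
      lose (there q) = there (lose q)

    -- Incompatible properties never count the same entry twice. Inequalities between lengths of
    -- lists stand in for cardinalities throughout.
    keep-disjoint : (P Q : A → Set) (xs : List A) → (∀ {x} → x ∈ xs → P x → Q x → ⊥) →
      length (keep P xs) + length (keep Q xs) ≤ length xs
    keep-disjoint P Q [] d = z≤n
    keep-disjoint P Q (x ∷ xs) d with dec (P x) | dec (Q x)
    ... | yes p | yes q = ⊥-elim (d (here refl) p q)
    ... | yes p | no _ = s≤s (keep-disjoint P Q xs (d ∘ there))
    ... | no _ | yes q = subst (_≤ suc (length xs)) (sym (+-suc (length (keep P xs)) (length (keep Q xs))))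
                           (s≤s (keep-disjoint P Q xs (d ∘ there)))
    ... | no _ | no _ = m≤n⇒m≤1+n (keep-disjoint P Q xs (d ∘ there))

    keep-disjoint-strict : (P Q : A → Set) {xs : List A} → (∀ {x} → x ∈ xs → P x → Q x → ⊥) →
      ∀ {x} → x ∈ xs → ¬ P x → ¬ Q x → length (keep P xs) + length (keep Q xs) < length xs
    keep-disjoint-strict P Q {x ∷ xs} d (here refl) ¬p ¬q with dec (P x) | dec (Q x)
    ... | yes p | _ = ⊥-elim (¬p p)
    ... | no _ | yes q = ⊥-elim (¬q q)
    ... | no _ | no _ = s≤s (keep-disjoint P Q xs (d ∘ there))
    keep-disjoint-strict P Q {y ∷ xs} d (there x∈) ¬p ¬q with dec (P y) | dec (Q y)
    ... | yes p | yes q = ⊥-elim (d (here refl) p q)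
    ... | yes p | no _ = s≤s (keep-disjoint-strict P Q (d ∘ there) x∈ ¬p ¬q)
    ... | no _ | yes q = subst (_< suc (length xs)) (sym (+-suc (length (keep P xs)) (length (keep Q xs))))
                           (s≤s (keep-disjoint-strict P Q (d ∘ there) x∈ ¬p ¬q))
    ... | no _ | no _ = m≤n⇒m≤1+n (keep-disjoint-strict P Q (d ∘ there) x∈ ¬p ¬q)

    Infinite : (A → Set) → Set
    Infinite P = (L : List A) → ∃ λ x → P x × x ∉ L

    Finite : (A → Set) → Set
    Finite P = ∃ λ L → ∀ x → P x → x ∈ L

    ¬fin⇒inf : {P : A → Set} → ¬ Finite P → Infinite P
    ¬fin⇒inf h L = dne λ k → h (L , λ x px → dne λ x∉ → k (x , px , x∉))

    inf-mono : {P Q : A → Set} → (∀ {x} → P x → Q x) → Infinite P → Infinite Q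
    inf-mono f h L with h L
    ... | x , px , x∉ = x , f px , x∉

    inf-minus : {P : A → Set} (F : List A) → Infinite P → Infinite (λ x → P x × x ∉ F)
    inf-minus F h L with h (L ++ F)
    ... | x , px , x∉ = x , (px , λ q → x∉ (∈-++⁺ʳ L q)) , λ q → x∉ (∈-++⁺ˡ q)

    inf-split : {P : A → Set} (Q : A → Set) → Infinite P →
      Infinite (λ x → P x × Q x) ⊎ Infinite (λ x → P x × ¬ Q x)
    inf-split {P} Q h with dec (Infinite (λ x → P x × Q x))
    ... | yes i = inj₁ i
    ... | no ¬i = inj₂ (inf-mono g (inf-minus L h))
      where
      f : Finite (λ x → P x × Q x)
      f = dne λ k → ¬i (¬fin⇒inf k)
      L = proj₁ f
      g : ∀ {x} → P x × x ∉ L → P x × ¬ Q x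
      g (px , x∉) = px , λ q → x∉ (proj₂ f _ (px , q))

    inf-pigeon : {P : A → Set} (R : A → A → Set) (T : List A) → Infinite P →
      (∀ x → P x → ∃ λ t → t ∈ T × R t x) → ∃ λ t → t ∈ T × Infinite (λ x → P x × R t x)
    inf-pigeon R [] h c with h []
    ... | x , px , _ with c x px
    ... | _ , () , _
    inf-pigeon {P} R (t ∷ T) h c with inf-split (R t) h
    ... | inj₁ i = t , here refl , i
    ... | inj₂ i with inf-pigeon R T i c′
      where
      c′ : ∀ x → P x × ¬ R t x → ∃ λ s → s ∈ T × R s x
      c′ x (px , ¬r) with c x px
      ... | _ , here refl , r = ⊥-elim (¬r r)
      ... | s , there s∈ , r = s , s∈ , r
    ... | s , s∈ , j = s , there s∈ , inf-mono (λ { ((p , _) , r) → p , r }) j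

  -- Finiteness of a type in the only form used later: pointwise bounds for a monotone property
  -- become uniform. It passes to vectors, hence to adjacency matrices, without an enumeration.
  Bounding : Set → Set₁
  Bounding A = (R : A → ℕ → Set) → (∀ a {m n} → m ≤ n → R a m → R a n) →
    (∀ a → ∃ λ m → R a m) → ∃ λ m → ∀ a → R a m

  bound-Bool : Bounding Bool
  bound-Bool R mono h = proj₁ (h true) ⊔ proj₁ (h false) ,
    λ { true → mono true (m≤m⊔n (proj₁ (h true)) _) (proj₂ (h true))
      ; false → mono false (m≤n⊔m (proj₁ (h true)) _) (proj₂ (h false)) }

  bound-Fin : ∀ n → Bounding (Fin n)
  bound-Fin zero R mono h = 0 , λ ()
  bound-Fin (suc n) R mono h with bound-Fin n (λ i → R (suc i)) (λ i → mono (suc i)) (λ i → h (suc i))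
  ... | m , f = proj₁ (h zero) ⊔ m ,
    λ { zero → mono zero (m≤m⊔n (proj₁ (h zero)) _) (proj₂ (h zero))
      ; (suc i) → mono (suc i) (m≤n⊔m (proj₁ (h zero)) _) (f i) }

  bound-Vec : ∀ {A} → Bounding A → ∀ n → Bounding (Vec A n)
  bound-Vec b zero R mono h = proj₁ (h []) , λ { [] → proj₂ (h []) }
  bound-Vec b (suc n) R mono h
    with b (λ a m → ∀ v → R (a ∷ v) m) (λ a m≤n f v → mono (a ∷ v) m≤n (f v))
           (λ a → bound-Vec b n (λ v → R (a ∷ v)) (λ v → mono (a ∷ v)) (λ v → h (a ∷ v)))
  ... | m , f = m , λ { (a ∷ v) → f a v }

-- Connectivity inside vertex sets, rays, automorphisms

module Basics (em : ExcludedMiddle (Level.suc 0ℓ)) (G : Graph) where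
  open Classical em public
  open Graph G public
  open Ray using () renaming (seq to at; inj to at-inj; adj to at-adj) public
  open Aut using () renaming (to to infixl 20 _·_; from to bwd; to-from to ·-bwd; from-to to bwd-·; pres to ·-E; refl' to E-·) public

  Conn : (V → Set) → V → V → Set
  Conn = ConnIn G

  module _ {P : V → Set} where

    conn-left : ∀ {u v} → Conn P u v → P u
    conn-left (here p) = p
    conn-left (step p _ _) = p

    conn-right : ∀ {u v} → Conn P u v → P v
    conn-right (here p) = p
    conn-right (step _ _ c) = conn-right c

    conn-trans : ∀ {u v w} → Conn P u v → Conn P v w → Conn P u w
    conn-trans (here _) d = d
    conn-trans (step p e c) d = step p e (conn-trans c d)

    conn-snoc : ∀ {u v w} → Conn P u v → E v w → P w → Conn P u w
    conn-snoc c e p = conn-trans c (step (conn-right c) e (here p))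

    conn-sym : ∀ {u v} → Conn P u v → Conn P v u
    conn-sym (here p) = here p
    conn-sym (step p e c) = conn-snoc (conn-sym c) (E-sym e) p

    conn-edge : ∀ {u v} → P u → P v → E u v → Conn P u v
    conn-edge p q e = step p e (here q)

    conn-inv : ∀ {u v} (Q : V → Set) → (∀ {x y} → Q x → P x → P y → E x y → Q y) → Q u → Conn P u v → Q v
    conn-inv Q f q (here _) = q
    conn-inv Q f q (step p e c) = conn-inv Q f (f q p (conn-left c) e) c

    conn-mono : ∀ {Q : V → Set} {u v} → (∀ {x} → P x → Q x) → Conn P u v → Conn Q u v
    conn-mono f (here p) = here (f p)
    conn-mono f (step p e c) = step (f p) e (conn-mono f c)

    conn-within : ∀ {Q : V → Set} {u v} → (∀ {x} → Conn P u x → Q x) → Conn P u v → Conn Q u v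
    conn-within {Q} {u} {v} f c = go (here (conn-left c)) c
      where
      go : ∀ {w} → Conn P u w → Conn P w v → Conn Q w v
      go a (here p) = here (f a)
      go a (step p e c) = step (f a) e (go (conn-snoc a e (conn-left c)) c)

    abstract
      first-exit : ∀ {u v} (Q : V → Set) → Q u → ¬ Q v → Conn P u v →
        ∃ λ x → ∃ λ y → Q x × ¬ Q y × E x y × Conn (λ z → P z × Q z) u x × Conn P y v
      first-exit Q q nq (here p) = ⊥-elim (nq q)
      first-exit {u} Q q nq (step {v = w} p e c) with dec (Q w)
      ... | no nqw = u , w , q , nqw , e , here (p , q) , c
      ... | yes qw with first-exit Q qw nq c
      ... | x , y , qx , nqy , e′ , a , b = x , y , qx , nqy , e′ , step (p , q) e a , b

  -- Components are not formed as sets: a vertex `x` stands for its component in the subgraph on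
  -- `P`, and an end is seen only through tails of its rays.
  record Lives (P : V → Set) (ρ : Ray G) (x : V) : Set where
    constructor lv
    field
      start : ℕ
      from-start : ∀ i → start ≤ i → Conn P x (at ρ i)

  module _ {P : V → Set} where

    lives-unique : ∀ {ρ x y} → Lives P ρ x → Lives P ρ y → Conn P x y
    lives-unique (lv N f) (lv M g) = conn-trans (f (N ⊔ M) (m≤m⊔n N M)) (conn-sym (g (N ⊔ M) (m≤n⊔m N M)))

    lives-conn : ∀ {ρ x y} → Conn P x y → Lives P ρ x → Lives P ρ y
    lives-conn c (lv N f) = lv N λ i N≤i → conn-trans (conn-sym c) (f i N≤i)

    lives-left : ∀ {ρ x} → Lives P ρ x → P x
    lives-left (lv N f) = conn-left (f N ≤-refl)

  lives-mono : ∀ {P Q : V → Set} {ρ x} → (∀ {x} → P x → Q x) → Lives P ρ x → Lives Q ρ x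
  lives-mono f (lv N g) = lv N λ i N≤i → conn-mono f (g i N≤i)

  ray-conn : ∀ {P : V → Set} (ρ : Ray G) N → (∀ i → N ≤ i → P (at ρ i)) → ∀ i → N ≤ i → Conn P (at ρ N) (at ρ i)
  ray-conn {P} ρ N f i N≤i = subst (λ j → Conn P (at ρ N) (at ρ j)) (trans (+-comm (i ∸ N) N) (m+[n∸m]≡n N≤i)) (go (i ∸ N))
    where
    go : ∀ d → Conn P (at ρ N) (at ρ (d + N))
    go zero = here (f N ≤-refl)
    go (suc d) = conn-snoc (go d) (at-adj ρ (d + N)) (f (suc d + N) (m≤n+m N (suc d)))

  abstract
    ray-avoids : (ρ : Ray G) (L : List V) → ∃ λ N → ∀ i → N ≤ i → at ρ i ∉ L
    ray-avoids ρ [] = 0 , λ i _ ()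
    ray-avoids ρ (v ∷ L) with ray-avoids ρ L | dec (∃ λ j → at ρ j ≡ v)
    ... | N , f | no ¬j = N , λ { i N≤i (here eq) → ¬j (i , eq) ; i N≤i (there q) → f i N≤i q }
    ... | N , f | yes (j , eq) = N ⊔ suc j ,
      λ { i le (here eq′) → <-irrefl (at-inj ρ j i (trans eq (sym eq′))) (≤-trans (m≤n⊔m N (suc j)) le)
        ; i le (there q) → f i (≤-trans (m≤m⊔n N (suc j)) le) q }

  abstract
    ray-lives : ∀ {P : V → Set} (ρ : Ray G) (L : List V) → (∀ {x} → x ∉ L → P x) → ∃ λ x → Lives P ρ x
    ray-lives ρ L f with ray-avoids ρ L
    ... | N , g = at ρ N , lv N (ray-conn ρ N (λ i le → f (g i le)))

  ray-infinite : ∀ {Q : V → Set} (ρ : Ray G) N → (∀ i → N ≤ i → Q (at ρ i)) → Infinite Q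
  ray-infinite ρ N f L with ray-avoids ρ L
  ... | M , g = at ρ (N ⊔ M) , f _ (m≤m⊔n N M) , g _ (m≤n⊔m N M)

  ·-inj : (φ : Aut G) → ∀ {u v} → φ · u ≡ φ · v → u ≡ v
  ·-inj φ {u} {v} eq = trans (sym (bwd-· φ u)) (trans (cong (bwd φ) eq) (bwd-· φ v))

  inv : Aut G → Aut G
  inv φ = record
    { to = bwd φ ; from = φ ·_ ; to-from = bwd-· φ ; from-to = ·-bwd φ
    ; pres = λ u v e → E-· φ _ _ (subst₂ E (sym (·-bwd φ u)) (sym (·-bwd φ v)) e)
    ; refl' = λ u v e → subst₂ E (·-bwd φ u) (·-bwd φ v) (·-E φ _ _ e) }

  _⊙_ : Aut G → Aut G → Aut G
  φ ⊙ ψ = record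
    { to = λ v → φ · (ψ · v) ; from = λ v → bwd ψ (bwd φ v)
    ; to-from = λ v → trans (cong (φ ·_) (·-bwd ψ _)) (·-bwd φ v)
    ; from-to = λ v → trans (cong (bwd ψ) (bwd-· φ _)) (bwd-· ψ v)
    ; pres = λ u v e → ·-E φ _ _ (·-E ψ _ _ e)
    ; refl' = λ u v e → E-· ψ _ _ (E-· φ _ _ e) }

  ·-conn : ∀ {P Q : V → Set} (φ : Aut G) → (∀ {x} → P x → Q (φ · x)) → ∀ {u v} → Conn P u v → Conn Q (φ · u) (φ · v)
  ·-conn φ f (here p) = here (f p)
  ·-conn φ f (step p e c) = step (f p) (·-E φ _ _ e) (·-conn φ f c)

  ·-ray : Aut G → Ray G → Ray G
  ·-ray φ ρ = record
    { seq = λ i → φ · at ρ i ; inj = λ i j eq → at-inj ρ i j (·-inj φ eq)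
    ; adj = λ i → ·-E φ _ _ (at-adj ρ i) }

  ·-lives : ∀ {P Q : V → Set} (φ : Aut G) → (∀ {x} → P x → Q (φ · x)) → ∀ {ρ x} → Lives P ρ x → Lives Q (·-ray φ ρ) (φ · x)
  ·-lives φ f (lv N g) = lv N λ i le → ·-conn φ f (g i le)

-- Induced paths and their orbits

module Paths (em : ExcludedMiddle (Level.suc 0ℓ)) (G : Graph) where
  open import Data.List.Membership.Propositional.Properties using (∈-lookup)
  open import Data.Fin using (Fin; zero; suc; toℕ; cast; fromℕ)
  open import Data.Fin.Properties using (toℕ-injective; toℕ-cast; toℕ<n; toℕ-fromℕ)
  open import Data.List using (lookup; take)
  open import Data.List.Properties using (unfold-reverse; ++-assoc; length-reverse; ∷-injective)
  open import Data.List.Relation.Unary.Any.Properties using (reverse⁻)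
  open Basics em G public

  data IP : List V → Set where
    one : ∀ {x} → IP (x ∷ [])
    cons : ∀ {x y zs} → E x y → (∀ {z} → z ∈ zs → ¬ E x z) → x ∉ y ∷ zs → IP (y ∷ zs) → IP (x ∷ y ∷ zs)

  ip-suffix : ∀ as {s bs} → IP (as ++ s ∷ bs) → IP (s ∷ bs)
  ip-suffix [] p = p
  ip-suffix (a ∷ []) (cons _ _ _ p) = p
  ip-suffix (a ∷ b ∷ as) (cons _ _ _ p) = ip-suffix (b ∷ as) p

  ip-prefix : ∀ as {s bs} → IP (as ++ s ∷ bs) → IP (as ++ s ∷ [])
  ip-prefix [] p = one
  ip-prefix (a ∷ []) (cons e n x p) = cons e (λ ()) (λ { (here q) → x (here q) }) one
  ip-prefix (a ∷ b ∷ as) {s} {bs} (cons e n x p) =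
    cons e (λ q → n (widen q)) (λ { (here q) → x (here q) ; (there q) → x (there (widen q)) }) (ip-prefix (b ∷ as) p)
    where
    widen : ∀ {z} → z ∈ as ++ s ∷ [] → z ∈ as ++ s ∷ bs
    widen q with ∈-++⁻ as q
    ... | inj₁ r = ∈-++⁺ˡ r
    ... | inj₂ (here r) = ∈-++⁺ʳ as (here r)

  ip-head∉ : ∀ {x xs} → IP (x ∷ xs) → x ∉ xs
  ip-head∉ (cons _ _ x∉ _) q = x∉ q

  ip-init : ∀ {x} ws {bs} → IP (x ∷ ws ++ bs) → IP (x ∷ ws)
  ip-init [] p = one
  ip-init (w ∷ ws) (cons e n x p) =
    cons e (λ q → n (∈-++⁺ˡ q)) (λ { (here q) → x (here q) ; (there q) → x (there (∈-++⁺ˡ q)) }) (ip-init ws p)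

  ip-tail : ∀ {x} ws {u bs} → IP (x ∷ ws ++ u ∷ bs) → IP (ws ++ u ∷ bs)
  ip-tail [] (cons _ _ _ p) = p
  ip-tail (w ∷ ws) (cons _ _ _ p) = p

  take-⊂ : ∀ {A : Set} m (xs : List A) {z} → z ∈ take m xs → z ∈ xs
  take-⊂ (suc m) (x ∷ xs) (here q) = here q
  take-⊂ (suc m) (x ∷ xs) (there q) = there (take-⊂ m xs q)

  ip-take : ∀ m {x xs} → IP (x ∷ xs) → IP (x ∷ take m xs)
  ip-take zero p = one
  ip-take (suc m) one = one
  ip-take (suc m) {xs = y ∷ zs} (cons e n x p) =
    cons e (n ∘ take-⊂ m zs) (λ { (here q) → x (here q) ; (there q) → x (there (take-⊂ m zs q)) }) (ip-take m p)

  -- In applications a separator through `s` keeps `as` and `bs` apart; this is how arms in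
  -- different components are put together.
  ip-join : ∀ as {s bs} → IP (as ++ s ∷ []) → IP (s ∷ bs) →
    (∀ {a b} → a ∈ as → b ∈ bs → ¬ E a b × a ≢ b) → IP (as ++ s ∷ bs)
  ip-join [] p q f = q
  ip-join (a ∷ []) (cons e n x p) q f =
    cons e (λ r → proj₁ (f (here refl) r)) (λ { (here r) → x (here r) ; (there r) → proj₂ (f (here refl) r) refl }) q
  ip-join (a ∷ b ∷ as) {s} {bs} (cons e n x p) q f =
    cons e n′ x′ (ip-join (b ∷ as) p q (λ r → f (there r)))
    where
    n′ : ∀ {z} → z ∈ as ++ s ∷ bs → ¬ E a z
    n′ r with ∈-++⁻ as r
    ... | inj₁ r′ = n (∈-++⁺ˡ r′)
    ... | inj₂ (here r′) = n (∈-++⁺ʳ as (here r′))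
    ... | inj₂ (there r′) = proj₁ (f (here refl) r′)
    x′ : a ∉ b ∷ as ++ s ∷ bs
    x′ (here r) = x (here r)
    x′ (there r) with ∈-++⁻ as r
    ... | inj₁ r′ = x (there (∈-++⁺ˡ r′))
    ... | inj₂ (here r′) = x (there (∈-++⁺ʳ as (here r′)))
    ... | inj₂ (there r′) = proj₂ (f (here refl) r′) refl

  ip-reverse : ∀ {xs} → IP xs → IP (reverse xs)
  ip-reverse one = one
  ip-reverse (cons {x} {y} {zs} e n x∉ p) = subst IP eq
    (ip-join (reverse zs) (subst IP (unfold-reverse y zs) (ip-reverse p))
      (cons (E-sym e) (λ ()) (λ { (here q) → x∉ (here (sym q)) }) one)
      (λ { a∈ (here refl) → (λ e′ → n (reverse⁻ a∈) (E-sym e′)) , λ { refl → x∉ (there (reverse⁻ a∈)) } }))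
    where
    eq : reverse zs ++ y ∷ x ∷ [] ≡ reverse (x ∷ y ∷ zs)
    eq = sym (trans (unfold-reverse x (y ∷ zs)) (trans (cong (_++ x ∷ []) (unfold-reverse y zs)) (++-assoc (reverse zs) (y ∷ []) (x ∷ []))))

  ip-map : (φ : Aut G) → ∀ {xs} → IP xs → IP (map (φ ·_) xs)
  ip-map φ one = one
  ip-map φ (cons {x} {y} {zs} e n x∉ p) = cons (·-E φ _ _ e) n′ x′ (ip-map φ p)
    where
    n′ : ∀ {z} → z ∈ map (φ ·_) zs → ¬ E (φ · x) z
    n′ q with ∈-map⁻ (φ ·_) q
    ... | w , w∈ , refl = λ e′ → n w∈ (E-· φ _ _ e′)
    x′ : φ · x ∉ map (φ ·_) (y ∷ zs)
    x′ q with ∈-map⁻ (φ ·_) q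
    ... | w , w∈ , eq = x∉ (subst (_∈ y ∷ zs) (sym (·-inj φ eq)) w∈)

  ip-conn : ∀ {P : V → Set} {x xs} → IP (x ∷ xs) → (∀ {y} → y ∈ x ∷ xs → P y) → ∀ {y} → y ∈ x ∷ xs → Conn P x y
  ip-conn p f (here refl) = here (f (here refl))
  ip-conn (cons e _ _ p) f (there q) = step (f (here refl)) e (ip-conn p (f ∘ there) q)

  Step : ℕ → ℕ → Set
  Step a b = b ≡ suc a ⊎ a ≡ suc b

  ip-step : ∀ {xs} → IP xs → ∀ i j → E (lookup xs i) (lookup xs j) → Step (toℕ i) (toℕ j)
  ip-step one zero zero e = ⊥-elim (E-irr e)
  ip-step (cons _ _ _ p) zero zero e = ⊥-elim (E-irr e)
  ip-step (cons _ _ _ p) zero (suc zero) e = inj₁ refl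
  ip-step (cons {zs = zs} _ n _ p) zero (suc (suc j)) e = ⊥-elim (n (∈-lookup j) e)
  ip-step (cons _ _ _ p) (suc zero) zero e = inj₂ refl
  ip-step (cons {zs = zs} _ n _ p) (suc (suc i)) zero e = ⊥-elim (n (∈-lookup i) (E-sym e))
  ip-step (cons _ _ _ p) (suc i) (suc j) e with ip-step p i j e
  ... | inj₁ q = inj₁ (cong suc q)
  ... | inj₂ q = inj₂ (cong suc q)

  step-ip : ∀ {xs} → IP xs → ∀ i j → Step (toℕ i) (toℕ j) → E (lookup xs i) (lookup xs j)
  step-ip {x ∷ xs} p zero zero (inj₁ ())
  step-ip {x ∷ xs} p zero zero (inj₂ ())
  step-ip (cons e _ _ p) zero (suc zero) q = e
  step-ip (cons e _ _ p) zero (suc (suc j)) (inj₁ ())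
  step-ip (cons e _ _ p) zero (suc (suc j)) (inj₂ ())
  step-ip (cons e _ _ p) (suc zero) zero q = E-sym e
  step-ip (cons e _ _ p) (suc (suc i)) zero (inj₁ ())
  step-ip (cons e _ _ p) (suc (suc i)) zero (inj₂ ())
  step-ip (cons e _ _ p) (suc i) (suc j) (inj₁ q) = step-ip p i j (inj₁ (suc-injective q))
  step-ip (cons e _ _ p) (suc i) (suc j) (inj₂ q) = step-ip p i j (inj₂ (suc-injective q))

  ip-inj : ∀ {xs} → IP xs → InjectiveFin G (lookup xs)
  ip-inj {x ∷ xs} p zero zero eq = refl
  ip-inj (cons {y = y} {zs} _ _ x∉ p) zero (suc j) eq = ⊥-elim (x∉ (subst (_∈ y ∷ zs) (sym eq) (∈-lookup j)))
  ip-inj (cons {y = y} {zs} _ _ x∉ p) (suc i) zero eq = ⊥-elim (x∉ (subst (_∈ y ∷ zs) eq (∈-lookup i)))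
  ip-inj (cons _ _ _ p) (suc i) (suc j) eq = cong suc (ip-inj p i j eq)

  ci-trans : ∀ {m} {f : Fin m → V} {i j l} → ConnInduced G f i j → ConnInduced G f j l → ConnInduced G f i l
  ci-trans here d = d
  ci-trans (step e c) d = step e (ci-trans c d)

  ci-lift : ∀ {m} {f : Fin (suc m) → V} {i j} → ConnInduced G (f ∘ suc) i j → ConnInduced G f (suc i) (suc j)
  ci-lift here = here
  ci-lift (step e c) = step e (ci-lift c)

  ci-add : ∀ {m} {f : Fin (suc m) → V} {i} → E (f zero) (f (suc i)) → InducedConnected G (f ∘ suc) → InducedConnected G f
  ci-add e c zero zero = here
  ci-add e c zero (suc j) = step e (ci-lift (c _ j))
  ci-add e c (suc i) zero = ci-trans (ci-lift (c i _)) (step (E-sym e) here)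
  ci-add e c (suc i) (suc j) = ci-lift (c i j)

  ip-ci : ∀ {xs} → IP xs → InducedConnected G (lookup xs)
  ip-ci one zero zero = here
  ip-ci (cons e _ _ p) = ci-add {i = zero} e (ip-ci p)

  -- The permutation `σ` is unavoidable: transitivity extends some isomorphism between the two
  -- copies, not the one that is offered.
  record Match {m} (f g : Fin m → V) : Set where
    field
      aut : Aut G
      σ τ : Fin m → Fin m
      τσ : ∀ i → τ (σ i) ≡ i
      στ : ∀ i → σ (τ i) ≡ i
      on : ∀ i → aut · f i ≡ g (σ i)

  abstract
    match : ∀ {m} → CSTransitive G m → (f g : Fin m → V) → InjectiveFin G f → InjectiveFin G g → InducedConnected G f →
      (∀ i j → E (f i) (f j) → E (g i) (g j)) → (∀ i j → E (g i) (g j) → E (f i) (f j)) → Match f g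
    match cs f g inj-f inj-g cf fg gf with cs f g inj-f inj-g cf (λ i j → carry (cf i j))
        ((λ i → i) , ((λ i → i) , (λ _ → refl) , (λ _ → refl)) , fg , gf)
      where
      carry : ∀ {i j} → ConnInduced G f i j → ConnInduced G g i j
      carry here = here
      carry (step e c) = step (fg _ _ e) (carry c)
    ... | σ , ((τ , τσ , στ) , _) , φ , on = record { aut = φ ; σ = σ ; τ = τ ; τσ = τσ ; στ = στ ; on = on }

  infixr 5 _◂_
  _◂_ : ∀ {m} → V → (Fin m → V) → Fin (suc m) → V
  (x ◂ f) zero = x
  (x ◂ f) (suc i) = f i

  Clique : ∀ {m} → (Fin m → V) → Set
  Clique f = ∀ i j → i ≢ j → E (f i) (f j)

  clique-inj : ∀ {m} {f : Fin m → V} → Clique f → InjectiveFin G f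
  clique-inj {f = f} cl i l eq with i Data.Fin.≟ l
  ... | yes q = q
  ... | no ne = ⊥-elim (E-irr (subst (E (f i)) (sym eq) (cl i l ne)))

  clique-match : ∀ {m} → CSTransitive G m → {f g : Fin m → V} → Clique f → Clique g → Match f g
  clique-match cs {f} {g} cf cg = match cs f g (clique-inj cf) (clique-inj cg) con
    (λ i l e → cg i l λ { refl → E-irr e }) (λ i l e → cf i l λ { refl → E-irr e })
    where
    con : InducedConnected G f
    con i l with i Data.Fin.≟ l
    ... | yes refl = here
    ... | no ne = step (cf i l ne) here

  private
    -- Once the first step goes up, injectivity forbids turning back; `down` is the mirror image.
    up : ∀ {m} (s : Fin (suc (suc m)) → ℕ) → (∀ i j → s i ≡ s j → i ≡ j) →
      (∀ i j → Step (toℕ i) (toℕ j) → Step (s i) (s j)) → s (suc zero) ≡ suc (s zero) → ∀ i → s i ≡ s zero + toℕ i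
    up s inj-s st eq zero = sym (+-identityʳ _)
    up s inj-s st eq (suc zero) = trans eq (sym (+-comm (s zero) 1))
    up {suc m} s inj-s st eq (suc (suc i)) with st (suc zero) (suc (suc zero)) (inj₁ refl)
    ... | inj₂ q with inj-s zero (suc (suc zero)) (suc-injective (trans (sym eq) q))
    ... | ()
    up {suc m} s inj-s st eq (suc (suc i)) | inj₁ q =
      trans (up (s ∘ suc) (λ a b r → suc-inj (inj-s (suc a) (suc b) r)) (λ a b → st′ a b) q (suc i))
            (trans (cong (_+ suc (toℕ i)) eq) (sym (+-suc (s zero) (suc (toℕ i)))))
      where
      suc-inj : ∀ {l} {a b : Fin l} → Fin.suc a ≡ suc b → a ≡ b
      suc-inj refl = refl
      st′ : ∀ a b → Step (toℕ a) (toℕ b) → Step (s (suc a)) (s (suc b))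
      st′ a b (inj₁ r) = st (suc a) (suc b) (inj₁ (cong suc r))
      st′ a b (inj₂ r) = st (suc a) (suc b) (inj₂ (cong suc r))

    down : ∀ {m} (s : Fin (suc (suc m)) → ℕ) → (∀ i j → s i ≡ s j → i ≡ j) →
      (∀ i j → Step (toℕ i) (toℕ j) → Step (s i) (s j)) → s zero ≡ suc (s (suc zero)) → ∀ i → s i + toℕ i ≡ s zero
    down s inj-s st eq zero = +-identityʳ _
    down s inj-s st eq (suc zero) = trans (+-comm (s (suc zero)) 1) (sym eq)
    down {suc m} s inj-s st eq (suc (suc i)) with st (suc zero) (suc (suc zero)) (inj₁ refl)
    ... | inj₁ q with inj-s zero (suc (suc zero)) (trans eq (sym q))
    ... | ()
    down {suc m} s inj-s st eq (suc (suc i)) | inj₂ q =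
      trans (+-suc (s (suc (suc i))) (suc (toℕ i))) (trans (cong suc
            (down (s ∘ suc) (λ a b r → suc-inj (inj-s (suc a) (suc b) r)) (λ a b → st′ a b) q (suc i))) (sym eq))
      where
      suc-inj : ∀ {l} {a b : Fin l} → Fin.suc a ≡ suc b → a ≡ b
      suc-inj refl = refl
      st′ : ∀ a b → Step (toℕ a) (toℕ b) → Step (s (suc a)) (s (suc b))
      st′ a b (inj₁ r) = st (suc a) (suc b) (inj₁ (cong suc r))
      st′ a b (inj₂ r) = st (suc a) (suc b) (inj₂ (cong suc r))

  -- The direction of the first step decides everything, and since the values stay between 0 and
  -- `m`, a rising sequence must start at 0 and a falling one at `m`. So a path has only these two
  -- symmetries.
  step-perm : ∀ {m} (σ : Fin (suc m) → Fin (suc m)) → (∀ i j → σ i ≡ σ j → i ≡ j) →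
    (∀ i j → Step (toℕ i) (toℕ j) → Step (toℕ (σ i)) (toℕ (σ j))) →
    (∀ i → toℕ (σ i) ≡ toℕ i) ⊎ (∀ i → toℕ (σ i) + toℕ i ≡ m)
  step-perm {zero} σ inj-σ st = inj₁ λ { zero → lem (σ zero) }
    where
    lem : (i : Fin 1) → toℕ i ≡ 0
    lem zero = refl
  step-perm {suc m} σ inj-σ st with st zero (suc zero) (inj₁ refl)
  ... | inj₁ q = inj₁ λ i → trans (u i) (cong (_+ toℕ i) s0)
    where
    u = up (toℕ ∘ σ) (λ i j r → inj-σ i j (toℕ-injective r)) st q
    s0 : toℕ (σ zero) ≡ 0
    s0 = n≤0⇒n≡0 (+-cancelʳ-≤ (suc m) (toℕ (σ zero)) 0
      (subst (_≤ suc m) (trans (u (fromℕ (suc m))) (cong (toℕ (σ zero) +_) (toℕ-fromℕ (suc m)))) (≤-pred (toℕ<n (σ (fromℕ (suc m)))))))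
  ... | inj₂ q = inj₂ λ i → trans (d i) s0
    where
    d = down (toℕ ∘ σ) (λ i j r → inj-σ i j (toℕ-injective r)) st q
    s0 : toℕ (σ zero) ≡ suc m
    s0 = ≤-antisym (≤-pred (toℕ<n (σ zero)))
      (subst (suc m ≤_) (trans (cong (toℕ (σ (fromℕ (suc m))) +_) (sym (toℕ-fromℕ (suc m)))) (d (fromℕ (suc m)))) (m≤n+m (suc m) _))

  map≡-at : ∀ (h : V → V) (xs ys : List V) → length xs ≡ length ys →
    (∀ i j → toℕ i ≡ toℕ j → h (lookup xs i) ≡ lookup ys j) → map h xs ≡ ys
  map≡-at h [] [] _ f = refl
  map≡-at h (x ∷ xs) (y ∷ ys) len f = cong₂ _∷_ (f zero zero refl)
    (map≡-at h xs ys (suc-injective len) (λ i j eq → f (suc i) (suc j) (cong suc eq)))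

  -- A total lookup with default `d`, so that positions in a list and in its reversal can be
  -- compared as plain numbers.
  nth : V → List V → ℕ → V
  nth d [] i = d
  nth d (x ∷ xs) zero = x
  nth d (x ∷ xs) (suc i) = nth d xs i

  nth-lookup : ∀ d xs (i : Fin (length xs)) → nth d xs (toℕ i) ≡ lookup xs i
  nth-lookup d (x ∷ xs) zero = refl
  nth-lookup d (x ∷ xs) (suc i) = nth-lookup d xs i

  nth-++ˡ : ∀ d xs ys i → i < length xs → nth d (xs ++ ys) i ≡ nth d xs i
  nth-++ˡ d (x ∷ xs) ys zero _ = refl
  nth-++ˡ d (x ∷ xs) ys (suc i) (s≤s lt) = nth-++ˡ d xs ys i lt

  nth-++ʳ : ∀ d xs ys → nth d (xs ++ ys) (length xs) ≡ nth d ys 0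
  nth-++ʳ d [] ys = refl
  nth-++ʳ d (x ∷ xs) ys = nth-++ʳ d xs ys

  nth-reverse : ∀ d ys i j → suc (i + j) ≡ length ys → nth d (reverse ys) i ≡ nth d ys j
  nth-reverse d (y ∷ ys) i zero eq = trans (cong (λ zs → nth d zs i) (unfold-reverse y ys))
    (trans (cong (nth d (reverse ys ++ y ∷ [])) (trans (sym (+-identityʳ i)) (trans (suc-injective eq) (sym (length-reverse ys)))))
           (nth-++ʳ d (reverse ys) (y ∷ [])))
  nth-reverse d (y ∷ ys) i (suc j) eq = trans (cong (λ zs → nth d zs i) (unfold-reverse y ys))
    (trans (nth-++ˡ d (reverse ys) (y ∷ []) i (subst (i <_) (sym (length-reverse ys)) (subst (suc i ≤_) eq′ (s≤s (m≤m+n i j)))))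
           (nth-reverse d ys i j eq′))
    where
    eq′ : suc (i + j) ≡ length ys
    eq′ = suc-injective (trans (cong suc (sym (+-suc i j))) eq)

  path-equiv′ : ∀ xs ys → CSTransitive G (length xs) → IP xs → IP ys → length xs ≡ length ys →
    Σ (Aut G) λ φ → map (φ ·_) xs ≡ ys ⊎ map (φ ·_) xs ≡ reverse ys
  path-equiv′ (x ∷ xs) ys cs p q len = aut , orient (step-perm σ inj-σ st-σ)
    where
    g : Fin (length (x ∷ xs)) → V
    g i = lookup ys (cast len i)
    fg : ∀ i j → E (lookup (x ∷ xs) i) (lookup (x ∷ xs) j) → E (g i) (g j)
    fg i j e = step-ip q _ _ (subst₂ Step (sym (toℕ-cast len i)) (sym (toℕ-cast len j)) (ip-step p i j e))
    gf : ∀ i j → E (g i) (g j) → E (lookup (x ∷ xs) i) (lookup (x ∷ xs) j)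
    gf i j e = step-ip p i j (subst₂ Step (toℕ-cast len i) (toℕ-cast len j) (ip-step q _ _ e))
    inj-g : InjectiveFin G g
    inj-g i j eq = toℕ-injective (trans (sym (toℕ-cast len i)) (trans (cong toℕ (ip-inj q _ _ eq)) (toℕ-cast len j)))
    open Match (match cs (lookup (x ∷ xs)) g (ip-inj p) inj-g (ip-ci p) fg gf)
    inj-σ : ∀ i j → σ i ≡ σ j → i ≡ j
    inj-σ i j eq = trans (sym (τσ i)) (trans (cong τ eq) (τσ j))
    st-σ : ∀ i j → Step (toℕ i) (toℕ j) → Step (toℕ (σ i)) (toℕ (σ j))
    st-σ i j s = ip-step p (σ i) (σ j) (gf (σ i) (σ j) (subst₂ E (on i) (on j) (·-E aut _ _ (step-ip p i j s))))
    orient : (∀ i → toℕ (σ i) ≡ toℕ i) ⊎ (∀ i → toℕ (σ i) + toℕ i ≡ length xs) →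
      map (aut ·_) (x ∷ xs) ≡ ys ⊎ map (aut ·_) (x ∷ xs) ≡ reverse ys
    orient (inj₁ h) = inj₁ (map≡-at (aut ·_) (x ∷ xs) ys len λ i j eq →
      trans (on i) (cong (lookup ys) (toℕ-injective (trans (toℕ-cast len (σ i)) (trans (h i) eq)))))
    orient (inj₂ h) = inj₂ (map≡-at (aut ·_) (x ∷ xs) (reverse ys) (trans len (sym (length-reverse ys))) λ i j eq →
      trans (on i) (trans (sym (nth-lookup x ys (cast len (σ i))))
        (trans (sym (nth-reverse x ys (toℕ j) (toℕ (cast len (σ i)))
                 (trans (cong suc (trans (cong₂ _+_ (sym eq) (toℕ-cast len (σ i))) (trans (+-comm (toℕ i) _) (h i)))) len)))
               (nth-lookup x (reverse ys) j))))

  abstract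
    -- A path has no symmetry except its reversal, so the unknown permutation in `Match` costs only
    -- the direction.
    path-equiv : ∀ {k} → CSTransitive G k → ∀ {xs ys} → IP xs → IP ys → length xs ≡ k → length ys ≡ k →
      Σ (Aut G) λ φ → map (φ ·_) xs ≡ ys ⊎ map (φ ·_) xs ≡ reverse ys
    path-equiv cs {xs} {ys} p q refl eq = path-equiv′ xs ys cs p q (sym eq)

  -- The induced path is found by shortcutting: keep the last neighbour of the new vertex.
  InducedPath : (V → Set) → V → V → Set
  InducedPath P u v = ∃ λ ws → (∃ λ zs → u ∷ ws ≡ zs ++ v ∷ []) × IP (u ∷ ws) × (∀ {x} → x ∈ u ∷ ws → P x)

  -- Besides neighbours, this also serves to find the last vertex of a path in a separator.
  last-nbr : ∀ (R : V → Set) xs → (∃ λ x → x ∈ xs × R x) →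
    ∃ λ as → ∃ λ w → ∃ λ bs → xs ≡ as ++ w ∷ bs × R w × (∀ {b} → b ∈ bs → ¬ R b)
  last-nbr R (x ∷ xs) h with dec (∃ λ y → y ∈ xs × R y)
  ... | yes h′ with last-nbr R xs h′
  ... | as , w , bs , refl , r , nr = x ∷ as , w , bs , refl , r , nr
  last-nbr R (x ∷ xs) (y , here refl , r) | no k = [] , x , xs , refl , r , λ b∈ rb → k (_ , b∈ , rb)
  last-nbr R (x ∷ xs) (y , there y∈ , r) | no k = ⊥-elim (k (y , y∈ , r))

  ends-suffix : ∀ {u v w : V} ws as bs → (∃ λ zs → u ∷ ws ≡ zs ++ v ∷ []) → u ∷ ws ≡ as ++ w ∷ bs →
    ∃ λ zs → w ∷ bs ≡ zs ++ v ∷ []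
  ends-suffix ws [] bs h refl = h
  ends-suffix (y ∷ ws) (a ∷ as) bs ([] , ()) eq
  ends-suffix [] (a ∷ []) bs h ()
  ends-suffix [] (a ∷ b ∷ as) bs h ()
  ends-suffix (y ∷ ws) (a ∷ as) bs (z ∷ zs , eq) eq′ =
    ends-suffix ws as bs (zs , proj₂ (∷-injective eq)) (proj₂ (∷-injective eq′))

  induced-path : ∀ {P u v} → Conn P u v → InducedPath P u v
  induced-path (here p) = [] , ([] , refl) , one , λ { (here refl) → p }
  induced-path {P} {u} (step p e c) with induced-path c
  ... | ws , ends , ip , all with last-nbr (λ x → u ≡ x ⊎ E u x) (_ ∷ ws) (_ , here refl , inj₂ e)
  ... | as , w , bs , eq , inj₁ refl , nr = bs , ends-suffix ws as bs ends eq , ip-suffix as (subst IP eq ip) ,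
          λ q → all (subst (_ ∈_) (sym eq) (∈-++⁺ʳ as q))
  ... | as , w , bs , eq , inj₂ uw , nr = w ∷ bs , (u ∷ proj₁ es , cong (u ∷_) (proj₂ es)) ,
          cons uw (λ b∈ ub → nr b∈ (inj₂ ub)) (λ { (here refl) → E-irr uw ; (there q) → nr q (inj₁ refl) })
            (ip-suffix as (subst IP eq ip)) , λ { (here refl) → p ; (there q) → all (subst (_ ∈_) (sym eq) (∈-++⁺ʳ as q)) }
    where
    es = ends-suffix ws as bs ends eq

-- Separators of least order

module Separators (em : ExcludedMiddle (Level.suc 0ℓ)) (G : Graph) (more : MoreThanOneEnd G) where
  open Paths em G public

  C : List V → V → V → Set
  C S = Conn (Avoid G S)

  In : List V → Ray G → V → Set
  In S = Lives (Avoid G S)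

  Splits : List V → Ray G → Ray G → Set
  Splits S ρ σ = ∃ λ x → ∃ λ y → In S ρ x × In S σ y × ¬ C S x y

  abstract
    lives : ∀ S ρ → ∃ λ x → In S ρ x
    lives S ρ = ray-lives ρ S (λ x∉ → x∉)

  some-split : ∃ λ S → ∃ λ ρ → ∃ λ σ → Splits S ρ σ
  some-split = dne λ k → proj₂ (proj₂ more) λ S → equiv S (proj₂ (lives S ρ)) (proj₂ (lives S σ)) (k′ k S)
    where
    ρ = proj₁ more
    σ = proj₁ (proj₂ more)
    k′ : ¬ (∃ λ S → ∃ λ ρ → ∃ λ σ → Splits S ρ σ) → ∀ S → C S (proj₁ (lives S ρ)) (proj₁ (lives S σ))
    k′ k S = dne λ nc → k (S , ρ , σ , _ , _ , proj₂ (lives S ρ) , proj₂ (lives S σ) , nc)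
    equiv : ∀ S {x y} → In S ρ x → In S σ y → C S x y →
            ∃ λ N → ∀ i j → N ≤ i → N ≤ j → C S (at ρ i) (at σ j)
    equiv S (lv N f) (lv M g) c = N ⊔ M , λ i j p q →
      conn-trans (conn-sym (f i (≤-trans (m≤m⊔n N M) p))) (conn-trans c (g j (≤-trans (m≤n⊔m N M) q)))

  abstract
    private
      order : ∃ λ m → (∃ λ S → length S ≡ m × ∃ λ ρ → ∃ λ σ → Splits S ρ σ) ×
                      (∀ k → (∃ λ S → length S ≡ k × ∃ λ ρ → ∃ λ σ → Splits S ρ σ) → m ≤ k)
      order = least _ (_ , proj₁ some-split , refl , proj₂ some-split)

    n : ℕ
    n = proj₁ order

    some-sep′ : ∃ λ S → length S ≡ n × ∃ λ ρ → ∃ λ σ → Splits S ρ σ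
    some-sep′ = proj₁ (proj₂ order)

    n-min : ∀ {F ρ σ} → Splits F ρ σ → n ≤ length F
    n-min sp = proj₂ (proj₂ order) _ (_ , refl , _ , _ , sp)

  record IsSep (S : List V) : Set where
    constructor mkSep
    field
      sep-size : length S ≡ n
      sep-cut : ∃ λ ρ → ∃ λ σ → Splits S ρ σ
  open IsSep public

  some-sep : ∃ IsSep
  some-sep = proj₁ some-sep′ , mkSep (proj₁ (proj₂ some-sep′)) (proj₂ (proj₂ some-sep′))

  -- Minimality of `n` controls only the components that contain an end.
  Big : List V → V → Set
  Big S x = ∃ λ ρ → In S ρ x

  big-conn : ∀ {S x y} → C S x y → Big S x → Big S y
  big-conn c (ρ , l) = ρ , lives-conn c l

  big∉ : ∀ {S x} → Big S x → x ∉ S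
  big∉ (ρ , l) = lives-left l

  abstract
    other-big : ∀ {S} → IsSep S → ∀ x → ∃ λ y → Big S y × ¬ C S x y
    other-big {S} (mkSep _ (ρ , σ , a , b , la , lb , nc)) x with dec (C S x a)
    ... | no ¬c = a , (ρ , la) , ¬c
    ... | yes c = b , (σ , lb) , λ d → nc (conn-trans (conn-sym c) d)

  -- If the component of `x` sent no edge to `s`, it would remain a component after `s` is dropped
  -- from `S`, and the smaller set would still separate two ends.
  tight : ∀ {S x s} → IsSep S → Big S x → s ∈ S → ∃ λ y → C S x y × E y s
  tight {S} {x} {s} sep (ρ , lx) s∈ = dne absurd
    where
    F = keep (_≢ s) S
    F⊂ : ∀ {v} → v ∉ S → v ∉ F
    F⊂ v∉ q = v∉ (proj₁ (∈-keep⁻ (_≢ s) q))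
    absurd : ¬ ¬ (∃ λ y → C S x y × E y s)
    absurd none with other-big sep x
    ... | y , (σ , ly) , nc = <-irrefl refl (≤-<-trans (n-min sp) (subst (length F <_) (sep-size sep)
                                 (keep-drops (_≢ s) s∈ (λ q → q refl))))
      where
      stay : ∀ {z w} → C S x z → z ∉ F → w ∉ F → E z w → C S x w
      stay {z} {w} c _ w∉ e = conn-snoc c e λ w∈ → w∉ (∈-keep⁺ w∈ λ { refl → none (z , c , e) })
      sp : Splits F ρ σ
      sp = x , y , lives-mono F⊂ lx , lives-mono F⊂ ly ,
           λ d → nc (conn-inv (C S x) stay (here (lives-left lx)) d)

  -- `X` contains the boundary of the intersection of the components of `c` and `c′`. This
  -- intersection holds a tail of `ρ` and, by `nc`, no tail of `σ`.
  corner-splits : ∀ {S S′ ρ σ c d c′} X → In S ρ c → In S σ d → ¬ C S c d → In S′ ρ c′ →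
    (∀ {v} → v ∈ X → v ∈ S ⊎ v ∈ S′) → (∀ {v} → v ∈ S → C S′ c′ v → v ∈ X) →
    (∀ {v} → v ∈ S → v ∈ S′ → v ∈ X) → (∀ {v} → v ∈ S′ → C S c v → v ∈ X) → Splits X ρ σ
  corner-splits {S} {S′} {ρ} {σ} {c} {d} {c′} X (lv N f) (lv M g) nc (lv N′ f′) X⊂ p q r =
    at ρ K , y , lv K (λ i le → ray-conn ρ K (λ j le′ → off (f j (≤-trans (m≤m⊔n N N′) le′)) (f′ j (≤-trans (m≤n⊔m N N′) le′))) i le)
    , ly , apart ly
    where
    K = N ⊔ N′
    y = proj₁ (lives X σ)
    ly = proj₂ (lives X σ)
    off : ∀ {z} → C S c z → C S′ c′ z → z ∉ X
    off a a′ z∈ = [ conn-right a , conn-right a′ ]′ (X⊂ z∈)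
    stay : ∀ {z w} → C S c z × C S′ c′ z → z ∉ X → w ∉ X → E z w → C S c w × C S′ c′ w
    stay {z} {w} (a , a′) _ w∉ e = b , conn-snoc a′ e w∉S′
      where
      w∉S : w ∉ S
      w∉S w∈ with dec (w ∈ S′)
      ... | yes w∈′ = w∉ (q w∈ w∈′)
      ... | no w∉′ = w∉ (p w∈ (conn-snoc a′ e w∉′))
      b = conn-snoc a e w∉S
      w∉S′ : w ∉ S′
      w∉S′ w∈ = w∉ (r w∈ b)
    apart : ∀ {y} → In X σ y → ¬ C X (at ρ K) y
    apart (lv M′ h) con = nc (conn-trans (proj₁ both) (conn-sym (g (M ⊔ M′) (m≤m⊔n M M′))))
      where
      both = conn-inv (λ z → C S c z × C S′ c′ z) stay
               (f K (m≤m⊔n N N′) , f′ K (m≤n⊔m N N′)) (conn-trans con (h (M ⊔ M′) (m≤n⊔m M M′)))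

  swap4 : ∀ p q r s → (p + q) + (r + s) ≡ (p + r) + (q + s)
  swap4 p q r s = begin
    (p + q) + (r + s) ≡⟨ +-assoc p q (r + s) ⟩
    p + (q + (r + s)) ≡⟨ cong (p +_) (sym (+-assoc q r s)) ⟩
    p + ((q + r) + s) ≡⟨ cong (λ z → p + (z + s)) (+-comm q r) ⟩
    p + ((r + q) + s) ≡⟨ cong (p +_) (+-assoc r q s) ⟩
    p + (r + (q + s)) ≡⟨ sym (+-assoc p r (q + s)) ⟩
    (p + r) + (q + s) ∎
    where open ≡-Reasoning

  module Corner {S S′ ρ σ c d c′ d′} (sep : IsSep S) (sep′ : IsSep S′)
    (lc : In S ρ c) (ld : In S σ d) (nc : ¬ C S c d)
    (lc′ : In S′ ρ c′) (ld′ : In S′ σ d′) (nc′ : ¬ C S′ c′ d′) where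

    -- The common part of `S` and `S′` goes once into each corner: `P` puts it into `X₁` as part of
    -- `S`, `Q′` into `X₂` as part of `S′`. So the two corners together have at most 2n vertices.
    P P′ Q Q′ : V → Set
    P v = C S′ c′ v ⊎ v ∈ S′
    P′ v = C S′ d′ v
    Q v = C S c v
    Q′ v = C S d v ⊎ v ∈ S

    X₁ X₂ : List V
    X₁ = keep P S ++ keep Q S′
    X₂ = keep P′ S ++ keep Q′ S′

    X₁⊂ : ∀ {v} → v ∈ X₁ → (v ∈ S × P v) ⊎ (v ∈ S′ × Q v)
    X₁⊂ v∈ with ∈-++⁻ (keep P S) v∈
    ... | inj₁ q = inj₁ (∈-keep⁻ P q)
    ... | inj₂ q = inj₂ (∈-keep⁻ Q q)

    X₂⊂ : ∀ {v} → v ∈ X₂ → (v ∈ S × P′ v) ⊎ (v ∈ S′ × Q′ v)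
    X₂⊂ v∈ with ∈-++⁻ (keep P′ S) v∈
    ... | inj₁ q = inj₁ (∈-keep⁻ P′ q)
    ... | inj₂ q = inj₂ (∈-keep⁻ Q′ q)

    X₁∋ : ∀ {v} → v ∈ S′ → Q v → v ∈ X₁
    X₁∋ v∈ q = ∈-++⁺ʳ (keep P S) (∈-keep⁺ v∈ q)

    sp₁ : Splits X₁ ρ σ
    sp₁ = corner-splits X₁ lc ld nc lc′ ([ inj₁ ∘ proj₁ , inj₂ ∘ proj₁ ]′ ∘ X₁⊂)
      (λ v∈ q → ∈-++⁺ˡ (∈-keep⁺ v∈ (inj₁ q))) (λ v∈ v∈′ → ∈-++⁺ˡ (∈-keep⁺ v∈ (inj₂ v∈′))) X₁∋

    sp₂ : Splits X₂ σ ρ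
    sp₂ = corner-splits X₂ ld lc (nc ∘ conn-sym) ld′ ([ inj₁ ∘ proj₁ , inj₂ ∘ proj₁ ]′ ∘ X₂⊂)
      (λ v∈ q → ∈-++⁺ˡ (∈-keep⁺ v∈ q)) (λ v∈ v∈′ → ∈-++⁺ʳ (keep P′ S) (∈-keep⁺ v∈′ (inj₂ v∈)))
      (λ v∈ q → ∈-++⁺ʳ (keep P′ S) (∈-keep⁺ v∈ (inj₁ q)))

    private
      a = length (keep P S)
      a′ = length (keep P′ S)
      b = length (keep Q S′)
      b′ = length (keep Q′ S′)
      PP′ : ∀ {v} → v ∈ S → P v → P′ v → ⊥
      PP′ _ (inj₁ p) q = nc′ (conn-trans p (conn-sym q))
      PP′ _ (inj₂ p) q = conn-right q p
      QQ′ : ∀ {v} → v ∈ S′ → Q v → Q′ v → ⊥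
      QQ′ _ p (inj₁ q) = nc (conn-trans p (conn-sym q))
      QQ′ _ p (inj₂ q) = conn-right p q
      aa′ : a + a′ ≤ n
      aa′ = subst (a + a′ ≤_) (sep-size sep) (keep-disjoint P P′ S PP′)
      bb′ : b + b′ ≤ n
      bb′ = subst (b + b′ ≤_) (sep-size sep′) (keep-disjoint Q Q′ S′ QQ′)
      ab : n ≤ a + b
      ab = subst (n ≤_) (length-++ (keep P S)) (n-min sp₁)
      a′b′ : n ≤ a′ + b′
      a′b′ = subst (n ≤_) (length-++ (keep P′ S)) (n-min sp₂)

    sep₁ : IsSep X₁
    sep₁ = mkSep (≤-antisym (subst (_≤ n) (sym (length-++ (keep P S))) (+-cancelʳ-≤ n (a + b) n
             (≤-trans (+-monoʳ-≤ (a + b) a′b′) (subst (_≤ n + n) (swap4 a a′ b b′) (+-mono-≤ aa′ bb′))))) (n-min sp₁))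
           (ρ , σ , sp₁)

    sep₂ : IsSep X₂
    sep₂ = mkSep (≤-antisym (subst (_≤ n) (sym (length-++ (keep P′ S))) (+-cancelˡ-≤ n (a′ + b′) n
             (≤-trans (+-monoˡ-≤ (a′ + b′) ab) (subst (_≤ n + n) (swap4 a a′ b b′) (+-mono-≤ aa′ bb′))))) (n-min sp₂))
           (σ , ρ , sp₂)

    -- A vertex of `S` in a third component of `S′` would belong to neither corner, and their sizes
    -- would add up to less than 2n.
    no-waste : ∀ {s} → s ∈ S → s ∉ S′ → C S′ c′ s ⊎ C S′ d′ s
    no-waste {s} s∈ s∉ with dec (C S′ c′ s) | dec (C S′ d′ s)
    ... | yes p | _ = inj₁ p
    ... | no _ | yes q = inj₂ q
    ... | no ¬p | no ¬q = ⊥-elim (<-irrefl refl (≤-<-trans (+-mono-≤ ab a′b′)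
        (subst (_< n + n) (swap4 a a′ b b′) (+-mono-<-≤ strict bb′))))
      where
      strict : a + a′ < n
      strict = subst (a + a′ <_) (sep-size sep) (keep-disjoint-strict P P′ PP′ s∈ [ ¬p , s∉ ]′ ¬q)

  -- Corners need two ends split by both sets. If `S′` leaves `ρ` and `σ` together, a third end `τ`
  -- beyond `S′` replaces one of them, according to its side of `S`.
  pick : ∀ {S S′ ρ c} → IsSep S → IsSep S′ → In S ρ c → ∃ λ ρ′ → ∃ λ σ → ∃ λ d → ∃ λ c′ → ∃ λ d′ →
    In S ρ′ c × In S σ d × ¬ C S c d × In S′ ρ′ c′ × In S′ σ d′ × ¬ C S′ c′ d′
  pick {S} {S′} {ρ} {c} sep sep′ lc with other-big sep c
  ... | d , (σ , ld) , nc with lives S′ ρ | lives S′ σ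
  ... | c′ , lc′ | d′ , ld′ with dec (C S′ c′ d′)
  ... | no nc′ = ρ , σ , d , c′ , d′ , lc , ld , nc , lc′ , ld′ , nc′
  ... | yes con with other-big sep′ c′
  ... | e′ , (τ , le′) , ne′ with lives S τ
  ... | e , le with dec (C S c e)
  ... | yes ce = τ , σ , d , e′ , d′ , lives-conn (conn-sym ce) le , ld , nc , le′ , ld′ ,
                 λ q → ne′ (conn-trans con (conn-sym q))
  ... | no nce = ρ , τ , e , c′ , e′ , lc , le , nce , lc′ , le′ , ne′

  big-off : ∀ {S F s} → IsSep S → IsSep F → s ∈ S → s ∉ F → Big F s
  big-off sep sepF s∈ s∉ with sep-cut sep
  ... | ρ , _ , _ , _ , lc , _ with pick sep sepF lc
  ... | ρ′ , σ , d , c′ , d′ , l , ld , nc , lc′ , ld′ , nc′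
    with Corner.no-waste sep sepF l ld nc lc′ ld′ nc′ s∈ s∉
  ... | inj₁ p = big-conn p (ρ′ , lc′)
  ... | inj₂ q = big-conn q (σ , ld′)

  Cross : List V → List V → Set
  Cross F S = ∃ λ s → ∃ λ t → s ∈ S × t ∈ S × s ∉ F × t ∉ F × ¬ C F s t

  nested-conn : ∀ {F S s t} → ¬ Cross F S → s ∈ S → t ∈ S → s ∉ F → t ∉ F → C F s t
  nested-conn h s∈ t∈ s∉ t∉ = dne λ nc → h (_ , _ , s∈ , t∈ , s∉ , t∉ , nc)

  -- Without crossing, the part of `S` off `F` meets a single component of `F`, while at least two
  -- contain ends.
  free-big : ∀ {F S} → IsSep F → ¬ Cross F S → ∃ λ y → Big F y × (∀ {s} → s ∈ S → ¬ C F y s)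
  free-big {F} {S} sepF h with other-big sepF (proj₁ (proj₂ (proj₂ (sep-cut sepF))))
  ... | b , bb , nab with dec (∃ λ s → s ∈ S × C F b s)
  ... | no none = b , bb , λ s∈ c → none (_ , s∈ , c)
  ... | yes (s , s∈ , bs) with other-big sepF b
  ... | a , ba , nba = a , ba , λ t∈ at → nba (conn-trans bs
          (conn-trans (nested-conn h s∈ t∈ (conn-right bs) (conn-right at)) (conn-sym at)))

  comp-off : ∀ {F S y z} → (∀ {s} → s ∈ S → ¬ C F y s) → C F y z → C S y z
  comp-off h = conn-within λ c z∈ → h z∈ c

  -- If `F` did not cross `S`, some component of `F` with an end would miss `S`. By tightness all
  -- vertices of `F` have neighbours in it, so it would connect `p` to `q` off `S`.
  cross-sym : ∀ {S F} → IsSep F → Cross S F → Cross F S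
  cross-sym {S} {F} sepF (p , q , p∈ , q∈ , p∉ , q∉ , npq) = dne λ h → go h
    where
    go : ¬ Cross F S → ⊥
    go h with free-big sepF h
    ... | y , by , off with tight sepF by p∈ | tight sepF by q∈
    ... | u , yu , up | w , yw , wq = npq (step p∉ (E-sym up) (conn-trans (conn-sym (comp-off off yu))
            (conn-snoc (comp-off off yw) wq q∉)))

-- Crossing separators and the family crossed least

module Nested (em : ExcludedMiddle (Level.suc 0ℓ)) (G : Graph) (more : MoreThanOneEnd G) where
  open import Data.List.Membership.Propositional using (lose)
  open import Data.List using (concatMap)
  open import Data.List.Membership.Propositional.Properties using (∈-concatMap⁺)
  open Separators em G more public

  _≋_ : List V → List V → Set
  S ≋ T = (∀ {v} → v ∈ S → v ∈ T) × (∀ {v} → v ∈ T → v ∈ S)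

  ≋-refl : ∀ {S} → S ≋ S
  ≋-refl = (λ q → q) , (λ q → q)

  ≋-sym : ∀ {S T} → S ≋ T → T ≋ S
  ≋-sym (f , g) = g , f

  ≋-trans : ∀ {S T R} → S ≋ T → T ≋ R → S ≋ R
  ≋-trans (f , g) (f′ , g′) = f′ ∘ f , g ∘ g′

  verts : ∀ {P u v} → Conn P u v → List V
  verts (here {u} _) = u ∷ []
  verts (step {u} _ _ c) = u ∷ verts c

  verts-conn : ∀ {P Q u v} (c : Conn P u v) → (∀ {x} → x ∈ verts c → P x → Q x) → Conn Q u v
  verts-conn (here p) f = here (f (here refl) p)
  verts-conn (step p e c) f = step (f (here refl) p) e (verts-conn c (f ∘ there))

  abstract
    -- Every minimal separator meets a fixed path from a to b, so induct after deleting one vertex of it.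
    minimal-finite : ∀ m (F : List V) a b → ∃ λ (Ls : List (List V)) → ∀ S → length S ≤ m →
      ¬ Conn (λ v → v ∉ F × v ∉ S) a b →
      (∀ {s} → s ∈ S → Conn (λ v → v ∉ F × (v ∉ S ⊎ v ≡ s)) a b) → ∃ λ T → T ∈ Ls × S ≋ T
    minimal-finite zero F a b = [] ∷ [] , λ { [] z≤n _ _ → [] , here refl , ≋-refl }
    minimal-finite (suc m) F a b with dec (Conn (λ v → v ∉ F) a b)
    ... | no nc = [] ∷ [] , λ { [] _ _ _ → [] , here refl , ≋-refl
                              ; (s ∷ S) _ _ min → ⊥-elim (nc (conn-mono proj₁ (min (here refl)))) }
    ... | yes c = concatMap f (verts c) , found
      where
      f : V → List (List V)
      f v = map (v ∷_) (proj₁ (minimal-finite m (v ∷ F) a b))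
      found : ∀ S → length S ≤ suc m → ¬ Conn (λ v → v ∉ F × v ∉ S) a b →
        (∀ {s} → s ∈ S → Conn (λ v → v ∉ F × (v ∉ S ⊎ v ≡ s)) a b) → ∃ λ T → T ∈ concatMap f (verts c) × S ≋ T
      found S le nc min with dne {∃ λ v → v ∈ verts c × v ∈ S}
                               (λ k → nc (verts-conn c λ x∈ x∉ → x∉ , λ q → k (_ , x∈ , q)))
      ... | v , v∈c , v∈S with proj₂ (minimal-finite m (v ∷ F) a b) (keep (_≢ v) S)
              (≤-pred (≤-trans (keep-drops (_≢ v) v∈S (λ q → q refl)) le))
              (λ d → nc (conn-mono (λ (p , q) → (λ r → p (there r)) , λ r → q (∈-keep⁺ r λ { refl → p (here refl) })) d))
              (λ s∈ → conn-mono (off (proj₂ (∈-keep⁻ (_≢ v) {S} s∈))) (min (proj₁ (∈-keep⁻ (_≢ v) {S} s∈))))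
        where
        off : ∀ {s x} → s ≢ v → x ∉ F × (x ∉ S ⊎ x ≡ s) → x ∉ v ∷ F × (x ∉ keep (_≢ v) S ⊎ x ≡ s)
        off ne (p , inj₁ q) = (λ { (here refl) → q v∈S ; (there r) → p r }) , inj₁ (λ r → q (proj₁ (∈-keep⁻ (_≢ v) {S} r)))
        off ne (p , inj₂ refl) = (λ { (here refl) → ne refl ; (there r) → p r }) , inj₂ refl
      ... | T , T∈ , (g , h) = v ∷ T , ∈-concatMap⁺ f (lose v∈c (∈-map⁺ (v ∷_) T∈)) , into , back
        where
        into : ∀ {x} → x ∈ S → x ∈ v ∷ T
        into {x} x∈ with dec (x ≡ v)
        ... | yes refl = here refl
        ... | no ne = there (g (∈-keep⁺ x∈ ne))
        back : ∀ {x} → x ∈ v ∷ T → x ∈ S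
        back (here refl) = v∈S
        back (there q) = proj₁ (∈-keep⁻ (_≢ v) {S} (h q))

    seps-finite : ∀ a b → ∃ λ (Ls : List (List V)) → ∀ S → IsSep S → Big S a → Big S b → ¬ C S a b →
      ∃ λ T → T ∈ Ls × S ≋ T
    seps-finite a b with minimal-finite n [] a b
    ... | Ls , f = Ls , λ S sep ba bb nc → f S (≤-reflexive (sep-size sep)) (λ c → nc (conn-mono proj₂ c))
                          (λ s∈ → min S sep ba bb s∈)
      where
      min : ∀ S → IsSep S → Big S a → Big S b → ∀ {s} → s ∈ S → Conn (λ v → v ∉ [] × (v ∉ S ⊎ v ≡ s)) a b
      min S sep ba bb s∈ with tight sep ba s∈ | tight sep bb s∈
      ... | y , ay , ys | z , bz , zs = conn-trans (conn-snoc (conn-mono off ay) ys ((λ ()) , inj₂ refl))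
                                          (step ((λ ()) , inj₂ refl) (E-sym zs) (conn-sym (conn-mono off bz)))
        where
        off : ∀ {s v} → v ∉ S → v ∉ [] × (v ∉ S ⊎ v ≡ s)
        off v∉ = (λ ()) , inj₁ v∉

    -- A crossing set `F` splits two vertices of `S` that lie in components of `F` with ends, so it
    -- is one of the finitely many minimal separators of this pair.
    cross-finite : ∀ S → IsSep S → ∃ λ (Ls : List (List V)) → ∀ F → IsSep F → Cross F S → ∃ λ T → T ∈ Ls × F ≋ T
    cross-finite S sep = concatMap (λ s → concatMap (λ t → proj₁ (seps-finite s t)) S) S , found
      where
      found : ∀ F → IsSep F → Cross F S → ∃ λ T → T ∈ concatMap (λ s → concatMap (λ t → proj₁ (seps-finite s t)) S) S × F ≋ T
      found F sepF (s , t , s∈ , t∈ , s∉ , t∉ , nc)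
        with proj₂ (seps-finite s t) F sepF (big-off sep sepF s∈ s∉) (big-off sep sepF t∈ t∉) nc
      ... | T , T∈ , eq = T , ∈-concatMap⁺ (λ s → concatMap (λ t → proj₁ (seps-finite s t)) S)
                                (lose s∈ (∈-concatMap⁺ (λ t → proj₁ (seps-finite s t)) (lose t∈ T∈))) , eq

  cross-resp : ∀ {F T S} → F ≋ T → Cross F S → Cross T S
  cross-resp (f , g) (s , t , s∈ , t∈ , s∉ , t∉ , nc) =
    s , t , s∈ , t∈ , s∉ ∘ g , t∉ ∘ g , λ c → nc (conn-mono (λ x∉ x∈ → x∉ (f x∈)) c)

  Within : List V → V → List V → Set
  Within S c X = ∀ {v} → v ∈ X → v ∈ S ⊎ C S c v

  within-uncrossed : ∀ {S c X} → Within S c X → ¬ Cross S X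
  within-uncrossed w (s , t , s∈ , t∈ , s∉ , t∉ , nc) with w s∈ | w t∈
  ... | inj₁ q | _ = s∉ q
  ... | inj₂ _ | inj₁ q = t∉ q
  ... | inj₂ p | inj₂ q = nc (conn-trans (conn-sym p) q)

  within-free : ∀ {S c X F} → IsSep S → Big S c → Within S c X → (∀ {f} → f ∈ F → ¬ C S c f) → ¬ Cross F X
  within-free {S} {c} {X} {F} sep bc w off (x , y , x∈ , y∈ , x∉ , y∉ , nc) =
    nc (conn-trans (conn-sym (reach x∈ x∉)) (reach y∈ y∉))
    where
    reach : ∀ {v} → v ∈ X → v ∉ F → C F c v
    reach v∈ v∉ with w v∈
    ... | inj₂ q = comp-off off q
    ... | inj₁ q with tight sep bc q
    ... | z , cz , zv = conn-snoc (comp-off off cz) zv v∉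

  -- If `F` did not cross `S`, then neither would `S` cross `F`, so `F` would miss the component of
  -- `c` or that of `d`; the corner on that side would be uncrossed.
  cross-both : ∀ {S c d X Y F} → IsSep S → IsSep F → Big S c → Big S d → ¬ C S c d →
    Within S c X → Within S d Y → Cross F X → Cross F Y → Cross F S
  cross-both {S} {c} {d} {X} {Y} {F} sep sepF bc bd nc wx wy cx cy = dne go
    where
    go : ¬ ¬ Cross F S
    go h with dec (∃ λ f → f ∈ F × C S c f)
    ... | no none = within-free sep bc wx (λ f∈ q → none (_ , f∈ , q)) cx
    ... | yes (f , f∈ , cf) = within-free sep bd wy (λ g∈ dg → nc (conn-trans cf (conn-trans
            (nested-conn (h ∘ cross-sym sepF) f∈ g∈ (conn-right cf) (conn-right dg)) (conn-sym dg)))) cy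

  module _ {S S′ F : List V} (sepS : IsSep S) (sepS′ : IsSep S′) (sepF : IsSep F) where

    -- Otherwise the component of `y` off `F` misses `S`; together with the part of its boundary `F`
    -- outside `S` it connects all of `S′` off `S`, so `S` would not cross `S′`.
    cross-mixed : Cross S S′ → ¬ Cross F S → ¬ Cross F S′ →
      ∀ {x y} → x ∈ S → y ∈ S′ → x ∉ F → y ∉ F → C F x y
    cross-mixed (p , q , p∈ , q∈ , p∉ , q∉ , npq) h h′ {x} {y} x∈ y∈ x∉ y∉ = dne go
      where
      module _ (nxy : ¬ C F x y) where
        off : ∀ {s} → s ∈ S → ¬ C F y s
        off s∈ c = nxy (conn-trans (nested-conn h x∈ s∈ x∉ (conn-right c)) (conn-sym c))
        reach : ∀ {r} → r ∈ S′ → r ∉ S → C S y r ⊎ r ∈ F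
        reach {r} r∈ r∉ with dec (r ∈ F)
        ... | yes r∈F = inj₂ r∈F
        ... | no r∉F = inj₁ (comp-off off (nested-conn h′ y∈ r∈ y∉ r∉F))
        touch : ∀ {r} → r ∈ F → r ∉ S → C S y r
        touch r∈F r∉ with tight sepF (big-off sepS′ sepF y∈ y∉) r∈F
        ... | z , yz , zr = conn-snoc (comp-off off yz) zr r∉
        both : ∀ {r} → r ∈ S′ → r ∉ S → C S y r
        both r∈ r∉ with reach r∈ r∉
        ... | inj₁ c = c
        ... | inj₂ r∈F = touch r∈F r∉
      go : ¬ ¬ C F x y
      go nxy = npq (conn-trans (conn-sym (both nxy p∈ p∉)) (both nxy q∈ q∉))

    cross-union : ∀ {X} → Cross S S′ → (∀ {v} → v ∈ X → v ∈ S ⊎ v ∈ S′) → Cross F X → Cross F S ⊎ Cross F S′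
    cross-union cr X⊂ (x , y , x∈ , y∈ , x∉ , y∉ , nc) with dec (Cross F S) | dec (Cross F S′)
    ... | yes q | _ = inj₁ q
    ... | no _ | yes q = inj₂ q
    ... | no h | no h′ with X⊂ x∈ | X⊂ y∈
    ... | inj₁ p | inj₁ q = ⊥-elim (nc (nested-conn h p q x∉ y∉))
    ... | inj₂ p | inj₂ q = ⊥-elim (nc (nested-conn h′ p q x∉ y∉))
    ... | inj₁ p | inj₂ q = ⊥-elim (nc (cross-mixed cr h h′ p q x∉ y∉))
    ... | inj₂ p | inj₁ q = ⊥-elim (nc (conn-sym (cross-mixed cr h h′ q p y∉ x∉)))

  -- Counts the separators crossing `S` by a list that represents each of them up to `≋`. Redundant
  -- entries do no harm, since the length is minimised.
  Covers : List V → List (List V) → Set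
  Covers S L = ∀ F → IsSep F → Cross F S → ∃ λ T → T ∈ L × F ≋ T

  abstract
    private
      fewest : ∃ λ m → (∃ λ S → IsSep S × ∃ λ L → length L ≡ m × Covers S L) ×
                       (∀ k → (∃ λ S → IsSep S × ∃ λ L → length L ≡ k × Covers S L) → m ≤ k)
      fewest = least _ (_ , _ , proj₂ some-sep , _ , refl , proj₂ (cross-finite _ (proj₂ some-sep)))

    m₀ : ℕ
    m₀ = proj₁ fewest

    some-few : ∃ λ S → IsSep S × ∃ λ L → length L ≡ m₀ × Covers S L
    some-few = proj₁ (proj₂ fewest)

    m₀-min : ∀ {S L} → IsSep S → Covers S L → m₀ ≤ length L
    m₀-min sep cov = proj₂ (proj₂ fewest) _ (_ , sep , _ , refl , cov)

  record 𝒩 (S : List V) : Set where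
    constructor mk𝒩
    field
      𝒩-sep : IsSep S
      𝒩-cover : ∃ λ L → length L ≡ m₀ × Covers S L
  open 𝒩 public

  some-𝒩 : ∃ 𝒩
  some-𝒩 = proj₁ some-few , mk𝒩 (proj₁ (proj₂ some-few)) (proj₂ (proj₂ some-few))

  -- A separator crossing both corners crosses S and S′, and neither S nor S′ crosses a corner;
  -- so one of two opposite corners would be crossed by fewer separators.
  nested : ∀ {S S′} → 𝒩 S → 𝒩 S′ → ¬ Cross S′ S
  nested {S} {S′} (mk𝒩 sep (L , len , cov)) (mk𝒩 sep′ (L′ , len′ , cov′)) cr with sep-cut sep
  ... | _ , _ , _ , _ , l , _ with pick sep sep′ l
  ... | ρ , σ , d , c′ , d′ , lc , ld , nc , lc′ , ld′ , nc′ = contradiction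
    where
    open Corner sep sep′ lc ld nc lc′ ld′ nc′
    w₁ : Within S _ X₁
    w₁ v∈ with X₁⊂ v∈
    ... | inj₁ (p , _) = inj₁ p
    ... | inj₂ (_ , q) = inj₂ q
    w₁′ : Within S′ c′ X₁
    w₁′ v∈ with X₁⊂ v∈
    ... | inj₁ (_ , inj₁ p) = inj₂ p
    ... | inj₁ (_ , inj₂ p) = inj₁ p
    ... | inj₂ (q , _) = inj₁ q
    w₂ : Within S d X₂
    w₂ v∈ with X₂⊂ v∈
    ... | inj₁ (p , _) = inj₁ p
    ... | inj₂ (_ , inj₁ q) = inj₂ q
    ... | inj₂ (_ , inj₂ q) = inj₁ q
    w₂′ : Within S′ d′ X₂
    w₂′ v∈ with X₂⊂ v∈
    ... | inj₁ (_ , p) = inj₂ p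
    ... | inj₂ (q , _) = inj₁ q
    bS : ∀ {F} → IsSep F → Cross F X₁ → Cross F X₂ → Cross F S
    bS sepF = cross-both sep sepF (ρ , lc) (σ , ld) nc w₁ w₂
    bS′ : ∀ {F} → IsSep F → Cross F X₁ → Cross F X₂ → Cross F S′
    bS′ sepF = cross-both sep′ sepF (ρ , lc′) (σ , ld′) nc′ w₁′ w₂′
    -- A separator crossing `X₁` is looked up in `L` first and otherwise in `L′`; for `X₂` it is the
    -- other way round. One that crosses both corners crosses `S` and `S′`, and is thus counted once
    -- from each list.
    A A′ B B′ : List V → Set
    A T = ∃ λ F → IsSep F × F ≋ T × Cross F X₁
    A′ T = ∃ λ F → IsSep F × F ≋ T × Cross F X₁ × ¬ Cross F S
    B T = ∃ λ F → IsSep F × F ≋ T × Cross F X₂ × ¬ Cross F S′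
    B′ T = ∃ λ F → IsSep F × F ≋ T × Cross F X₂
    AB : ∀ {T} → A T → B T → ⊥
    AB (F , sF , e , x) (F′ , sF′ , e′ , x′ , nx) =
      nx (bS′ sF′ (cross-resp (≋-trans e (≋-sym e′)) x) x′)
    A′B′ : ∀ {T} → A′ T → B′ T → ⊥
    A′B′ (F , sF , e , x , nx) (F′ , sF′ , e′ , x′) =
      nx (bS sF x (cross-resp (≋-trans e′ (≋-sym e)) x′))
    cov₁ : Covers X₁ (keep A L ++ keep A′ L′)
    cov₁ F sF x with dec (Cross F S)
    ... | yes y with cov F sF y
    ... | T , T∈ , e = T , ∈-++⁺ˡ (∈-keep⁺ T∈ (F , sF , e , x)) , e
    cov₁ F sF x | no ny with cross-union sep sep′ sF (cross-sym sep cr) (λ q → [ inj₁ ∘ proj₁ , inj₂ ∘ proj₁ ]′ (X₁⊂ q)) x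
    ... | inj₁ y = ⊥-elim (ny y)
    ... | inj₂ y with cov′ F sF y
    ... | T , T∈ , e = T , ∈-++⁺ʳ (keep A L) (∈-keep⁺ T∈ (F , sF , e , x , ny)) , e
    cov₂ : Covers X₂ (keep B′ L′ ++ keep B L)
    cov₂ F sF x with dec (Cross F S′)
    ... | yes y with cov′ F sF y
    ... | T , T∈ , e = T , ∈-++⁺ˡ (∈-keep⁺ T∈ (F , sF , e , x)) , e
    cov₂ F sF x | no ny with cross-union sep sep′ sF (cross-sym sep cr) (λ q → [ inj₁ ∘ proj₁ , inj₂ ∘ proj₁ ]′ (X₂⊂ q)) x
    ... | inj₂ y = ⊥-elim (ny y)
    ... | inj₁ y with cov F sF y
    ... | T , T∈ , e = T , ∈-++⁺ʳ (keep B′ L′) (∈-keep⁺ T∈ (F , sF , e , x , ny)) , e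
    -- `S′` is represented in `L` but crosses neither corner, which makes this sum strict.
    strict : length (keep A L) + length (keep B L) < m₀
    strict with cov S′ sep′ cr
    ... | T , T∈ , e = subst (length (keep A L) + length (keep B L) <_) len (keep-disjoint-strict A B (λ _ → AB) T∈
      (λ { (F , _ , e′ , x) → within-uncrossed w₁′ (cross-resp (≋-trans e′ (≋-sym e)) x) })
      (λ { (F , _ , e′ , x , _) → within-uncrossed w₂′ (cross-resp (≋-trans e′ (≋-sym e)) x) }))
    weak : length (keep A′ L′) + length (keep B′ L′) ≤ m₀
    weak = subst (length (keep A′ L′) + length (keep B′ L′) ≤_) len′ (keep-disjoint A′ B′ L′ (λ _ → A′B′))
    contradiction : ⊥
    contradiction = <-irrefl refl (≤-<-trans
      (+-mono-≤ (subst (m₀ ≤_) (length-++ (keep A L)) (m₀-min sep₁ cov₁))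
                (subst (m₀ ≤_) (trans (length-++ (keep B′ L′)) (+-comm _ (length (keep B L)))) (m₀-min sep₂ cov₂)))
      (subst (_< m₀ + m₀) (swap4 (length (keep A L)) (length (keep B L)) (length (keep A′ L′)) (length (keep B′ L′)))
        (+-mono-<-≤ strict weak)))

-- Invariance of the family; cliques and stars

module Homogeneous (em : ExcludedMiddle (Level.suc 0ℓ)) (G : Graph) (more : MoreThanOneEnd G)
  (connected : Connected G) (j : ℕ) (cs : CSTransitive G (suc (suc (suc j)))) where
  open import Data.Fin using (Fin; zero; suc)
  open import Data.List.Properties using (map-∘; map-id; map-cong)
  open import Data.List.Relation.Unary.Any.Properties using (reverse⁺)
  open Nested em G more public

  k : ℕ
  k = suc (suc (suc j))

  img : Aut G → List V → List V
  img φ = map (φ ·_)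

  img⁻ : ∀ φ {S v} → φ · v ∈ img φ S → v ∈ S
  img⁻ φ {S} q with ∈-map⁻ (φ ·_) q
  ... | w , w∈ , eq = subst (_∈ S) (sym (·-inj φ eq)) w∈

  img-C : ∀ φ {S x y} → C S x y → C (img φ S) (φ · x) (φ · y)
  img-C φ = ·-conn φ (λ x∉ q → x∉ (img⁻ φ q))

  img-inv : ∀ φ S → img (inv φ) (img φ S) ≡ S
  img-inv φ S = trans (sym (map-∘ S)) (trans (map-cong (bwd-· φ) S) (map-id S))

  inv-img : ∀ φ S → img φ (img (inv φ) S) ≡ S
  inv-img φ S = trans (sym (map-∘ S)) (trans (map-cong (·-bwd φ) S) (map-id S))

  img-C⁻ : ∀ φ {S x y} → C (img φ S) (φ · x) (φ · y) → C S x y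
  img-C⁻ φ {S} {x} {y} c = subst₂ (C S) (bwd-· φ x) (bwd-· φ y)
    (subst (λ T → C T _ _) (img-inv φ S) (img-C (inv φ) c))

  img-In : ∀ φ {S ρ x} → In S ρ x → In (img φ S) (·-ray φ ρ) (φ · x)
  img-In φ = ·-lives φ (λ x∉ q → x∉ (img⁻ φ q))

  img-Big : ∀ φ {S x} → Big S x → Big (img φ S) (φ · x)
  img-Big φ (ρ , l) = ·-ray φ ρ , img-In φ l

  img-IsSep : ∀ φ {S} → IsSep S → IsSep (img φ S)
  img-IsSep φ {S} (mkSep len (ρ , σ , x , y , lx , ly , nc)) =
    mkSep (trans (length-map (φ ·_) S) len) (_ , _ , _ , _ , img-In φ lx , img-In φ ly , λ c → nc (img-C⁻ φ c))

  img-Cross : ∀ φ {F S} → Cross F S → Cross (img φ F) (img φ S)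
  img-Cross φ (s , t , s∈ , t∈ , s∉ , t∉ , nc) = φ · s , φ · t , ∈-map⁺ (φ ·_) s∈ , ∈-map⁺ (φ ·_) t∈ ,
    (λ q → s∉ (img⁻ φ q)) , (λ q → t∉ (img⁻ φ q)) , λ c → nc (img-C⁻ φ c)

  img-≋ : ∀ φ {S T} → S ≋ T → img φ S ≋ img φ T
  img-≋ φ {S} {T} (f , g) = h f , h g
    where
    h : ∀ {S T : List V} → (∀ {v} → v ∈ S → v ∈ T) → ∀ {v} → v ∈ img φ S → v ∈ img φ T
    h f q with ∈-map⁻ (φ ·_) q
    ... | w , w∈ , refl = ∈-map⁺ (φ ·_) (f w∈)

  img-𝒩 : ∀ φ {S} → 𝒩 S → 𝒩 (img φ S)
  img-𝒩 φ {S} (mk𝒩 sep (L , len , cov)) = mk𝒩 (img-IsSep φ sep) (map (img φ) L , trans (length-map (img φ) L) len , cov′)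
    where
    cov′ : Covers (img φ S) (map (img φ) L)
    cov′ F sepF cr with cov (img (inv φ) F) (img-IsSep (inv φ) sepF)
                          (subst (Cross (img (inv φ) F)) (img-inv φ S) (img-Cross (inv φ) cr))
    ... | T , T∈ , eq = img φ T , ∈-map⁺ (img φ) T∈ , subst (_≋ img φ T) (inv-img φ F) (img-≋ φ eq)

  -- The first invariant set: copies of a k-vertex graph that meet it in incompatible ways cannot be
  -- matched.
  U : V → Set
  U v = ∃ λ S → 𝒩 S × v ∈ S

  img-U : ∀ φ {v} → U v → U (φ · v)
  img-U φ (S , nS , v∈) = img φ S , img-𝒩 φ nS , ∈-map⁺ (φ ·_) v∈

  img-U⁻ : ∀ φ {v} → U (φ · v) → U v
  img-U⁻ φ {v} u = subst U (bwd-· φ v) (img-U (inv φ) u)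

  sep-nonempty : ∀ {S} → IsSep S → ∃ λ s → s ∈ S
  sep-nonempty {s ∷ S} _ = s , here refl
  sep-nonempty {[]} (mkSep _ (ρ , σ , x , y , _ , _ , nc)) = ⊥-elim (nc (conn-mono (λ _ ()) (connected x y)))

  equiv : ∀ {xs ys} → IP xs → IP ys → length xs ≡ k → length ys ≡ k →
    Σ (Aut G) λ φ → img φ xs ≡ ys ⊎ img φ xs ≡ reverse ys
  equiv = path-equiv cs

  equiv-∋ : ∀ (φ : Aut G) {xs ys y} → img φ xs ≡ ys ⊎ img φ xs ≡ reverse ys → y ∈ ys → ∃ λ x → x ∈ xs × y ≡ φ · x
  equiv-∋ φ (inj₁ eq) y∈ = ∈-map⁻ (φ ·_) (subst (_ ∈_) (sym eq) y∈)
  equiv-∋ φ (inj₂ eq) y∈ = ∈-map⁻ (φ ·_) (subst (_ ∈_) (sym eq) (reverse⁺ y∈))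

  Indep : ∀ {m} → (Fin m → V) → Set
  Indep f = InjectiveFin G f × (∀ i j → ¬ E (f i) (f j))

  ramsey : ∀ a b {P : V → Set} → Infinite P →
    (Σ (Fin a → V) λ f → Clique f × (∀ i → P (f i))) ⊎ (Σ (Fin b → V) λ f → Indep f × (∀ i → P (f i)))
  ramsey zero b h = inj₁ ((λ ()) , (λ ()) , λ ())
  ramsey (suc a) zero h = inj₂ ((λ ()) , ((λ ()) , λ ()) , λ ())
  ramsey (suc a) (suc b) {P} h with h []
  ... | v , pv , _ with inf-split (E v) (inf-minus (v ∷ []) h)
  ... | inj₁ i with ramsey a (suc b) i
  ... | inj₂ (f , ind , all) = inj₂ (f , ind , λ l → proj₁ (proj₁ (all l)))
  ... | inj₁ (f , cl , all) = inj₁ (v ◂ f , cl′ , λ { zero → pv ; (suc l) → proj₁ (proj₁ (all l)) })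
    where
    cl′ : Clique (v ◂ f)
    cl′ zero zero ne = ⊥-elim (ne refl)
    cl′ zero (suc l) ne = proj₂ (all l)
    cl′ (suc l) zero ne = E-sym (proj₂ (all l))
    cl′ (suc l) (suc l′) ne = cl l l′ (ne ∘ cong suc)
  ramsey (suc a) (suc b) {P} h | v , pv , _ | inj₂ i with ramsey (suc a) b i
  ... | inj₁ (f , cl , all) = inj₁ (f , cl , λ l → proj₁ (proj₁ (all l)))
  ... | inj₂ (f , (inj-f , nE) , all) = inj₂ (v ◂ f , (inj′ , nE′) , λ { zero → pv ; (suc l) → proj₁ (proj₁ (all l)) })
    where
    inj′ : InjectiveFin G (v ◂ f)
    inj′ zero zero eq = refl
    inj′ zero (suc l) eq = ⊥-elim (proj₂ (proj₁ (all l)) (here (sym eq)))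
    inj′ (suc l) zero eq = ⊥-elim (proj₂ (proj₁ (all l)) (here eq))
    inj′ (suc l) (suc l′) eq = cong suc (inj-f l l′ eq)
    nE′ : ∀ l l′ → ¬ E ((v ◂ f) l) ((v ◂ f) l′)
    nE′ zero zero e = E-irr e
    nE′ zero (suc l) e = proj₂ (all l) e
    nE′ (suc l) zero e = proj₂ (all l) (E-sym e)
    nE′ (suc l) (suc l′) e = nE l l′ e

  -- Centre and k - 1 pairwise nonadjacent leaves, k vertices in all.
  record Star (c : V) (f : Fin (suc (suc j)) → V) : Set where
    field
      leaves : Indep f
      spokes : ∀ i → E c (f i)

  abstract
    star-match : ∀ {c d} {f g : Fin (suc (suc j)) → V} → Star c f → Star d g → Match (c ◂ f) (d ◂ g)
    star-match {c} {d} {f} {g} s t = match cs (c ◂ f) (d ◂ g) (star-inj s) (star-inj t) con (same s t) (same t s)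
      where
      open Star
      star-inj : ∀ {c f} → Star c f → InjectiveFin G (c ◂ f)
      star-inj s zero zero eq = refl
      star-inj {c} s zero (suc l) eq = ⊥-elim (E-irr (subst (E c) (sym eq) (spokes s l)))
      star-inj {c} s (suc l) zero eq = ⊥-elim (E-irr (subst (E c) eq (spokes s l)))
      star-inj s (suc l) (suc l′) eq = cong suc (proj₁ (leaves s) l l′ eq)
      same : ∀ {c d f g} → Star c f → Star d g → ∀ i l → E ((c ◂ f) i) ((c ◂ f) l) → E ((d ◂ g) i) ((d ◂ g) l)
      same s t zero zero e = ⊥-elim (E-irr e)
      same s t zero (suc l) e = spokes t l
      same s t (suc l) zero e = E-sym (spokes t l)
      same s t (suc l) (suc l′) e = ⊥-elim (proj₂ (leaves s) l l′ e)
      con : InducedConnected G (c ◂ f)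
      con zero zero = here
      con zero (suc l) = step (spokes s l) here
      con (suc l) zero = step (E-sym (spokes s l)) here
      con (suc l) (suc l′) = step {j = zero} (E-sym (spokes s l)) (step (spokes s l′) here)

-- Every big component contains further separators

module Leaf (em : ExcludedMiddle (Level.suc 0ℓ)) (G : Graph) (more : MoreThanOneEnd G)
  (connected : Connected G) (j : ℕ) (cs : CSTransitive G (suc (suc (suc j)))) where
  open import Data.Fin using (Fin; zero; suc)
  open Homogeneous em G more connected j cs public

  -- `Near i` is the ball of radius `i` around `U`, and `Lev i` the sphere.
  data Near : ℕ → V → Set where
    now : ∀ {v} → U v → Near zero v
    stay : ∀ {i v} → Near i v → Near (suc i) v
    via : ∀ {i v w} → E v w → Near i w → Near (suc i) v

  data Lev : ℕ → V → Set where
    lev0 : ∀ {v} → U v → Lev zero v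
    levs : ∀ {i v} → Near (suc i) v → ¬ Near i v → Lev (suc i) v

  lev-near : ∀ {i v} → Lev i v → Near i v
  lev-near (lev0 u) = now u
  lev-near (levs h _) = h

  lev-far : ∀ {i v} → Lev (suc i) v → ¬ Near i v
  lev-far (levs _ nh) = nh

  lev-U : ∀ {v} → Lev zero v → U v
  lev-U (lev0 u) = u

  near-img : ∀ φ {i v} → Near i v → Near i (φ · v)
  near-img φ (now u) = now (img-U φ u)
  near-img φ (stay h) = stay (near-img φ h)
  near-img φ (via e h) = via (·-E φ _ _ e) (near-img φ h)

  lev-down : ∀ {i v} → Lev (suc i) v → ∃ λ w → E v w × Lev i w
  lev-down (levs (stay h) nh) = ⊥-elim (nh h)
  lev-down {zero} (levs (via e (now u)) nh) = _ , e , lev0 u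
  lev-down {suc i} (levs (via e h) nh) = _ , e , levs h λ h′ → nh (via e h′)

  lev-least : ∀ {i v} → Near i v → ∃ λ m → m ≤ i × Lev m v
  lev-least (now u) = 0 , z≤n , lev0 u
  lev-least {suc i} {v} h with dec (Near i v)
  ... | no nh = suc i , ≤-refl , levs h nh
  ... | yes h′ with lev-least h′
  ... | m , m≤i , l = m , m≤n⇒m≤1+n m≤i , l

  near-all : ∀ v → ∃ λ i → Near i v
  near-all v with sep-nonempty (𝒩-sep (proj₂ some-𝒩))
  ... | s , s∈ = go (connected v s)
    where
    go : ∀ {v} → Conn (λ _ → ⊤) v s → ∃ λ i → Near i v
    go (here _) = 0 , now (_ , proj₂ some-𝒩 , s∈)
    go (step _ e c) with go c
    ... | i , h = suc i , via e h

  near-mono : ∀ {i m v} → i ≤ m → Near i v → Near m v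
  near-mono {i} {m} {v} i≤m h = subst (λ l → Near l v) (trans (+-comm (m ∸ i) i) (m+[n∸m]≡n i≤m)) (go (m ∸ i))
    where
    go : ∀ d → Near (d + i) v
    go zero = h
    go (suc d) = stay (go d)

  -- A shortest path to `U` is induced and meets `U` only in its last vertex.
  descent : ∀ i {v} → Lev (suc i) v → ∃ λ ws → ∃ λ u → IP (v ∷ ws ++ u ∷ []) × length ws ≡ i × U u ×
    (∀ {z} → z ∈ v ∷ ws → ¬ U z) × (∀ {z} → z ∈ ws ++ u ∷ [] → Near i z)
  descent zero {v} l with lev-down l
  ... | w , e , lev0 u = [] , w , cons e (λ ()) (λ { (here refl) → lev-far l (now u) }) one , refl , u ,
                         (λ { (here refl) → lev-far l ∘ now }) , λ { (here refl) → now u }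
  descent (suc i) {v} l with lev-down l
  ... | w , e , lw with descent i lw
  ... | ws , u , ip , len , uu , nu , near = w ∷ ws , u ,
      cons e (λ z∈ e′ → lev-far l (via e′ (near z∈))) (λ z∈ → lev-far l (near′ z∈)) ip , cong suc len , uu ,
      (λ { (here refl) uv → lev-far l (near-mono z≤n (now uv)) ; (there q) → nu q }) , near′
    where
    near′ : ∀ {z} → z ∈ w ∷ ws ++ u ∷ [] → Near (suc i) z
    near′ (here refl) = lev-near lw
    near′ (there q) = stay (near q)

  length-snoc : ∀ ws (u : V) → length (ws ++ u ∷ []) ≡ suc (length ws)
  length-snoc ws u = trans (length-++ ws) (+-comm (length ws) 1)

  -- Of the k + 1 vertices of a shortest path to `U`, the first k avoid `U` and the last k do not.
  -- Both are induced paths, so an automorphism would carry a vertex from outside `U` into it.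
  no-lev-k : ∀ {v} → ¬ Lev k v
  no-lev-k l with descent (suc (suc j)) l
  ... | ws , u , ip , len , uu , nu , _
    with equiv (ip-init ws ip) (ip-tail ws ip) (cong suc len) (trans (length-snoc ws u) (cong suc len))
  ... | φ , m with equiv-∋ φ m (∈-++⁺ʳ ws (here refl))
  ... | x , x∈ , refl = nu x∈ (img-U⁻ φ uu)

  no-lev : ∀ d {v} → ¬ Lev (d + k) v
  no-lev zero l = no-lev-k l
  no-lev (suc d) l = no-lev d (proj₂ (proj₂ (lev-down l)))

  near-bound : ∀ v → Near (suc (suc j)) v
  near-bound v with near-all v
  ... | i , h with lev-least h
  ... | m , _ , l with m <? k
  ... | yes (s≤s m≤) = near-mono m≤ (lev-near l)
  ... | no m≮k = ⊥-elim (no-lev (m ∸ k) (subst (λ i → Lev i v) (sym (m∸n+n≡m (≮⇒≥ m≮k))) l))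

  another : (a : Fin (suc (suc j))) → ∃ λ b → b ≢ a
  another zero = suc zero , λ ()
  another (suc a) = zero , λ ()

  0≢1 : ∀ {m} {a : Fin m} → Fin.zero ≢ suc a
  0≢1 ()

  suc-inj : ∀ {m} {a b : Fin m} → Fin.suc a ≡ suc b → a ≡ b
  suc-inj refl = refl

  -- Replacing a leaf of a star whose only vertex in U is its centre cannot separate
  -- leaves that an automorphism-invariant relation holds together.
  star-swap : ∀ {c y} {f : Fin (suc (suc j)) → V} (R : V → V → Set) → Star c f → Star c (y ◂ (f ∘ suc)) →
    U c → (∀ l → ¬ U (f l)) → ¬ U y → (∀ φ → φ · c ≡ c → ∀ {u v} → R u v → R (φ · u) (φ · v)) →
    (∀ a b → R (f a) (f b)) → (∀ l → ¬ R y (f l)) → ⊥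
  -- The index sent to `y` is that of a leaf. There is a second leaf because k is at least 3; its
  -- image is again a leaf, held together with `y` by `R`.
  star-swap {c} {y} {f} R s s′ uc off nuy inv-R inside apart = leaf (τ (suc zero)) (στ (suc zero))
    where
    g = y ◂ (f ∘ suc)
    open Match (star-match s s′)
    centre : ∀ l → U ((c ◂ g) l) → l ≡ zero
    centre zero _ = refl
    centre (suc zero) u = ⊥-elim (nuy u)
    centre (suc (suc l)) u = ⊥-elim (off (suc l) u)
    σ0 : σ zero ≡ zero
    σ0 = centre _ (subst U (on zero) (img-U aut uc))
    σ-inj : ∀ {a b} → σ a ≡ σ b → a ≡ b
    σ-inj {a} {b} q = trans (sym (τσ a)) (trans (cong τ q) (τσ b))
    image : ∀ a b → b ≢ a → σ (suc a) ≡ suc zero → ∀ l → σ (suc b) ≡ l → ⊥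
    image a b ne q zero q′ = 0≢1 (sym (σ-inj (trans q′ (sym σ0))))
    image a b ne q (suc zero) q′ = ne (suc-inj (σ-inj (trans q′ (sym q))))
    image a b ne q (suc (suc l)) q′ = apart (suc l) (subst₂ R
        (trans (on (suc a)) (cong (c ◂ g) q)) (trans (on (suc b)) (cong (c ◂ g) q′))
        (inv-R aut (trans (on zero) (cong (c ◂ g) σ0)) (inside a b)))
    leaf : ∀ a → σ a ≡ suc zero → ⊥
    leaf zero q = 0≢1 (trans (sym σ0) q)
    leaf (suc a) q = image a (proj₁ (another a)) (proj₂ (another a)) q _ refl

  replace-leaf : ∀ {c p} {f : Fin (suc (suc j)) → V} → Star c f → E c p →
    (∀ i → ¬ E p (f i) × p ≢ f i) → Star c (p ◂ (f ∘ suc))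
  replace-leaf {c} {p} {f} s cp h = record { leaves = inj′ , nE′ ; spokes = spokes′ }
    where
    open Star s
    spokes′ : ∀ i → E c ((p ◂ (f ∘ suc)) i)
    spokes′ zero = cp
    spokes′ (suc l) = spokes (suc l)
    inj′ : InjectiveFin G (p ◂ (f ∘ suc))
    inj′ zero zero eq = refl
    inj′ zero (suc l) eq = ⊥-elim (proj₂ (h (suc l)) eq)
    inj′ (suc l) zero eq = ⊥-elim (proj₂ (h (suc l)) (sym eq))
    inj′ (suc l) (suc l′) eq = proj₁ leaves (suc l) (suc l′) eq
    nE′ : ∀ i l → ¬ E ((p ◂ (f ∘ suc)) i) ((p ◂ (f ∘ suc)) l)
    nE′ zero zero e = E-irr e
    nE′ zero (suc l) e = proj₁ (h (suc l)) e
    nE′ (suc l) zero e = proj₁ (h (suc l)) (E-sym e)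
    nE′ (suc l) (suc l′) e = proj₂ leaves (suc l) (suc l′) e

  replace-clique : ∀ {c} {f : Fin k → V} → Clique f → (∀ i → E (f i) c) → Clique (c ◂ (f ∘ suc))
  replace-clique cl h zero zero ne = ⊥-elim (ne refl)
  replace-clique cl h zero (suc l) ne = E-sym (h (suc l))
  replace-clique cl h (suc l) zero ne = h (suc l)
  replace-clique cl h (suc l) (suc l′) ne = cl (suc l) (suc l′) ne

  module _ {S : List V} {x : V} (nS : 𝒩 S) (bx : Big S x) (none : ∀ {u} → C S x u → ¬ U u) where

    private
      -- The ball of radius k - 1 around `U` covers the infinite component and that of radius 0
      -- misses it; somewhere between, finite turns into infinite.
      level-jump : ∀ i → Infinite (λ v → C S x v × Near i v) →
        ∃ λ i → Finite (λ v → C S x v × Near i v) × Infinite (λ v → C S x v × Near (suc i) v)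
      level-jump zero h with h []
      ... | v , (c , now u) , _ = ⊥-elim (none c u)
      level-jump (suc i) h with dec (Finite (λ v → C S x v × Near i v))
      ... | yes f = i , f , h
      ... | no nf = level-jump i (¬fin⇒inf nf)

      abstract
        jump : ∃ λ i → Finite (λ v → C S x v × Near i v) × Infinite (λ v → C S x v × Near (suc i) v)
        jump = level-jump (suc (suc j)) (inf-mono (λ {v} c → c , near-bound v)
                 (ray-infinite (proj₁ bx) (Lives.start (proj₂ bx)) (Lives.from-start (proj₂ bx))))

      i₀ : ℕ
      i₀ = proj₁ jump

      L : List V
      L = proj₁ (proj₁ (proj₂ jump))

    module _ {c : V} (lc : Lev i₀ c) where

      Y : V → Set
      Y z = C S x z × Lev (suc i₀) z × E z c

      -- With `c` in place of one member, the clique has a vertex nearer to `U` than any vertex of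
      -- the old clique.
      no-clique : {f : Fin k → V} → Clique f → (∀ i → Y (f i)) → ⊥
      no-clique {f} cl all = lev-far (proj₁ (proj₂ (all (σ zero)))) (subst (Near i₀) (on zero) (near-img aut (lev-near lc)))
        where
        open Match (clique-match cs (replace-clique cl λ l → proj₂ (proj₂ (all l))) cl)

      star : ∀ {f : Fin (suc (suc j)) → V} → Indep f → (∀ i → Y (f i)) → Star c f
      star ind all = record { leaves = ind ; spokes = λ l → E-sym (proj₂ (proj₂ (all l))) }

    -- A neighbour `p` of `c` one level below can replace a leaf: the leaves are two levels above
    -- `p`, hence not adjacent to it. The new star comes nearer to `U` than the old one.
    no-star-pos : ∀ i → i₀ ≡ suc i → ∀ {c} (lc : Lev i₀ c) {f : Fin (suc (suc j)) → V} → Indep f → (∀ i → Y lc (f i)) → ⊥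
    no-star-pos i eq {c} lc {f} ind all with lev-down (subst (λ m → Lev m c) eq lc)
    ... | p , cp , lp = low (σ (suc zero)) (subst (Near i) (on (suc zero)) (near-img aut (lev-near lp)))
      where
      high : ∀ l → ¬ Near (suc i) (f l)
      high l h = lev-far (proj₁ (proj₂ (all l))) (subst (λ m → Near m (f l)) (sym eq) h)
      s′ : Star c (p ◂ (f ∘ suc))
      s′ = replace-leaf (star lc ind all) cp λ l → (λ e → high l (via (E-sym e) (lev-near lp))) ,
             λ { refl → high l (stay (lev-near lp)) }
      open Match (star-match s′ (star lc ind all))
      low : ∀ l → ¬ Near i ((c ◂ f) l)
      low zero h = lev-far (subst (λ m → Lev m c) eq lc) h
      low (suc l) h = high l (stay h)

    module _ (eq : i₀ ≡ 0) {c : V} (lc : Lev i₀ c) {f : Fin (suc (suc j)) → V} (ind : Indep f) (all : ∀ i → Y lc (f i)) where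

      private
        uc : U c
        uc = lev-U (subst (λ m → Lev m c) eq lc)
        c∈ : c ∈ S
        c∈ = dne λ c∉ → none (conn-snoc (proj₁ (all zero)) (proj₂ (proj₂ (all zero))) c∉) uc
        off : ∀ l → ¬ U (f l)
        off l = none (proj₁ (all l))
        s : Star c f
        s = star lc ind all

      module _ {y : V} (yc : E y c) (y∉ : y ∉ S) (apart : ∀ l → ¬ C S y (f l)) where

        private
          g = y ◂ (f ∘ suc)
          s′ : Star c g
          s′ = replace-leaf s (E-sym yc) λ l →
                 (λ e → apart l (conn-edge y∉ (conn-right (proj₁ (all l))) e)) , λ { refl → apart l (here y∉) }

        -- The star with leaf `y` has two vertices in `U`, the old star only its centre.
        swap-in-U : ¬ U y
        swap-in-U uy = 0≢1 (trans (sym (τσ zero)) (trans (cong τ (trans (centre _ (subst U (on zero) (img-U aut uc)))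
                            (sym (centre _ (subst U (on (suc zero)) (img-U aut uy)))))) (τσ (suc zero))))
          where
          open Match (star-match s′ s)
          centre : ∀ l → U ((c ◂ f) l) → l ≡ zero
          centre zero _ = refl
          centre (suc l) u = ⊥-elim (off l u)

        -- The old leaves are connected off `U`, because their component of `S` misses `U`, whereas
        -- `S` cuts `y` off from them. Connection off `U` is invariant.
        swap-off-U : ¬ U y → ⊥
        swap-off-U nuy = star-swap (Conn (λ v → ¬ U v)) s s′ uc off nuy
          (λ φ _ → ·-conn φ (λ nu u → nu (img-U⁻ φ u)))
          (λ a b → conn-within (λ d → none (conn-trans (proj₁ (all a)) d)) (conn-trans (conn-sym (proj₁ (all a))) (proj₁ (all b))))
          (λ l d → apart l (conn-mono (λ nu v∈ → nu (_ , nS , v∈)) d))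

      no-star-zero : ⊥
      no-star-zero with other-big (𝒩-sep nS) x
      ... | y₀ , by₀ , ny₀ with tight (𝒩-sep nS) by₀ c∈
      ... | y , y₀y , yc = swap-off-U yc (conn-right y₀y) apart (swap-in-U yc (conn-right y₀y) apart)
        where
        apart : ∀ l → ¬ C S y (f l)
        apart l d = ny₀ (conn-trans (proj₁ (all l)) (conn-sym (conn-trans y₀y d)))

    -- Infinitely many vertices of the component lie just above level `i₀`, each with a neighbour at
    -- level `i₀` in the finite set `L ++ S`. One such neighbour serves infinitely many, and
    -- Ramsey's theorem gives a clique or a star.
    leaf-absurd : ⊥
    leaf-absurd with inf-pigeon (λ t z → E z t × Lev i₀ t) (L ++ S)
                       (inf-mono (λ { ((d , h) , v∉) → d , levs h λ h′ → v∉ (proj₂ (proj₁ (proj₂ jump)) _ (d , h′)) })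
                         (inf-minus L (proj₂ (proj₂ jump)))) below
      where
      below : ∀ z → C S x z × Lev (suc i₀) z → ∃ λ t → t ∈ L ++ S × (E z t × Lev i₀ t)
      below z (d , l) with lev-down l
      ... | w , e , lw with dec (w ∈ S)
      ... | yes w∈ = w , ∈-++⁺ʳ L w∈ , e , lw
      ... | no w∉ = w , ∈-++⁺ˡ (proj₂ (proj₁ (proj₂ jump)) w (conn-snoc d e w∉ , lev-near lw)) , e , lw
    ... | c , _ , inf with inf []
    ... | _ , (_ , (_ , lc)) , _ with ramsey k (suc (suc j)) {Y lc} (inf-mono (λ { ((d , l) , (e , _)) → d , l , e }) inf)
    ... | inj₁ (f , cl , all) = no-clique lc cl all
    ... | inj₂ (f , ind , all) = by-level i₀ refl
      where
      by-level : ∀ m → i₀ ≡ m → ⊥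
      by-level zero eq = no-star-zero eq lc ind all
      by-level (suc m) eq = no-star-pos m eq lc ind all

  abstract
    meets-U : ∀ {S x} → 𝒩 S → Big S x → ∃ λ u → C S x u × U u
    meets-U nS bx = dne λ h → leaf-absurd nS bx λ c u → h (_ , c , u)

-- Separators between two vertices; paths deep into a component

module Deep (em : ExcludedMiddle (Level.suc 0ℓ)) (G : Graph) (more : MoreThanOneEnd G)
  (connected : Connected G) (j : ℕ) (cs : CSTransitive G (suc (suc (suc j)))) where
  open import Data.Fin using (Fin; zero; suc)
  open import Data.Bool using (Bool)
  open import Data.Vec using (Vec; tabulate)
  import Data.Vec as Vec
  open import Data.Vec.Properties using (lookup∘tabulate)
  open import Relation.Nullary using (does)
  open import Data.List using (lookup; take)
  open import Data.List.Properties using (length-take)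
  open Leaf em G more connected j cs public

  record SS (S : List V) (a b : V) : Set where
    constructor ss
    field
      ss-𝒩 : 𝒩 S
      ss-left : Big S a
      ss-right : Big S b
      ss-apart : ¬ C S a b

  -- Separators are lists, so two of them are distinct when they have different elements.
  data Seps (a b : V) : List (List V) → Set where
    [] : Seps a b []
    add : ∀ {S Ss} → SS S a b → (∀ {T} → T ∈ Ss → ¬ S ≋ T) → Seps a b Ss → Seps a b (S ∷ Ss)

  -- A lower bound for the number of family members between `a` and `b`; the number itself is never
  -- formed.
  Many : ℕ → V → V → Set
  Many m a b = ∃ λ Ss → Seps a b Ss × length Ss ≡ m

  seps-sym : ∀ {a b Ss} → Seps a b Ss → Seps b a Ss
  seps-sym [] = []
  seps-sym (add (ss n l r c) d s) = add (ss n r l (c ∘ conn-sym)) d (seps-sym s)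

  many-sym : ∀ {m a b} → Many m a b → Many m b a
  many-sym (Ss , s , len) = Ss , seps-sym s , len

  img-≋⁻ : ∀ φ {S T} → img φ S ≋ img φ T → S ≋ T
  img-≋⁻ φ {S} {T} eq = subst₂ _≋_ (img-inv φ S) (img-inv φ T) (img-≋ (inv φ) eq)

  img-seps : ∀ φ {a b Ss} → Seps a b Ss → Seps (φ · a) (φ · b) (map (img φ) Ss)
  img-seps φ [] = []
  img-seps φ (add {S} {Ss} (ss n l r c) d s) =
    add (ss (img-𝒩 φ n) (img-Big φ l) (img-Big φ r) (c ∘ img-C⁻ φ)) d′ (img-seps φ s)
    where
    d′ : ∀ {T} → T ∈ map (img φ) Ss → ¬ img φ S ≋ T
    d′ T∈ eq with ∈-map⁻ (img φ) T∈
    ... | T , T∈′ , refl = d T∈′ (img-≋⁻ φ eq)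

  img-many : ∀ φ {m a b} → Many m a b → Many m (φ · a) (φ · b)
  img-many φ (Ss , s , len) = map (img φ) Ss , img-seps φ s , trans (length-map (img φ) Ss) len

  seps-bound : ∀ {a b Ss} (Ls : List (List V)) → Seps a b Ss → (∀ {S} → S ∈ Ss → ∃ λ T → T ∈ Ls × S ≋ T) →
    length Ss ≤ length Ls
  seps-bound Ls [] h = z≤n
  seps-bound Ls (add {S} {Ss} _ d s) h with h (here refl)
  ... | T , T∈ , eq = ≤-<-trans (seps-bound (keep (λ X → ¬ X ≋ T) Ls) s h′)
                        (keep-drops (λ X → ¬ X ≋ T) T∈ (λ ne → ne ≋-refl))
    where
    h′ : ∀ {S′} → S′ ∈ Ss → ∃ λ X → X ∈ keep (λ X → ¬ X ≋ T) Ls × S′ ≋ X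
    h′ S′∈ with h (there S′∈)
    ... | X , X∈ , eq′ = X , ∈-keep⁺ X∈ (λ xt → d S′∈ (≋-trans eq (≋-trans (≋-sym xt) (≋-sym eq′)))) , eq′

  many-finite : ∀ a b → ∃ λ M → ∀ {m} → Many m a b → m ≤ M
  many-finite a b with seps-finite a b
  ... | Ls , f = length Ls , λ { (Ss , s , refl) → seps-bound Ls s (found s) }
    where
    found : ∀ {Ss} → Seps a b Ss → ∀ {S} → S ∈ Ss → ∃ λ T → T ∈ Ls × S ≋ T
    found (add (ss n l r c) _ s) (here refl) = f _ (𝒩-sep n) l r c
    found (add _ _ s) (there q) = found s q

  module Uniform {l₀ : ℕ} (cs₀ : CSTransitive G l₀) where

    private
      Type : Set
      Type = Vec (Vec Bool l₀) l₀

      type : (Fin l₀ → V) → Type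
      type f = tabulate λ i → tabulate λ l → does (dec (E (f i) (f l)))

      bit-eq : ∀ {A B : Set} → does (dec A) ≡ does (dec B) → A → B
      bit-eq {A} {B} eq a with dec A | dec B
      ... | yes _ | yes b = b
      ... | no na | _ = ⊥-elim (na a)
      bit-eq {A} {B} () a | yes _ | no _

      same-type : ∀ {f g} → type f ≡ type g → ∀ i l → E (f i) (f l) → E (g i) (g l)
      same-type {f} {g} eq i l = bit-eq (trans (sym (entry f)) (trans (cong (λ t → Vec.lookup (Vec.lookup t i) l) eq) (entry g)))
        where
        entry : ∀ f → Vec.lookup (Vec.lookup (type f) i) l ≡ does (dec (E (f i) (f l)))
        entry f = trans (cong (λ v → Vec.lookup v l) (lookup∘tabulate _ i)) (lookup∘tabulate _ l)

      Q : (Fin l₀ → V) → ℕ → Set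
      Q f M = ∀ i l {m} → Many m (f i) (f l) → m ≤ M

      Q-some : ∀ f → ∃ (Q f)
      Q-some f = bound-Fin l₀ (λ i M → ∀ l {m} → Many m (f i) (f l) → m ≤ M) (λ i M≤ h l x → ≤-trans (h l x) M≤)
        λ i → bound-Fin l₀ (λ l M → ∀ {m} → Many m (f i) (f l) → m ≤ M) (λ l M≤ h x → ≤-trans (h x) M≤)
          λ l → many-finite (f i) (f l)

      Q-match : ∀ {f g M} → Match f g → Q f M → Q g M
      Q-match {f} {g} {M} mt q i l x = q (τ i) (τ l) (subst₂ (Many _) (pull i) (pull l) (img-many (inv aut) x))
        where
        open Match mt
        pull : ∀ i → bwd aut (g i) ≡ f (τ i)
        pull i = trans (cong (bwd aut) (trans (cong g (sym (στ i))) (sym (on (τ i))))) (bwd-· aut _)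

    abstract
      -- There are finitely many isomorphism types of k-vertex graphs, and each is a single orbit.
      uniform : ∃ λ M → ∀ (f : Fin l₀ → V) → InjectiveFin G f → InducedConnected G f → ∀ i l {m} → Many m (f i) (f l) → m ≤ M
      uniform with bound-Vec (bound-Vec bound-Bool l₀) l₀
                     (λ t M → ∀ f → InjectiveFin G f → InducedConnected G f → type f ≡ t → Q f M)
                     (λ t M≤ h f a b c i l x → ≤-trans (h f a b c i l x) M≤) per-type
        where
        per-type : ∀ t → ∃ λ M → ∀ f → InjectiveFin G f → InducedConnected G f → type f ≡ t → Q f M
        per-type t with dec (∃ λ f → InjectiveFin G f × InducedConnected G f × type f ≡ t)
        ... | no none = 0 , λ f a b c → ⊥-elim (none (f , a , b , c))
        ... | yes (f , a , b , c) = proj₁ (Q-some f) , λ g a′ b′ c′ →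
                Q-match (match cs₀ f g a a′ b (same-type (trans c (sym c′))) (same-type (trans c′ (sym c)))) (proj₂ (Q-some f))
      ... | M , h = M , λ f a b → h (type f) f a b refl

  M₀ : ℕ
  M₀ = proj₁ (Uniform.uniform cs)

  adjoin : ∀ {m} (f : Fin (suc m) → V) → ∃ λ v → (∀ i → v ≢ f i) × ∃ λ i → E v (f i)
  adjoin {m} f with ray-infinite {Q = λ _ → ⊤} (proj₁ more) 0 (λ _ _ → tt) (Vec.toList (tabulate f))
  ... | w , _ , w∉ with first-exit (λ v → ∃ λ i → v ≡ f i) (zero , refl)
                          (λ { (i , refl) → w∉ (in-list f i) }) (connected (f zero) w)
    where
    in-list : ∀ {m} (f : Fin m → V) i → f i ∈ Vec.toList (tabulate f)
    in-list f zero = here refl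
    in-list f (suc i) = there (in-list (f ∘ suc) i)
  ... | x , y , (i , refl) , ny , e , _ = y , (λ l eq → ny (l , eq)) , i , E-sym e

  -- An infinite connected graph lets a finite connected subgraph take in one more neighbour, so
  -- bounds for k vertices apply to smaller subgraphs.
  extend : ∀ d {m} (f : Fin (suc m) → V) → InjectiveFin G f → InducedConnected G f →
    Σ (Fin (d + suc m) → V) λ g → InjectiveFin G g × InducedConnected G g × (∀ i → ∃ λ l → g l ≡ f i)
  extend zero f inj-f con = f , inj-f , con , λ i → i , refl
  extend (suc d) {m} f inj-f con with extend d f inj-f con
  ... | g , inj-g , con-g , cover = grow (d + m) (+-suc d m) g inj-g con-g cover
    where
    grow : ∀ l → d + suc m ≡ suc l → (g : Fin (d + suc m) → V) → InjectiveFin G g → InducedConnected G g →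
      (∀ i → ∃ λ l → g l ≡ f i) →
      Σ (Fin (suc (d + suc m)) → V) λ h → InjectiveFin G h × InducedConnected G h × (∀ i → ∃ λ l → h l ≡ f i)
    grow l eq g inj-g con-g cover rewrite eq with adjoin g
    ... | v , v≢ , i , e = v ◂ g , inj′ , ci-add {f = v ◂ g} {i = i} e con-g , λ a → suc (proj₁ (cover a)) , proj₂ (cover a)
      where
      inj′ : InjectiveFin G (v ◂ g)
      inj′ zero zero _ = refl
      inj′ zero (suc b) q = ⊥-elim (v≢ b q)
      inj′ (suc a) zero q = ⊥-elim (v≢ a (sym q))
      inj′ (suc a) (suc b) q = cong suc (inj-g a b q)

  ∈-lookup⁻ : ∀ {xs : List V} {x} → x ∈ xs → ∃ λ i → lookup xs i ≡ x
  ∈-lookup⁻ (here refl) = zero , refl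
  ∈-lookup⁻ (there q) with ∈-lookup⁻ q
  ... | i , eq = suc i , eq

  few-across : ∀ {x xs y m} → IP (x ∷ xs) → length (x ∷ xs) ≤ k → y ∈ x ∷ xs → Many m x y → m ≤ M₀
  few-across {x} {xs} {y} p le y∈ mn = go (k ∸ length (x ∷ xs)) (m∸n+n≡m le)
    where
    go : ∀ d → d + suc (length xs) ≡ k → _
    go d eq with extend d (lookup (x ∷ xs)) (ip-inj p) (ip-ci p)
    ... | g , inj-g , con-g , cover = bounded (d + suc (length xs)) eq g inj-g con-g (proj₁ (cover zero)) (proj₁ (cover i))
          (subst₂ (Many _) (sym (proj₂ (cover zero))) (sym (trans (proj₂ (cover i)) (proj₂ (∈-lookup⁻ y∈)))) mn)
      where
      i = proj₁ (∈-lookup⁻ y∈)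
      bounded : ∀ l → l ≡ k → (g : Fin l → V) → InjectiveFin G g → InducedConnected G g → ∀ a b {m} → Many m (g a) (g b) → m ≤ M₀
      bounded l refl g inj-g con-g = proj₂ (Uniform.uniform cs) g inj-g con-g

  record Next (S : List V) (x : V) : Set where
    field
      S′ : List V
      x′ : V
      n𝒩 : 𝒩 S′
      nBig : Big S′ x′
      inside : ∀ {z} → C S′ x′ z → C S x z
      witness : ∃ λ u → u ∈ S′ × C S x u
      bounded : ∀ {v} → v ∈ S′ → v ∈ S ⊎ C S x v

  abstract
    -- A separator meets the component of `x` by `meets-U`. By nestedness one of its own components
    -- with an end misses `S`, and tightness ties this one to `u`, hence places it inside.
    next : ∀ {S x} → 𝒩 S → Big S x → Next S x
    next {S} {x} nS bx with meets-U nS bx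
    ... | u , xu , S′ , nS′ , u∈ with free-big (𝒩-sep nS′) (nested nS nS′)
    ... | y , by , off with tight (𝒩-sep nS′) by u∈
    ... | w , yw , wu = record
      { S′ = S′ ; x′ = y ; n𝒩 = nS′ ; nBig = by
      ; inside = λ c → conn-trans (conn-trans (conn-snoc xu (E-sym wu) (conn-right yw′)) (conn-sym yw′)) (comp-off off c)
      ; witness = u , u∈ , xu
      ; bounded = bnd }
      where
      yw′ : C S y w
      yw′ = comp-off off yw
      bnd : ∀ {v} → v ∈ S′ → v ∈ S ⊎ C S x v
      bnd {v} v∈ with dec (v ∈ S)
      ... | yes q = inj₁ q
      ... | no q = inj₂ (conn-trans xu (nested-conn (nested nS′ nS) u∈ v∈ (conn-right xu) q))

  big-within : ∀ {S T x} → (∀ {z} → C S x z → z ∉ T) → Big S x → Big T x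
  big-within off (ρ , lv N f) = ρ , lv N λ i le → conn-within off (f i le)

  -- Iterating `next` puts any number of separators between `y` and a vertex `z` ever deeper inside.
  -- The last clause keeps the new ones distinct from `S`: they contain vertices of its component.
  chain : ∀ m {S x y} → 𝒩 S → Big S x → Big S y → ¬ C S y x →
    ∃ λ z → C S x z × ∃ λ Ss → Seps y z Ss × length Ss ≡ suc m × (∀ {T} → T ∈ Ss → T ≡ S ⊎ ∃ λ u → u ∈ T × C S x u)
  chain zero {S} {x} nS bx by nc = x , here (big∉ bx) , S ∷ [] , add (ss nS by bx nc) (λ ()) [] , refl , λ { (here refl) → inj₁ refl }
  chain (suc m) {S} {x} {y} nS bx by nc with next nS bx
  ... | nx with chain m (Next.n𝒩 nx) (Next.nBig nx) (big-within off by) (λ c → nc (conn-sym (Next.inside nx (conn-sym c))))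
    where
    off : ∀ {z} → C S y z → z ∉ Next.S′ nx
    off c z∈ with Next.bounded nx z∈
    ... | inj₁ q = conn-right c q
    ... | inj₂ q = nc (conn-trans c (conn-sym q))
  ... | z , xz , Ss , s , len , new = z , xz′ , S ∷ Ss , add (ss nS by (big-conn xz′ bx) (λ c → nc (conn-trans c (conn-sym xz′)))) distinct s ,
        cong suc len , λ { (here refl) → inj₁ refl ; (there q) → inj₂ (new′ q) }
    where
    xz′ = Next.inside nx xz
    new′ : ∀ {T} → T ∈ Ss → ∃ λ u → u ∈ T × C S x u
    new′ q with new q
    ... | inj₁ refl = Next.witness nx
    ... | inj₂ (u , u∈ , c) = u , u∈ , Next.inside nx c
    distinct : ∀ {T} → T ∈ Ss → ¬ S ≋ T
    distinct q (_ , g) with new′ q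
    ... | u , u∈ , c = conn-right c (g u∈)

  DeepPath : List V → V → V → Set
  DeepPath S x s = ∃ λ qs → IP (s ∷ qs) × length qs ≡ suc (suc j) × (∀ {q} → q ∈ qs → C S x q)

  abstract
    -- The target `z` has `M₀ + 1` separators between it and a neighbour `y₀` of `s` on another
    -- side, so an induced path from `y₀` through `s` to `z` has more than k vertices. Its part from
    -- `s` on is cut down to k.
    deep : ∀ {S x s} → 𝒩 S → Big S x → s ∈ S → DeepPath S x s
    deep {S} {x} {s} nS bx s∈ with other-big (𝒩-sep nS) x
    ... | y , by , nxy with tight (𝒩-sep nS) by s∈ | tight (𝒩-sep nS) bx s∈
    ... | y₀ , yy₀ , y₀s | w , xw , ws with chain M₀ nS bx (big-conn yy₀ by) (λ c → nxy (conn-sym (conn-trans yy₀ c)))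
    ... | z , xz , Ss , sp , len , _ with induced-path {P = λ v → v ≡ s ⊎ C S x v}
          (step (inj₁ refl) (E-sym ws) (conn-within (λ d → inj₂ (conn-trans xw d)) (conn-trans (conn-sym xw) xz)))
    ... | qs , (zs , ends) , ip , all = take (suc (suc j)) qs , ip-take _ ip , length≥ , λ q → inC (take-⊂ _ qs q)
      where
      inC : ∀ {q} → q ∈ qs → C S x q
      inC q∈ with all (there q∈)
      ... | inj₁ refl = ⊥-elim (ip-head∉ ip q∈)
      ... | inj₂ c = c
      y₀∉ : ∀ {q} → q ∈ qs → ¬ C S y₀ q
      y₀∉ q∈ c = nxy (conn-trans (inC q∈) (conn-sym (conn-trans yy₀ c)))
      ip′ : IP (y₀ ∷ s ∷ qs)
      ip′ = cons y₀s (λ q∈ e → y₀∉ q∈ (conn-edge (conn-right yy₀) (conn-right (inC q∈)) e))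
              (λ { (here refl) → conn-right yy₀ s∈ ; (there q∈) → y₀∉ q∈ (here (conn-right yy₀)) }) ip
      long : suc (suc j) ≤ length qs
      long with suc (suc j) ≤? length qs
      ... | yes le = le
      ... | no nle = ⊥-elim (<-irrefl refl (few-across ip′ (s≤s (≰⇒> nle))
              (there (subst (z ∈_) (sym ends) (∈-++⁺ʳ zs (here refl)))) (Ss , sp , len)))
      length≥ : length (take (suc (suc j)) qs) ≡ suc (suc j)
      length≥ = trans (length-take (suc (suc j)) qs) (m≤n⇒m⊓n≡m long)

-- Induced paths do not return to a separator

module Returns (em : ExcludedMiddle (Level.suc 0ℓ)) (G : Graph) (more : MoreThanOneEnd G)
  (connected : Connected G) (j : ℕ) (cs : CSTransitive G (suc (suc (suc j)))) where
  open import Data.List using (take; drop)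
  open import Data.List.Properties using (length-take; length-drop; length-reverse; take++drop≡id; reverse-++; reverse-involutive; unfold-reverse; map-++; ++-assoc; ∷ʳ-injectiveˡ; ∷-injective; ∷-injectiveʳ)
  open import Data.List.Relation.Unary.Any.Properties using (reverse⁺; reverse⁻)
  open Deep em G more connected j cs public

  record Pk (xs : List V) : Set where
    constructor pk
    field
      pk-ip : IP xs
      pk-length : length xs ≡ k

  transport : (R : List V → Set) → (∀ φ {xs} → R xs → R (img φ xs)) → (∀ {xs} → R xs → R (reverse xs)) →
    ∀ {xs ys} → Pk xs → Pk ys → R xs → R ys
  transport R im rev (pk p l) (pk q m) r with equiv p q l m
  ... | φ , inj₁ eq = subst R eq (im φ r)
  ... | φ , inj₂ eq = subst R (reverse-involutive _) (rev (subst R eq (im φ r)))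

  First Last : List V → V → Set
  First xs a = ∃ λ zs → xs ≡ a ∷ zs
  Last xs b = ∃ λ zs → xs ≡ zs ++ b ∷ []

  first-reverse : ∀ {xs a} → First (reverse xs) a → Last xs a
  first-reverse {xs} {a} (zs , eq) = reverse zs , trans (sym (reverse-involutive xs)) (trans (cong reverse eq) (unfold-reverse a zs))

  last-reverse : ∀ {xs a} → Last (reverse xs) a → First xs a
  last-reverse {xs} {a} (zs , eq) = reverse zs , trans (sym (reverse-involutive xs)) (trans (cong reverse eq) (reverse-++ zs (a ∷ [])))

  first-img : ∀ φ {xs a} → First (img φ xs) a → ∃ λ b → First xs b × a ≡ φ · b
  first-img φ {x ∷ xs} (zs , refl) = x , (xs , refl) , refl

  last-img : ∀ φ {xs a} → Last (img φ xs) a → ∃ λ b → Last xs b × a ≡ φ · b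
  last-img φ {[]} ([] , ())
  last-img φ {[]} (_ ∷ _ , ())
  last-img φ {x ∷ []} ([] , refl) = x , ([] , refl) , refl
  last-img φ {x ∷ []} (_ ∷ [] , ())
  last-img φ {x ∷ []} (_ ∷ _ ∷ _ , ())
  last-img φ {x ∷ y ∷ xs} ([] , ())
  last-img φ {x ∷ y ∷ xs} (z ∷ zs , eq) with last-img φ {y ∷ xs} (zs , ∷-injectiveʳ eq)
  ... | b , (ws , eq′) , eq″ = b , (x ∷ ws , cong (x ∷_) eq′) , eq″

  last-unique : ∀ {xs a b} → Last xs a → Last xs b → a ≡ b
  last-unique (zs , refl) (ws , eq) = ∷-injectiveˡʳ zs ws eq
    where
    ∷-injectiveˡʳ : ∀ zs ws {a b : V} → zs ++ a ∷ [] ≡ ws ++ b ∷ [] → a ≡ b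
    ∷-injectiveˡʳ [] [] refl = refl
    ∷-injectiveˡʳ [] (_ ∷ []) ()
    ∷-injectiveˡʳ [] (_ ∷ _ ∷ _) ()
    ∷-injectiveˡʳ (_ ∷ []) [] ()
    ∷-injectiveˡʳ (_ ∷ _ ∷ _) [] ()
    ∷-injectiveˡʳ (_ ∷ zs) (_ ∷ ws) eq = ∷-injectiveˡʳ zs ws (∷-injectiveʳ eq)

  last-exists : ∀ x xs → ∃ λ b → Last (x ∷ xs) b
  last-exists x [] = x , [] , refl
  last-exists x (y ∷ xs) with last-exists y xs
  ... | b , zs , eq = b , x ∷ zs , cong (x ∷_) eq

  last-∈ : ∀ {xs b} → Last xs b → b ∈ xs
  last-∈ (zs , refl) = ∈-++⁺ʳ zs (here refl)

  last-++ : ∀ as {bs b} → Last bs b → Last (as ++ bs) b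
  last-++ as (zs , refl) = as ++ zs , sym (++-assoc as zs _)

  last-suffix : ∀ as {w bs b} → Last (as ++ w ∷ bs) b → Last (w ∷ bs) b
  last-suffix [] h = h
  last-suffix (a ∷ as) {w} {bs} h with last-exists w bs
  ... | c , l = subst (Last (w ∷ bs)) (last-unique (last-++ (a ∷ as) l) h) l

  ManyEnds : ℕ → List V → Set
  ManyEnds m xs = ∀ {a b} → First xs a → Last xs b → Many m a b

  many-ends : ∀ {xs ys a b c d m} → Pk xs → Pk ys → First xs a → Last xs b → First ys c → Last ys d → Many m a b → Many m c d
  many-ends {m = m} p q fa lb fc ld mn = transport (ManyEnds m) im rev p q (start fa lb mn) fc ld
    where
    start : ∀ {xs a b} → First xs a → Last xs b → Many m a b → ManyEnds m xs
    start (_ , refl) lb mn (_ , refl) lb′ = subst (Many m _) (last-unique lb lb′) mn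
    im : ∀ φ {xs} → ManyEnds m xs → ManyEnds m (img φ xs)
    im φ h f l with first-img φ f | last-img φ l
    ... | _ , f′ , refl | _ , l′ , refl = img-many φ (h f′ l′)
    rev : ∀ {xs} → ManyEnds m xs → ManyEnds m (reverse xs)
    rev h f l = many-sym (h (last-reverse l) (first-reverse f))

  -- Only finitely many separators lie between two vertices; a count that can always be raised is
  -- the contradiction behind the path exchanges below.
  climb : ∀ {a b} → (∀ {m} → Many m a b → Many (suc m) a b) → ⊥
  climb {a} {b} h = <-irrefl refl (proj₂ (many-finite a b) (all (suc (proj₁ (many-finite a b)))))
    where
    all : ∀ m → Many m a b
    all zero = [] , [] , refl
    all (suc m) = h (all m)

  -- The path meets `S` only in the inner vertex `v`, where it passes from one component with an end
  -- to another. Two arms joined at a separator give one such path, so all induced paths on k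
  -- vertices have this property.
  record Clean (xs : List V) : Set where
    field
      us vs : List V
      v : V
      split : xs ≡ us ++ v ∷ vs
      S : List V
      c𝒩 : 𝒩 S
      v∈ : v ∈ S
      a b : V
      a-big : Big S a
      b-big : Big S b
      ab : ¬ C S a b
      us-a : ∀ {u} → u ∈ us → C S a u
      vs-b : ∀ {w} → w ∈ vs → C S b w
      us-some : ∃ λ u → u ∈ us
      vs-some : ∃ λ w → w ∈ vs

  clean-img : ∀ φ {xs} → Clean xs → Clean (img φ xs)
  clean-img φ c = record
    { us = img φ us ; vs = img φ vs ; v = φ · v ; split = trans (cong (img φ) split) (map-++ (φ ·_) us (v ∷ vs))
    ; S = img φ S ; c𝒩 = img-𝒩 φ c𝒩 ; v∈ = ∈-map⁺ (φ ·_) v∈ ; a = φ · a ; b = φ · b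
    ; a-big = img-Big φ a-big ; b-big = img-Big φ b-big ; ab = ab ∘ img-C⁻ φ
    ; us-a = side us-a ; vs-b = side vs-b
    ; us-some = _ , ∈-map⁺ (φ ·_) (proj₂ us-some) ; vs-some = _ , ∈-map⁺ (φ ·_) (proj₂ vs-some) }
    where
    open Clean c
    side : ∀ {x zs} → (∀ {u} → u ∈ zs → C S x u) → ∀ {u} → u ∈ img φ zs → C (img φ S) (φ · x) u
    side h u∈ with ∈-map⁻ (φ ·_) u∈
    ... | _ , u∈′ , refl = img-C φ (h u∈′)

  clean-reverse : ∀ {xs} → Clean xs → Clean (reverse xs)
  clean-reverse c = record
    { us = reverse vs ; vs = reverse us ; v = v
    ; split = trans (cong reverse split) (trans (reverse-++ us (v ∷ vs)) (trans (cong (_++ reverse us) (unfold-reverse v vs))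
                (++-assoc (reverse vs) (v ∷ []) (reverse us))))
    ; S = S ; c𝒩 = c𝒩 ; v∈ = v∈ ; a = b ; b = a ; a-big = b-big ; b-big = a-big ; ab = ab ∘ conn-sym
    ; us-a = λ q → vs-b (reverse⁻ q) ; vs-b = λ q → us-a (reverse⁻ q)
    ; us-some = _ , reverse⁺ (proj₂ vs-some) ; vs-some = _ , reverse⁺ (proj₂ us-some) }
    where open Clean c

  apart-nbr : ∀ {S a b u w} → ¬ C S a b → C S a u → C S b w → ¬ E u w × u ≢ w
  apart-nbr nc p q = (λ e → nc (conn-trans (conn-snoc p e (conn-right q)) (conn-sym q))) ,
                     λ { refl → nc (conn-trans p (conn-sym q)) }

  through : ∀ {S a b s us vs} → ¬ C S a b → IP (s ∷ us) → IP (s ∷ vs) →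
    (∀ {u} → u ∈ us → C S a u) → (∀ {w} → w ∈ vs → C S b w) → IP (reverse us ++ s ∷ vs)
  through {s = s} {us} nc p q ua vb = ip-join (reverse us) (subst IP (unfold-reverse s us) (ip-reverse p)) q
    λ u∈ w∈ → apart-nbr nc (ua (reverse⁻ u∈)) (vb w∈)

  length-through : ∀ (us : List V) s vs → length (reverse us ++ s ∷ vs) ≡ suc (length us + length vs)
  length-through us s vs = trans (length-++ (reverse us)) (trans (cong (_+ suc (length vs)) (length-reverse us)) (+-suc (length us) (length vs)))

  abstract
    clean-exists : ∃ λ xs → Pk xs × Clean xs
    clean-exists with some-𝒩
    ... | S , nS with sep-nonempty (𝒩-sep nS) | sep-cut (𝒩-sep nS)
    ... | s , s∈ | ρ , σ , a , b , la , lb , nc with deep nS (ρ , la) s∈ | deep nS (σ , lb) s∈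
    ... | u ∷ us , p , _ , ua | vs , q , lq , vb = _ , pk path len , record
          { us = u ∷ [] ; vs = take (suc j) vs ; v = s ; split = refl ; S = S ; c𝒩 = nS ; v∈ = s∈ ; a = a ; b = b
          ; a-big = ρ , la ; b-big = σ , lb ; ab = nc ; us-a = λ { (here refl) → ua (here refl) }
          ; vs-b = λ w∈ → vb (take-⊂ (suc j) vs w∈) ; us-some = u , here refl ; vs-some = some vs lq }
      where
      path : IP (u ∷ s ∷ take (suc j) vs)
      path = through nc (ip-init (u ∷ []) p) (ip-take (suc j) q) (λ { (here refl) → ua (here refl) }) (λ w∈ → vb (take-⊂ (suc j) vs w∈))
      len : length (u ∷ s ∷ take (suc j) vs) ≡ k
      len = cong (suc ∘ suc) (trans (length-take (suc j) vs) (trans (cong (suc j ⊓_) lq) (m≤n⇒m⊓n≡m (n≤1+n (suc j)))))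
        where open import Data.Nat using (_⊓_)
      some : ∀ (vs : List V) → length vs ≡ suc (suc j) → ∃ λ w → w ∈ take (suc j) vs
      some (v ∷ vs) _ = v , here refl

  clean : ∀ {xs} → Pk xs → Clean xs
  clean p = transport Clean clean-img clean-reverse (proj₁ (proj₂ clean-exists)) p (proj₂ (proj₂ clean-exists))

  raise : ∀ {S t x y m} → SS S y x → (∀ {T} → SS T t x → SS T y x × ¬ S ≋ T) → Many m t x → Many (suc m) y x
  raise {S} {t} {x} {y} new h (Ss , sp , len) = S ∷ Ss , add new (distinct sp) (go sp) , cong suc len
    where
    go : ∀ {Ss} → Seps t x Ss → Seps y x Ss
    go [] = []
    go (add s d sp) = add (proj₁ (h s)) d (go sp)
    distinct : ∀ {Ss} → Seps t x Ss → ∀ {T} → T ∈ Ss → ¬ S ≋ T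
    distinct (add s _ _) (here refl) = proj₂ (h s)
    distinct (add _ _ sp) (there q) = distinct sp q

  -- A separator `T` between `t` and `x` misses the component of `y`: otherwise, by nestedness, it
  -- would miss that of `b`, through which `t` reaches `x`. So `t` and `y` are on the same side of
  -- `T`; and `S` is new because it contains `t`.
  push : ∀ {S b t x y m} → 𝒩 S → Big S b → C S b x → t ∈ S → Big S y → ¬ C S b y → Many m t x → Many (suc m) y x
  push {S} {b} {t} {x} {y} nS bb bx t∈ by nby =
    raise (ss nS by (big-conn bx bb) λ c → nby (conn-trans bx (conn-sym c))) one-sep
    where
    one-sep : ∀ {T} → SS T t x → SS T y x × ¬ S ≋ T
    one-sep {T} (ss nT bt bTx ntx) = ss nT (big-conn ty bt) bTx (λ c → ntx (conn-trans ty c)) , λ (f , _) → big∉ bt (f t∈)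
      where
      offY : ∀ {z} → C S y z → z ∉ T
      offY {z} yz z∈ with tight (𝒩-sep nS) bb t∈
      ... | w , bw , wt = ntx (step (big∉ bt) (E-sym wt) (conn-within (λ d → offB (conn-trans bw d)) (conn-trans (conn-sym bw) bx)))
        where
        offB : ∀ {z′} → C S b z′ → z′ ∉ T
        offB bz′ z′∈ = nby (conn-trans bz′ (conn-trans (nested-conn (nested nT nS) z′∈ z∈ (conn-right bz′) (conn-right yz)) (conn-sym yz)))
      ty : C T t y
      ty with tight (𝒩-sep nS) by t∈
      ... | w , yw , wt = step (big∉ bt) (E-sym wt) (conn-sym (conn-within offY yw))

  split-last : ∀ {A : Set} m (xs : List A) → m ≤ length xs → ∃ λ as → ∃ λ bs → xs ≡ as ++ bs × length bs ≡ m
  split-last m xs le = take (length xs ∸ m) xs , drop (length xs ∸ m) xs , sym (take++drop≡id (length xs ∸ m) xs) ,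
    trans (length-drop (length xs ∸ m) xs) (m∸[m∸n]≡n le)

  ip-suffix′ : ∀ as {bs m} → length bs ≡ suc m → IP (as ++ bs) → IP bs
  ip-suffix′ as {b ∷ bs} _ p = ip-suffix as p

  ip-conn₂ : ∀ {P : V → Set} xs {ys} → IP (xs ++ ys) → (∀ {x} → x ∈ xs → P x) →
    ∀ {y z} → y ∈ xs → z ∈ xs → Conn P y z
  ip-conn₂ (x ∷ xs) p f y∈ z∈ = conn-trans (conn-sym (ip-conn (ip-init xs p) f y∈)) (ip-conn (ip-init xs p) f z∈)

  nonempty-last : ∀ {xs : List V} → (∃ λ x → x ∈ xs) → ∃ λ b → Last xs b
  nonempty-last {[]} (_ , ())
  nonempty-last {x ∷ xs} _ = last-exists x xs

  peel : ∀ {t s v ws A vs} → t ∷ ws ++ s ∷ [] ≡ A ++ v ∷ vs → (∃ λ x → x ∈ A) → (∃ λ x → x ∈ vs) →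
    ∃ λ A′ → ∃ λ vs₀ → A ≡ t ∷ A′ × vs ≡ vs₀ ++ s ∷ [] × ws ≡ A′ ++ v ∷ vs₀
  peel {A = []} eq (_ , ()) _
  peel {t} {s} {v} {ws} {x ∷ A′} {vs} eq _ ne with nonempty-last ne
  ... | c , vs₀ , refl with last-unique (vs₀-last) (t ∷ ws , sym eq)
    where
    vs₀-last : Last (x ∷ A′ ++ v ∷ vs₀ ++ c ∷ []) c
    vs₀-last = last-++ (x ∷ A′) (last-++ (v ∷ []) (vs₀ , refl))
  ... | refl = A′ , vs₀ , cong (_∷ A′) (sym (proj₁ (∷-injective eq))) , refl ,
    ∷ʳ-injectiveˡ ws (A′ ++ v ∷ vs₀) (trans (∷-injectiveʳ eq) (sym (++-assoc A′ (v ∷ vs₀) (s ∷ []))))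

  module _ {S : List V} {b s t : V} {ws lead : List V} (nS : 𝒩 S) (bb : Big S b) (s∈ : s ∈ S) (t∈ : t ∈ S)
    (ip : IP (t ∷ ws ++ s ∷ lead)) (wsB : ∀ {w} → w ∈ ws → w ∉ S × ¬ C S b w) (leadB : ∀ {l} → l ∈ lead → C S b l)
    (long : suc j ≤ length lead) where

    -- Replacing `t` and `ws` by an arm of equally many vertices in another component gives a path
    -- on k vertices with the same last vertex, and by `push` one more separator lies between its
    -- ends.
    no-short-return : length ws ≤ j → ⊥
    no-short-return r≤j with other-big (𝒩-sep nS) b
    ... | y , by , nby with deep nS by s∈
    ... | qs , ipq , lq , qsY = climb step-up
      where
      r = length ws
      -- The `r + 2` vertices from `t` to `s` leave `m` for the lead. As `r ≤ j`, this is positive,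
      -- so the last vertex lies in the component of `b`.
      m = suc j ∸ r
      lead₁ = take m lead
      ys = take (suc r) qs
      leadB₁ : ∀ {l} → l ∈ lead₁ → C S b l
      leadB₁ q = leadB (take-⊂ m lead q)
      ip₁ : IP (t ∷ ws ++ s ∷ lead₁)
      ip₁ = ip-init (ws ++ s ∷ lead₁) {drop m lead} (subst IP (cong (t ∷_) (sym (trans (++-assoc ws (s ∷ lead₁) (drop m lead))
              (cong (λ z → ws ++ s ∷ z) (take++drop≡id m lead))))) ip)
      len₁ : length lead₁ ≡ m
      len₁ = trans (length-take m lead) (m≤n⇒m⊓n≡m (≤-trans (m∸n≤m (suc j) r) long))
      total : r + m ≡ suc j
      total = m+[n∸m]≡n (m≤n⇒m≤1+n r≤j)
      pk₁ : Pk (t ∷ ws ++ s ∷ lead₁)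
      pk₁ = pk ip₁ (cong suc (trans (length-++ ws) (trans (+-suc r (length lead₁)) (cong suc (trans (cong (r +_) len₁) total)))))
      lenys : length ys ≡ suc r
      lenys = trans (length-take (suc r) qs) (m≤n⇒m⊓n≡m (subst (suc r ≤_) (sym lq) (s≤s (m≤n⇒m≤1+n r≤j))))
      pk₂ : Pk (reverse ys ++ s ∷ lead₁)
      pk₂ = pk (through (λ c → nby (conn-sym c)) (ip-take (suc r) ipq) (ip-suffix (t ∷ ws) ip₁) (λ q → qsY (take-⊂ (suc r) qs q)) leadB₁)
               (trans (length-through ys s lead₁) (cong suc (trans (cong₂ _+_ lenys len₁) (cong suc total))))
      first₂ : ∀ zs → length zs ≡ suc r → (∀ {z} → z ∈ zs → z ∈ reverse ys) → ∃ λ y* → First (zs ++ s ∷ lead₁) y* × C S y y*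
      first₂ (z ∷ zs) _ h = z , (zs ++ s ∷ lead₁ , refl) , qsY (take-⊂ (suc r) qs (reverse⁻ (h (here refl))))
      fst₂ = first₂ (reverse ys) (trans (length-reverse ys) lenys) (λ q → q)
      last-lead : ∀ zs → length zs ≡ m → m ≢ 0 → ∃ λ x → Last zs x
      last-lead [] eq ne = ⊥-elim (ne (sym eq))
      last-lead (z ∷ zs) _ _ = last-exists z zs
      lst : ∃ λ x → Last lead₁ x
      lst = last-lead lead₁ len₁ (λ eq → <-irrefl refl (≤-trans (s≤s r≤j) (m∸n≡0⇒m≤n eq)))
      step-up : ∀ {m} → Many m t (proj₁ lst) → Many (suc m) t (proj₁ lst)
      step-up mn = many-ends pk₂ pk₁ (proj₁ (proj₂ fst₂)) (last-++ (reverse ys) (last-++ (s ∷ []) (proj₂ lst)))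
        (ws ++ s ∷ lead₁ , refl) (last-++ (t ∷ ws) (last-++ (s ∷ []) (proj₂ lst)))
        (push nS bb (leadB₁ (last-∈ (proj₂ lst))) t∈ (big-conn (proj₂ (proj₂ fst₂)) by) (λ c → nby (conn-trans c (conn-sym (proj₂ (proj₂ fst₂))))) mn)

    record Shorter : Set where
      field
        S′ : List V
        b′ s′ t′ : V
        ws′ lead′ : List V
        nS′ : 𝒩 S′
        bb′ : Big S′ b′
        s∈′ : s′ ∈ S′
        t∈′ : t′ ∈ S′
        ip′ : IP (t′ ∷ ws′ ++ s′ ∷ lead′)
        wsB′ : ∀ {w} → w ∈ ws′ → w ∉ S′ × ¬ C S′ b′ w
        leadB′ : ∀ {l} → l ∈ lead′ → C S′ b′ l
        long′ : suc j ≤ length lead′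
        less : length ws′ < length ws

    -- A long return contains a shorter one: the last k vertices up to `s` cross some `S₁` cleanly
    -- at `v`, and the path before `v` must meet `S₁` as well.
    module Shorten (long-ws : suc j ≤ length ws) where

      private
        cut : ∃ λ as → ∃ λ bs → t ∷ ws ++ s ∷ [] ≡ as ++ bs × length bs ≡ k
        cut = split-last k (t ∷ ws ++ s ∷ []) (s≤s (≤-trans (s≤s long-ws) (≤-reflexive (sym (length-snoc ws s)))))
        pre = proj₁ cut
        full = proj₁ (proj₂ (proj₂ cut))
        lenP = proj₂ (proj₂ (proj₂ cut))

        ipFull : IP (t ∷ ws ++ s ∷ [])
        ipFull = ip-prefix (t ∷ ws) ip

      open Clean (clean (pk (ip-suffix′ pre lenP (subst IP full ipFull)) lenP)) renaming (S to S₁; a to a₁; b to b₁)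

      private
        A = pre ++ us
        full′ : t ∷ ws ++ s ∷ [] ≡ A ++ v ∷ vs
        full′ = trans full (trans (cong (pre ++_) split) (sym (++-assoc pre us (v ∷ vs))))
        peeled = peel full′ (_ , ∈-++⁺ʳ pre (proj₂ us-some)) vs-some
        A′ = proj₁ peeled
        vs₀ = proj₁ (proj₂ peeled)
        A≡ : A ≡ t ∷ A′
        A≡ = proj₁ (proj₂ (proj₂ peeled))
        vs≡ : vs ≡ vs₀ ++ s ∷ []
        vs≡ = proj₁ (proj₂ (proj₂ (proj₂ peeled)))
        ws≡ : ws ≡ A′ ++ v ∷ vs₀
        ws≡ = proj₂ (proj₂ (proj₂ (proj₂ peeled)))
        u-last = nonempty-last us-some
        u = proj₁ u-last
        a₁u : C S₁ a₁ u
        a₁u = us-a (last-∈ (proj₂ u-last))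
        lastA : Last A u
        lastA = last-++ pre (proj₂ u-last)
        s∈vs : s ∈ vs
        s∈vs = subst (s ∈_) (sym vs≡) (∈-++⁺ʳ vs₀ (here refl))
        s∉ : s ∉ S₁
        s∉ = conn-right (vs-b s∈vs)
        v-off = wsB (subst (v ∈_) (sym ws≡) (∈-++⁺ʳ A′ (here refl)))
        -- `v` lies off `S` on another side than `b`, and `S` does not split `S₁`, so `S₁` misses
        -- the component of `b`.
        avoidB : ∀ {z} → C S b z → z ∉ S₁
        avoidB bz z∈ = proj₂ v-off (conn-trans bz (nested-conn (nested c𝒩 nS) z∈ v∈ (conn-right bz) (proj₁ v-off)))
        leadB₁ : ∀ {l} → l ∈ lead → C S₁ b₁ l
        leadB₁ l∈ = conn-trans (vs-b s∈vs) (ip-conn {P = Avoid G S₁} (ip-suffix (t ∷ ws) ip) allowed (there l∈))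
          where
          allowed : ∀ {y} → y ∈ s ∷ lead → y ∉ S₁
          allowed (here refl) = s∉
          allowed (there q) = avoidB (leadB q)

      -- Otherwise the path joins `t` to `u` off `S₁`, while `S₁` does not split `t` and `s`, both
      -- in `S`; then `u` and `s` would lie on the same side.
      meets : ∃ λ x → x ∈ A × x ∈ S₁
      meets = dne λ none → ab (conn-trans a₁u (conn-trans (conn-sym (tu none)) (conn-trans (ts none) (conn-sym (vs-b s∈vs)))))
        where
        t∈A : t ∈ A
        t∈A = subst (t ∈_) (sym A≡) (here refl)
        ts : ¬ (∃ λ x → x ∈ A × x ∈ S₁) → C S₁ t s
        ts none = nested-conn (nested nS c𝒩) t∈ s∈ (λ q → none (t , t∈A , q)) s∉
        tu : ¬ (∃ λ x → x ∈ A × x ∈ S₁) → C S₁ t u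
        tu none = ip-conn₂ A (subst IP full′ ipFull) (λ x∈ q → none (_ , x∈ , q)) t∈A (last-∈ lastA)

      found : (∃ λ as → ∃ λ w → ∃ λ bs → A ≡ as ++ w ∷ bs × w ∈ S₁ × (∀ {b} → b ∈ bs → b ∉ S₁)) → Shorter
      found (as , w , bs , eqA , w∈ , off) = record
        { S′ = S₁ ; b′ = b₁ ; s′ = v ; t′ = w ; ws′ = bs ; lead′ = vs₀ ++ s ∷ lead ; nS′ = c𝒩 ; bb′ = b-big
        ; s∈′ = v∈ ; t∈′ = w∈ ; ip′ = ipW
        ; wsB′ = λ q → off q , λ c → ab (conn-trans a₁u (conn-trans (inside u∈bs q) (conn-sym c)))
        ; leadB′ = lead-side
        ; long′ = ≤-trans long (≤-trans (n≤1+n _) (≤-trans (m≤n+m (suc (length lead)) (length vs₀)) (≤-reflexive (sym (length-++ vs₀)))))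
        ; less = subst (λ z → length bs < length z) (sym ws≡) (subst (length bs <_) (sym (length-++ A′))
                   (≤-<-trans shorter-A (m<m+n (length A′) (s≤s z≤n)))) }
        where
        eq : t ∷ ws ++ s ∷ lead ≡ as ++ w ∷ bs ++ v ∷ vs₀ ++ s ∷ lead
        eq = begin
          t ∷ ws ++ s ∷ lead                   ≡⟨ cong (λ z → t ∷ z ++ s ∷ lead) ws≡ ⟩
          (t ∷ A′ ++ v ∷ vs₀) ++ s ∷ lead      ≡⟨ cong (λ z → (z ++ v ∷ vs₀) ++ s ∷ lead) (trans (sym A≡) eqA) ⟩
          ((as ++ w ∷ bs) ++ v ∷ vs₀) ++ s ∷ lead ≡⟨ ++-assoc (as ++ w ∷ bs) (v ∷ vs₀) (s ∷ lead) ⟩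
          (as ++ w ∷ bs) ++ v ∷ vs₀ ++ s ∷ lead ≡⟨ ++-assoc as (w ∷ bs) (v ∷ vs₀ ++ s ∷ lead) ⟩
          as ++ w ∷ bs ++ v ∷ vs₀ ++ s ∷ lead  ∎
          where open ≡-Reasoning
        ipW : IP (w ∷ bs ++ v ∷ vs₀ ++ s ∷ lead)
        ipW = ip-suffix as (subst IP eq ip)
        u∈bs : u ∈ bs
        u∈bs = side (last-∈ (last-suffix as (subst (λ z → Last z u) eqA lastA)))
          where
          side : u ∈ w ∷ bs → u ∈ bs
          side (here eq) = ⊥-elim (conn-right a₁u (subst (_∈ S₁) (sym eq) w∈))
          side (there q) = q
        inside : ∀ {y z} → y ∈ bs → z ∈ bs → C S₁ y z
        inside = ip-conn₂ bs (ip-tail bs ipW) off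
        lead-side : ∀ {l} → l ∈ vs₀ ++ s ∷ lead → C S₁ b₁ l
        lead-side q = side (∈-++⁻ vs₀ q)
          where
          side : ∀ {l} → l ∈ vs₀ ⊎ l ∈ s ∷ lead → C S₁ b₁ l
          side (inj₁ r) = vs-b (subst (_ ∈_) (sym vs≡) (∈-++⁺ˡ r))
          side (inj₂ (here refl)) = vs-b s∈vs
          side (inj₂ (there r)) = leadB₁ r
        shorter-A : length bs ≤ length A′
        shorter-A = ≤-pred (subst (suc (length bs) ≤_) (trans (sym (length-++ as)) (cong length (trans (sym eqA) A≡))) (m≤n+m _ (length as)))

      shorter : Shorter
      shorter = found (last-nbr (_∈ S₁) A meets)

  private
    -- Induction on a bound `f` for the length of the excursion.
    no-return′ : ∀ f {S b s t ws lead} → length ws ≤ f → 𝒩 S → Big S b → s ∈ S → t ∈ S → IP (t ∷ ws ++ s ∷ lead) →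
      (∀ {w} → w ∈ ws → w ∉ S × ¬ C S b w) → (∀ {l} → l ∈ lead → C S b l) → suc j ≤ length lead → ⊥
    no-return′ f {ws = ws} le nS bb s∈ t∈ ip wsB leadB long with length ws ≤? j
    ... | yes q = no-short-return nS bb s∈ t∈ ip wsB leadB long q
    no-return′ zero le nS bb s∈ t∈ ip wsB leadB long | no q = q (≤-trans le z≤n)
    no-return′ (suc f) le nS bb s∈ t∈ ip wsB leadB long | no q =
      no-return′ f (≤-pred (≤-trans less le)) nS′ bb′ s∈′ t∈′ ip′ wsB′ leadB′ long′
      where open Shorter (Shorten.shorter nS bb s∈ t∈ ip wsB leadB long (≰⇒> q))

  abstract
    no-return : ∀ {S b s t ws lead} → 𝒩 S → Big S b → s ∈ S → t ∈ S → IP (t ∷ ws ++ s ∷ lead) →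
      (∀ {w} → w ∈ ws → w ∉ S × ¬ C S b w) → (∀ {l} → l ∈ lead → C S b l) → suc j ≤ length lead → ⊥
    no-return = no-return′ _ ≤-refl

  return-path : ∀ {S c s t} → 𝒩 S → Big S c → s ∈ S → t ∈ S → t ≢ s →
    ∃ λ ws → IP (t ∷ ws ++ s ∷ []) × (∀ {w} → w ∈ ws → C S c w)
  return-path {S} {c} {s} {t} nS bc s∈ t∈ t≢s with tight (𝒩-sep nS) bc s∈ | tight (𝒩-sep nS) bc t∈
  ... | y , cy , ys | z , cz , zt with induced-path {P = λ v → v ≡ t ⊎ v ≡ s ⊎ C S c v}
      (step (inj₁ refl) (E-sym zt) (conn-snoc (conn-within (λ d → inj₂ (inj₂ (conn-trans cz d))) (conn-trans (conn-sym cz) cy)) ys (inj₂ (inj₁ refl))))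
  ... | qs , ([] , eq) , ip , all = ⊥-elim (t≢s (proj₁ (∷-injective eq)))
  ... | .(zs ++ s ∷ []) , (t′ ∷ zs , refl) , ip , all = zs , ip , inner
    where
    inner : ∀ {w} → w ∈ zs → C S c w
    inner {w} w∈ with all (there (∈-++⁺ˡ w∈))
    ... | inj₁ refl = ⊥-elim (ip-head∉ ip (∈-++⁺ˡ w∈))
    ... | inj₂ (inj₂ c) = c
    ... | inj₂ (inj₁ refl) = ⊥-elim (no-dup zs w∈ (ip-tail zs ip))
      where
      no-dup : ∀ zs → w ∈ zs → ¬ IP (zs ++ w ∷ [])
      no-dup (x ∷ zs) (here refl) p = ip-head∉ p (∈-++⁺ʳ zs (here refl))
      no-dup (x ∷ zs) (there q) p = no-dup zs q (ip-tail zs p)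

  -- Otherwise S and S′ would share s but not t, and going from deep beyond S′ through s
  -- and back to t on the far side of S is a forbidden return.
  disjoint : ∀ {S S′ s t} → 𝒩 S → 𝒩 S′ → s ∈ S → s ∈ S′ → t ∈ S → t ∈ S′
  disjoint {S} {S′} {s} {t} nS nS′ s∈ s∈′ t∈ = dne go
    where
    go : ¬ t ∉ S′
    go t∉ with other-big (𝒩-sep nS′) t
    ... | b , bb , ntb with other-big (𝒩-sep nS) b | deep nS′ bb s∈′
    ... | c , bc , nbc | lead , ipl , lenl , leadB with return-path nS bc s∈ t∈ (λ { refl → t∉ s∈′ })
    ... | ws , ipw , wsC = no-return nS (big-within offS bb) s∈ t∈ (ip-join (t ∷ ws) ipw ipl across)
            (λ w∈ → conn-right (wsC w∈) , λ d → nbc (conn-trans d (conn-sym (wsC w∈)))) (λ l∈ → conn-within offS (leadB l∈))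
            (≤-trans (n≤1+n _) (≤-reflexive (sym lenl)))
      where
      offS : ∀ {z} → C S′ b z → z ∉ S
      offS bz z∈ = ntb (conn-trans (nested-conn (nested nS nS′) t∈ z∈ t∉ (conn-right bz)) (conn-sym bz))
      offC : ∀ {z} → C S c z → z ∉ S′
      offC cz z∈ with tight (𝒩-sep nS′) bb z∈
      ... | w , bw , wz = nbc (conn-trans (conn-snoc (conn-within offS bw) wz (conn-right cz)) (conn-sym cz))
      allowed : ∀ {a} → a ∈ t ∷ ws → a ∉ S′
      allowed (here refl) = t∉
      allowed (there q) = offC (wsC q)
      across : ∀ {a l} → a ∈ t ∷ ws → l ∈ lead → ¬ E a l × a ≢ l
      across a∈ l∈ = apart-nbr ntb (ip-conn₂ (t ∷ ws) ipw allowed (here refl) a∈) (leadB l∈)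

-- Vertices outside the separators and alternation along paths

module Modules (em : ExcludedMiddle (Level.suc 0ℓ)) (G : Graph) (more : MoreThanOneEnd G)
  (connected : Connected G) (j : ℕ) (cs : CSTransitive G (suc (suc (suc j)))) where
  open import Data.List.Properties using (reverse-++; reverse-involutive; unfold-reverse; reverse-map; ++-assoc; ∷-injective; ∷-injectiveˡ; ∷-injectiveʳ)
  open import Data.Fin using (zero; suc)
  open Returns em G more connected j cs public

  -- The vertex before s lies on the other side of S than the end x, since moving it
  -- to a third component would let one more separator separate the two ends.
  no-touch : ∀ {S s x y rest} → 𝒩 S → s ∈ S → Pk (y ∷ s ∷ rest) → Last rest x → Big S x → C S y x →
    (∀ {r} → r ∈ rest → C S x r) → ⊥
  no-touch {S} {s} {x} {y} {rest} nS s∈ P last bx yx restX with other-big (𝒩-sep nS) x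
  ... | c₀ , bc₀ , nxc₀ with tight (𝒩-sep nS) bc₀ s∈
  ... | c , c₀c , cs′ = climb λ mn → many-ends pk-c P (s ∷ rest , refl) (last-++ (c ∷ s ∷ []) last) (s ∷ rest , refl) (last-++ (y ∷ s ∷ []) last)
        (raise (ss nS (big-conn c₀c bc₀) bx (λ d → nxc (conn-sym d))) one-sep mn)
    where
    nxc : ¬ C S x c
    nxc d = nxc₀ (conn-trans d (conn-sym c₀c))
    pk-c : Pk (c ∷ s ∷ rest)
    pk-c = pk (through {us = c ∷ []} (nxc ∘ conn-sym) (cons (E-sym cs′) (λ ()) (λ { (here refl) → E-irr cs′ }) one)
                (ip-suffix (y ∷ []) (Pk.pk-ip P)) (λ { (here refl) → here (conn-right c₀c) }) restX) (Pk.pk-length P)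
    one-sep : ∀ {T} → SS T y x → SS T c x × ¬ S ≋ T
    one-sep {T} (ss nT by bTx nyx) = ss nT (big-conn yc by) bTx (λ d → nyx (conn-trans yc d)) , λ (f , _) → apartTS (f s∈) s∈
      where
      apartTS : ∀ {z} → z ∈ T → z ∉ S
      apartTS z∈ z∈S = nyx (conn-mono (λ v∉ v∈ → v∉ (disjoint nT nS z∈ z∈S v∈)) yx)
      offC : ∀ {z} → C S c z → z ∉ T
      offC cz z∈ = nyx (conn-within (λ yz′ z′∈ → nxc (conn-trans (conn-sym yx) (conn-trans yz′
                     (conn-trans (nested-conn (nested nT nS) z′∈ z∈ (conn-right yz′) (conn-right cz)) (conn-sym cz))))) yx)
      ys : E y s
      ys = step-ip (Pk.pk-ip P) zero (suc zero) (inj₁ refl)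
      yc : C T y c
      yc = step (big∉ by) ys (step (λ q → apartTS q s∈) (E-sym cs′) (here (offC (here (conn-right c₀c)))))

  -- A deep path from p on the side of T away from S, where T is the separator through p.
  record Beyond (S : List V) (s p : V) : Set where
    field
      T : List V
      nT : 𝒩 T
      p∈ : p ∈ T
      qs : List V
      path : IP (p ∷ qs)
      qs-long : length qs ≡ suc (suc j)
      near : ∀ {z} → z ∈ S → C T s z
      far : V
      apart : ¬ C T s far
      qs-far : ∀ {q} → q ∈ qs → C T far q
      qs-in : ∀ {q} → q ∈ qs → C S p q
      p-big : Big S p

  beyond : ∀ {S s p} → 𝒩 S → s ∈ S → U p → p ∉ S → Beyond S s p
  beyond {S} {s} {p} nS s∈ (T , nT , p∈) p∉ with other-big (𝒩-sep nT) s
  ... | b , bb , nsb with deep nT bb p∈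
  ... | q ∷ qs , path , long , far = record
    { T = T ; nT = nT ; p∈ = p∈ ; qs = q ∷ qs ; path = path ; qs-long = long ; near = near ; far = b ; apart = nsb
    ; qs-far = far ; qs-in = λ r → qs-in (there r) ; p-big = big-conn (conn-trans (conn-within off (far (here refl))) (conn-sym (qs-in (there (here refl))))) (big-within off bb) }
    where
    off-T : ∀ {z} → z ∈ S → z ∉ T
    off-T z∈ z∈T = p∉ (disjoint nT nS z∈T z∈ p∈)
    near : ∀ {z} → z ∈ S → C T s z
    near z∈ = nested-conn (nested nS nT) s∈ z∈ (off-T s∈) (off-T z∈)
    off : ∀ {z} → C T b z → z ∉ S
    off c z∈ = nsb (conn-trans (near z∈) (conn-sym c))
    allowed : ∀ {y} → y ∈ p ∷ q ∷ qs → y ∉ S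
    allowed (here refl) = p∉
    allowed (there r) = off (far r)
    qs-in : ∀ {y} → y ∈ p ∷ q ∷ qs → C S p y
    qs-in = ip-conn path allowed

  private
    module _ {A : Set} where
      split-end : ∀ m (xs : List A) → length xs ≡ suc m → ∃ λ as → ∃ λ l → xs ≡ as ++ l ∷ [] × length as ≡ m
      split-end zero (x ∷ []) refl = [] , x , refl , refl
      split-end (suc m) (x ∷ xs) eq with split-end m xs (suc-injective eq)
      ... | as , l , refl , len = x ∷ as , l , refl , cong suc len

  -- A path of k vertices starting d, s which runs away from d behind s.
  record Away (S : List V) (s d : V) : Set where
    field
      c : V
      c-big : Big S c
      apart : ¬ C S c d
      as : List V
      l : V
      path : IP (d ∷ s ∷ as ++ l ∷ [])
      as-long : length as ≡ j
      in-c : ∀ {q} → q ∈ as ++ l ∷ [] → C S c q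

    away-Pk : Pk (d ∷ s ∷ as ++ l ∷ [])
    away-Pk = pk path (cong (2 +_) (trans (length-snoc as l) (cong suc as-long)))

  away : ∀ {S s d} → 𝒩 S → s ∈ S → d ∉ S → E d s → Away S s d
  away {S} {s} {d} nS s∈ d∉ e with other-big (𝒩-sep nS) d
  ... | c , bc , ndc with deep nS bc s∈
  ... | qs , path , long , inC with split-end (suc j) qs long
  ... | bs , l , refl , lenb with split-end j bs lenb
  ... | as , l′ , refl , lena = record
    { c = c ; c-big = bc ; apart = ndc ∘ conn-sym ; as = as ; l = l′
    ; path = through {us = d ∷ []} ndc (cons (E-sym e) (λ ()) (λ { (here refl) → E-irr e }) one)
               (ip-init (as ++ l′ ∷ []) path) (λ { (here refl) → here d∉ }) (λ q → inC (∈-++⁺ˡ q))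
    ; as-long = lena ; in-c = λ q → inC (∈-++⁺ˡ q) }

  -- Both directions are recorded to make the property invariant under reversal.
  Extends : List V → Set
  Extends xs = (∃ λ u → IP (u ∷ xs)) × (∃ λ u → IP (u ∷ reverse xs))

  -- Two arms joined at a separator give an induced path on k + 2 vertices; its middle k vertices
  -- extend both ways.
  extends : ∀ {xs} → Pk xs → ∃ λ u → IP (u ∷ xs)
  extends P = proj₁ (transport Extends im rev (proj₁ (proj₂ base)) P (proj₂ (proj₂ base)))
    where
    im : ∀ φ {xs} → Extends xs → Extends (img φ xs)
    im φ {xs} ((u , p) , (w , q)) = (φ · u , ip-map φ p) , (φ · w , subst (λ z → IP (φ · w ∷ z)) (reverse-map (φ ·_) xs) (ip-map φ q))
    rev : ∀ {xs} → Extends xs → Extends (reverse xs)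
    rev {xs} ((u , p) , w) = w , (u , subst (λ z → IP (u ∷ z)) (sym (reverse-involutive xs)) p)
    base : ∃ λ xs → Pk xs × Extends xs
    base with some-𝒩
    ... | S , nS with sep-nonempty (𝒩-sep nS) | sep-cut (𝒩-sep nS)
    ... | s , s∈ | ρ , σ , a , b , la , lb , nc with deep nS (ρ , la) s∈ | deep nS (σ , lb) s∈
    ... | u ∷ u′ ∷ us , p , _ , ua | vs , q , lq , vb with split-end (suc j) vs lq
    ... | zs , l , refl , lenz = u ∷ s ∷ zs ,
        pk (ip-init (s ∷ zs) whole′) (cong (2 +_) lenz) , (u′ , ip-init (u ∷ s ∷ zs) whole) ,
        (l , subst IP (reverse-++ (u ∷ s ∷ zs) (l ∷ [])) (ip-reverse whole′))
      where
      whole : IP (u′ ∷ u ∷ s ∷ zs ++ l ∷ [])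
      whole = through {us = u ∷ u′ ∷ []} nc (ip-init (u ∷ u′ ∷ []) p) q (λ r → ua (∈-++⁺ˡ {ys = us} r)) vb
      whole′ : IP (u ∷ s ∷ zs ++ l ∷ [])
      whole′ = ip-tail [] whole

  SomeEnd : (V → Set) → List V → Set
  SomeEnd Q xs = ∃ λ a → (First xs a ⊎ Last xs a) × Q a

  some-end : ∀ (Q : V → Set) → (∀ φ {v} → Q v → Q (φ · v)) → ∀ {xs ys} → Pk xs → Pk ys → SomeEnd Q xs → SomeEnd Q ys
  some-end Q inv-Q = transport (SomeEnd Q) im rev
    where
    im : ∀ φ {xs} → SomeEnd Q xs → SomeEnd Q (img φ xs)
    im φ (a , inj₁ (zs , refl) , q) = φ · a , inj₁ (img φ zs , refl) , inv-Q φ q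
    im φ {xs} (a , inj₂ (zs , refl) , q) = φ · a , inj₂ (img φ zs , map-++ (φ ·_) zs (a ∷ [])) , inv-Q φ q
      where open import Data.List.Properties using (map-++)
    rev : ∀ {xs} → SomeEnd Q xs → SomeEnd Q (reverse xs)
    rev {xs} (a , inj₁ (zs , refl) , q) = a , inj₂ (reverse zs , unfold-reverse a zs) , q
    rev {xs} (a , inj₂ (zs , refl) , q) = a , inj₁ (reverse zs , reverse-++ zs (a ∷ [])) , q

  -- From here on some vertex outside U is adjacent to U; then U and its complement alternate on paths.
  module Mixed {S₀ d₀ s₀} (nS₀ : 𝒩 S₀) (s₀∈ : s₀ ∈ S₀) (d₀∉U : ¬ U d₀) (e₀ : E d₀ s₀) where

    private
      A₀ : Away S₀ s₀ d₀
      A₀ = away nS₀ s₀∈ (λ q → d₀∉U (_ , nS₀ , q)) e₀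

    -- The path `A₀` starts at `d₀` outside `U`, and the one in `end-on` at `s₀` in `U`. So every
    -- induced path on k vertices has exactly one end in `U`.
    end-off : ∀ {xs} → Pk xs → SomeEnd (λ v → ¬ U v) xs
    end-off P = some-end (λ v → ¬ U v) (λ φ nu u → nu (img-U⁻ φ u)) (Away.away-Pk A₀) P (_ , inj₁ (_ , refl) , d₀∉U)

    end-on : ∀ {xs} → Pk xs → SomeEnd U xs
    end-on P with other-big (𝒩-sep nS₀) d₀
    ... | c , bc , _ with deep nS₀ bc s₀∈
    ... | qs , path , long , _ = some-end U img-U (pk path (cong suc long)) P (s₀ , inj₁ (qs , refl) , S₀ , nS₀ , s₀∈)

    last-off : ∀ {a l xs} → Pk (a ∷ xs) → U a → Last (a ∷ xs) l → ¬ U l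
    last-off P ua last ul with end-off P
    ... | _ , inj₁ (_ , refl) , nu = nu ua
    ... | _ , inj₂ last′ , nu = nu (subst U (last-unique last last′) ul)

    last-on : ∀ {a l xs} → Pk (a ∷ xs) → ¬ U a → Last (a ∷ xs) l → U l
    last-on P nua last with end-on P
    ... | _ , inj₁ (_ , refl) , u = ⊥-elim (nua u)
    ... | _ , inj₂ last′ , u = subst U (last-unique last′ last) u

    private
      -- The automorphism shifts the path by one place, so membership in `U` passes along it from
      -- vertex to vertex.
      spread : ∀ φ {x l} cs zs → U x → cs ≡ zs ++ l ∷ [] → img φ cs ≡ x ∷ zs → U l
      spread φ (c ∷ []) [] u refl eq = img-U⁻ φ (subst U (sym (∷-injectiveˡ eq)) u)
      spread φ (c ∷ _ ∷ _) [] u () eq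
      spread φ (c ∷ cs) (z ∷ zs) u eq eq′ with ∷-injective eq
      ... | refl , eq″ = spread φ cs zs (img-U⁻ φ (subst U (sym (∷-injectiveˡ eq′)) u)) eq″ (∷-injectiveʳ eq′)

    -- Suppose `e` is in `U`. An automorphism from the path `s, ..., l` to the path `e, s, ...`
    -- spreads `U` up to `l`, or sends `l` to `e`; but `l` is the end off `U`.
    arm-off : ∀ {S a b s e es} → 𝒩 S → s ∈ S → Big S b → ¬ C S a b → IP (s ∷ e ∷ es) → (∀ {u} → u ∈ e ∷ es → C S a u) → ¬ U e
    arm-off {S} {a} {b} {s} {e} {es} nS s∈ bb nc p ea ue with deep nS bb s∈
    ... | vs , q , lq , vb with split-end (suc j) vs lq
    ... | zs , l , refl , lenz = side (equiv q (Pk.pk-ip P₂) (cong suc lq) (Pk.pk-length P₂))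
      where
      us : U s
      us = S , nS , s∈
      P₁ : Pk (s ∷ zs ++ l ∷ [])
      P₁ = pk q (cong suc lq)
      P₂ : Pk (e ∷ s ∷ zs)
      P₂ = pk (through {us = e ∷ []} nc (ip-init (e ∷ []) p) (ip-init zs q) (λ { (here refl) → ea (here refl) }) (λ r → vb (∈-++⁺ˡ r)))
              (cong (2 +_) lenz)
      nl : ¬ U l
      nl = last-off P₁ us (s ∷ zs , refl)
      side : (Σ (Aut G) λ φ → img φ (s ∷ zs ++ l ∷ []) ≡ e ∷ s ∷ zs ⊎ img φ (s ∷ zs ++ l ∷ []) ≡ reverse (e ∷ s ∷ zs)) → ⊥
      side (φ , inj₁ eq) = nl (spread φ (zs ++ l ∷ []) zs us refl (∷-injectiveʳ eq))
      side (φ , inj₂ eq) = nl (img-U⁻ φ (subst U (last-unique (reverse (s ∷ zs) , trans eq (unfold-reverse e (s ∷ zs))) lastφ) ue))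
        where
        open import Data.List.Properties using (map-++)
        lastφ : Last (img φ (s ∷ zs ++ l ∷ [])) (φ · l)
        lastφ = img φ (s ∷ zs) , map-++ (φ ·_) (s ∷ zs) (l ∷ [])

    Alternates : List V → Set
    Alternates xs = (∀ {a b zs} → xs ≡ a ∷ b ∷ zs → U a → ¬ U b) × (∀ {a b zs} → xs ≡ zs ++ b ∷ a ∷ [] → U a → ¬ U b)

    alternates : ∀ {xs} → Pk xs → Alternates xs
    alternates P with other-big (𝒩-sep nS₀) d₀
    ... | a , ba , _ with other-big (𝒩-sep nS₀) a
    ... | b , bb , nab with deep nS₀ ba s₀∈
    ... | q ∷ qs , path , long , qa = transport Alternates im rev (pk path (cong suc long)) P start
      where
      P₀ : Pk (s₀ ∷ q ∷ qs)
      P₀ = pk path (cong suc long)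
      us : U s₀
      us = S₀ , nS₀ , s₀∈
      start : Alternates (s₀ ∷ q ∷ qs)
      start = (λ { refl _ → arm-off nS₀ s₀∈ bb nab path qa }) ,
              λ {a} {b} {zs} eq u → ⊥-elim (last-off P₀ us (zs ++ b ∷ [] , trans eq (sym (++-assoc zs (b ∷ []) (a ∷ [])))) u)
      im₁ : ∀ φ {xs a b zs} → (∀ {a b zs} → xs ≡ a ∷ b ∷ zs → U a → ¬ U b) → img φ xs ≡ a ∷ b ∷ zs → U a → ¬ U b
      im₁ φ {x ∷ y ∷ xs} h refl ua ub = h refl (img-U⁻ φ ua) (img-U⁻ φ ub)
      to-front : ∀ {a b : V} {xs zs} → xs ≡ zs ++ b ∷ a ∷ [] → reverse xs ≡ a ∷ b ∷ reverse zs
      to-front {a} {b} {zs = zs} refl = reverse-++ zs (b ∷ a ∷ [])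
      to-back : ∀ {a b : V} {xs zs} → reverse xs ≡ a ∷ b ∷ zs → xs ≡ reverse zs ++ b ∷ a ∷ []
      to-back {a} {b} {xs} {zs} eq = trans (sym (reverse-involutive xs)) (trans (cong reverse eq)
        (trans (unfold-reverse a (b ∷ zs)) (trans (cong (_++ a ∷ []) (unfold-reverse b zs)) (++-assoc (reverse zs) (b ∷ []) (a ∷ [])))))
      im : ∀ φ {xs} → Alternates xs → Alternates (img φ xs)
      im φ {xs} (h , h′) = im₁ φ h ,
        λ eq → im₁ φ {reverse xs} (λ eq′ → h′ (to-back eq′)) (trans (reverse-map (φ ·_) xs) (to-front eq))
      rev : ∀ {xs} → Alternates xs → Alternates (reverse xs)
      rev {xs} (h , h′) = (λ eq → h′ (to-back eq)) , λ eq → h (trans (sym (reverse-involutive xs)) (to-front eq))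

    no-U-edge : ∀ {S t u} → 𝒩 S → t ∈ S → u ∉ S → U u → ¬ E u t
    no-U-edge nS t∈ u∉ uu e = proj₁ (alternates (Away.away-Pk (away nS t∈ u∉ e))) refl uu (_ , nS , t∈)

    -- The path from `d` to `l` ends in `U`, so by alternation the vertex before `l` is off `U`. It
    -- is the last vertex of the path starting at `y`, whose first one must then be in `U`.
    before-off-U : ∀ {S s d} → 𝒩 S → s ∈ S → ¬ U d → (a : Away S s d) → ∀ {y} → IP (y ∷ d ∷ s ∷ Away.as a) → U y
    before-off-U {S} {s} {d} nS s∈ nud a {y} p = dne λ nuy → proj₂ (alternates away-Pk) {zs = d ∷ proj₁ (proj₂ le)} (eq (proj₂ (proj₂ le)))
        (last-on away-Pk nud (d ∷ s ∷ as , refl)) (last-on (pk p (cong (3 +_) as-long)) nuy (last-++ (y ∷ d ∷ []) (proj₂ le)))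
      where
      open Away a
      le : ∃ λ b → Last (s ∷ as) b
      le = last-exists s as
      eq : ∀ {b zs} → s ∷ as ≡ zs ++ b ∷ [] → d ∷ s ∷ as ++ l ∷ [] ≡ d ∷ zs ++ b ∷ l ∷ []
      eq {b} {zs} q = cong (d ∷_) (trans (cong (_++ l ∷ []) q) (++-assoc zs (b ∷ []) (l ∷ [])))

    -- A path from `d` running away behind `s` extends by a vertex before `d`. This vertex is in `U`
    -- by `before-off-U`, and in `S` it would make the path a return through `d`.
    across : ∀ {S s d} → 𝒩 S → s ∈ S → ¬ U d → E d s → ∃ λ u → U u × u ∉ S × E u d
    across {S} {s} {d} nS s∈ nud e = from-ext (extends away-Pk)
      where
      a : Away S s d
      a = away nS s∈ (λ q → nud (_ , nS , q)) e
      open Away a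
      from-ext : (∃ λ u → IP (u ∷ d ∷ s ∷ as ++ l ∷ [])) → ∃ λ u → U u × u ∉ S × E u d
      from-ext (u , p) = u , before-off-U nS s∈ nud a (ip-init (d ∷ s ∷ as) p) ,
        (λ u∈ → no-return {ws = d ∷ []} nS c-big s∈ u∈ p (λ { (here refl) → (λ q → nud (_ , nS , q)) , apart }) in-c
                  (≤-reflexive (sym (trans (length-snoc as l) (cong suc as-long))))) ,
        step-ip p zero (suc zero) (inj₁ refl)

    -- If `w′` missed `s`, an induced path on k vertices would begin `w′, w, s`, and `before-off-U`
    -- would put `w′` into `U`.
    off-U-twins : ∀ {S s w w′} → 𝒩 S → s ∈ S → ¬ U w → ¬ U w′ → E w s → E w w′ → E w′ s
    off-U-twins {S} {s} {w} {w′} nS s∈ nw nw′ e e′ = dne λ ne → nw′ (before-off-U nS s∈ nw a (path′ ne))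
      where
      w′∉ : w′ ∉ S
      w′∉ q = nw′ (_ , nS , q)
      a : Away S s w
      a = away nS s∈ (λ q → nw (_ , nS , q)) e
      open Away a
      sep : ∀ {q} → q ∈ as → ¬ E w′ q × w′ ≢ q
      sep q∈ = apart-nbr (apart ∘ conn-sym) (step (λ q → nw (_ , nS , q)) e′ (here w′∉)) (in-c (∈-++⁺ˡ q∈))
      path′ : ¬ E w′ s → IP (w′ ∷ w ∷ s ∷ as)
      path′ ne = cons (E-sym e′) (λ { (here refl) → ne ; (there q) → proj₁ (sep q) })
        (λ { (here refl) → E-irr e′ ; (there (here refl)) → w′∉ s∈ ; (there (there q)) → proj₂ (sep q) refl })
        (ip-init (s ∷ as) path)

-- The partition into modules

module Classes (em : ExcludedMiddle (Level.suc 0ℓ)) (G : Graph) (more : MoreThanOneEnd G)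
  (connected : Connected G) (j : ℕ) (cs : CSTransitive G (suc (suc (suc j)))) where
  open import Data.List using (take)
  open import Data.List.Properties using (length-take)
  open import Data.Fin using (Fin; zero; suc)
  open Modules em G more connected j cs public

  -- From `t` to `s` through a component other than that of `d`, then along the lead: a forbidden
  -- return.
  no-detour : ∀ {S s t d lead} → 𝒩 S → s ∈ S → t ∈ S → t ≢ s → IP (s ∷ lead) → Big S d → (∀ {l} → l ∈ lead → C S d l) →
    (∀ {l} → l ∈ lead → ¬ E t l × t ≢ l) → suc j ≤ length lead → ⊥
  no-detour {S} {s} {t} {d} nS s∈ t∈ t≢s p bd lead-d off long with other-big (𝒩-sep nS) d
  ... | c , bc , ndc with return-path nS bc s∈ t∈ t≢s
  ... | ws , ipw , wsC = no-return nS bd s∈ t∈ (ip-join (t ∷ ws) ipw p λ { (here refl) l∈ → off l∈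
                           ; (there w∈) l∈ → apart-nbr (ndc ∘ conn-sym) (wsC w∈) (lead-d l∈) })
        (λ w∈ → conn-right (wsC w∈) , λ dw → ndc (conn-trans dw (conn-sym (wsC w∈)))) lead-d long

  -- If `d` missed `t`, a path from `s` through `d` to beyond a further separator would have no
  -- neighbour of `t` after `s`. For `d` off `U` this separator is the one of a vertex `u` supplied
  -- by `across`.
  is-module : ∀ {S s t d} → 𝒩 S → s ∈ S → t ∈ S → d ∉ S → E d s → E d t
  is-module {S} {s} {t} {d} nS s∈ t∈ d∉ e = dne λ ne → go ne (dec (U d))
    where
    t≢s : ¬ E d t → t ≢ s
    t≢s ne refl = ne e
    go : ¬ E d t → Dec (U d) → ⊥
    go ne (yes ud) = no-detour nS s∈ t∈ (t≢s ne)
        (cons (E-sym e) (λ q → proj₁ (apart-nbr apart (near s∈) (qs-far q)))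
              (λ { (here refl) → d∉ s∈ ; (there q) → proj₂ (apart-nbr apart (near s∈) (qs-far q)) refl }) path)
        p-big (λ { (here refl) → here d∉ ; (there q) → qs-in q })
        (λ { (here refl) → (λ e′ → ne (E-sym e′)) , λ { refl → d∉ t∈ } ; (there q) → apart-nbr apart (near t∈) (qs-far q) })
        (≤-trans (n≤1+n _) (≤-trans (≤-reflexive (sym qs-long)) (n≤1+n _)))
      where open Beyond (beyond nS s∈ ud d∉)
    go ne (no nud) = far-side (Mixed.across nS s∈ nud e nS s∈ nud e)
      where
      open Mixed nS s∈ nud e
      far-side : (∃ λ u → U u × u ∉ S × E u d) → ⊥
      far-side (u , uu , u∉ , eud) = no-detour nS s∈ t∈ (t≢s ne)
          (cons (E-sym e) (λ { (here refl) → su ; (there q) → proj₁ (apart-nbr apart (near s∈) (qs-far q)) })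
            (λ { (here refl) → d∉ s∈ ; (there (here refl)) → u∉ s∈ ; (there (there q)) → proj₂ (apart-nbr apart (near s∈) (qs-far q)) refl })
            (cons (E-sym eud) (λ q → proj₁ (apart-nbr apart sd (qs-far q)))
              (λ { (here refl) → E-irr eud ; (there q) → proj₂ (apart-nbr apart sd (qs-far q)) refl }) path))
          (big-conn (conn-edge u∉ d∉ eud) p-big)
          (λ { (here refl) → here d∉ ; (there (here refl)) → conn-edge d∉ u∉ (E-sym eud)
             ; (there (there q)) → step d∉ (E-sym eud) (qs-in q) })
          (λ { (here refl) → (λ e′ → ne (E-sym e′)) , (λ { refl → d∉ t∈ })
             ; (there (here refl)) → (λ e′ → no-U-edge nS t∈ u∉ uu (E-sym e′)) , (λ { refl → u∉ t∈ })
             ; (there (there q)) → apart-nbr apart (near t∈) (qs-far q) })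
          (≤-trans (n≤1+n _) (≤-trans (≤-reflexive (sym qs-long)) (≤-trans (n≤1+n _) (n≤1+n _))))
        where
        open Beyond (beyond nS s∈ uu u∉)
        su : ¬ E s u
        su e′ = no-U-edge nS s∈ u∉ uu (E-sym e′)
        sd : C T s d
        sd = conn-edge (conn-left (near s∈)) (λ q → nud (_ , nT , q)) (E-sym e)

  SameNbrs : V → V → Set
  SameNbrs x y = ∀ {u} → U u → (E x u → E y u) × (E y u → E x u)

  infix 4 _≈_
  _≈_ : V → V → Set
  x ≈ y = (∃ λ S → 𝒩 S × x ∈ S × y ∈ S) ⊎ (¬ U x × ¬ U y × SameNbrs x y)

  ≈-refl : ∀ {x} → x ≈ x
  ≈-refl {x} with dec (U x)
  ... | yes (S , nS , x∈) = inj₁ (S , nS , x∈ , x∈)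
  ... | no nu = inj₂ (nu , nu , λ _ → (λ e → e) , (λ e → e))

  ≈-sym : ∀ {x y} → x ≈ y → y ≈ x
  ≈-sym (inj₁ (S , nS , x∈ , y∈)) = inj₁ (S , nS , y∈ , x∈)
  ≈-sym (inj₂ (nx , ny , h)) = inj₂ (ny , nx , λ u → proj₂ (h u) , proj₁ (h u))

  ≈-trans : ∀ {x y z} → x ≈ y → y ≈ z → x ≈ z
  ≈-trans (inj₁ (S , nS , x∈ , y∈)) (inj₁ (T , nT , y∈′ , z∈)) = inj₁ (S , nS , x∈ , disjoint nT nS y∈′ y∈ z∈)
  ≈-trans (inj₁ (S , nS , x∈ , y∈)) (inj₂ (ny , _ , _)) = ⊥-elim (ny (S , nS , y∈))
  ≈-trans (inj₂ (_ , ny , _)) (inj₁ (S , nS , y∈ , _)) = ⊥-elim (ny (S , nS , y∈))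
  ≈-trans (inj₂ (nx , _ , h)) (inj₂ (_ , nz , h′)) =
    inj₂ (nx , nz , λ u → proj₁ (h′ u) ∘ proj₁ (h u) , proj₂ (h u) ∘ proj₂ (h′ u))

  ≈-img : ∀ φ {x y} → x ≈ y → φ · x ≈ φ · y
  ≈-img φ (inj₁ (S , nS , x∈ , y∈)) = inj₁ (img φ S , img-𝒩 φ nS , ∈-map⁺ (φ ·_) x∈ , ∈-map⁺ (φ ·_) y∈)
  ≈-img φ {x} {y} (inj₂ (nx , ny , h)) = inj₂ (nx ∘ img-U⁻ φ , ny ∘ img-U⁻ φ , h′)
    where
    pull : ∀ {x u} → E (φ · x) u → E x (bwd φ u)
    pull {x} {u} e = E-· φ _ _ (subst (E (φ · x)) (sym (·-bwd φ u)) e)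
    push′ : ∀ {x u} → E x (bwd φ u) → E (φ · x) u
    push′ {x} {u} e = subst (E (φ · x)) (·-bwd φ u) (·-E φ _ _ e)
    h′ : SameNbrs (φ · x) (φ · y)
    h′ {u} uu = (λ e → push′ (proj₁ (h (img-U (inv φ) uu)) (pull e))) , (λ e → push′ (proj₂ (h (img-U (inv φ) uu)) (pull e)))

  ≈-in : ∀ {S x y} → 𝒩 S → x ∈ S → x ≈ y → y ∈ S
  ≈-in nS x∈ (inj₁ (T , nT , x∈′ , y∈)) = disjoint nT nS x∈′ x∈ y∈
  ≈-in nS x∈ (inj₂ (nx , _)) = ⊥-elim (nx (_ , nS , x∈))

  off-class : ∀ {S v x} → 𝒩 S → v ∈ S → ¬ (v ≈ x) → x ∉ S
  off-class nS v∈ ne x∈ = ne (inj₁ (_ , nS , v∈ , x∈))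

  twins : ∀ {w w′} → ¬ U w → ¬ U w′ → E w w′ → w ≈ w′
  twins nw nw′ e = inj₂ (nw , nw′ , λ (S , nS , u∈) →
    (λ e′ → Mixed.off-U-twins nS u∈ nw e′ nS u∈ nw nw′ e′ e) , (λ e′ → Mixed.off-U-twins nS u∈ nw′ e′ nS u∈ nw′ nw e′ (E-sym e)))

  -- If `w′` missed `u`, an induced path `w′, s, w, u, ...` would meet `S` only in `s` and be on one
  -- side before and after it, which `no-touch` excludes.
  twins-at : ∀ {S s w w′ u} → 𝒩 S → s ∈ S → ¬ U w → ¬ U w′ → E w s → E w′ s → C S w w′ → U u → E w u → E w′ u
  twins-at {S} {s} {w} {w′} {u} nS s∈ nw nw′ e e′ ww′ uu eu with dec (u ∈ S)
  ... | yes u∈ = is-module nS s∈ u∈ (conn-right ww′) e′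
  ... | no u∉ = dne λ ne → no-touch nS s∈ (P ne) last (big-conn last-in w-big) (conn-trans (conn-sym ww′) last-in) (λ q → conn-trans (conn-sym last-in) (inside (take-⊂ (suc j) (w ∷ u ∷ qs) q)))
    where
    open Mixed nS s∈ nw e
    open Beyond (beyond nS s∈ uu u∉)
    w∉ = conn-left ww′
    to-s : ∀ {x} → ¬ U x → E x s → C T s x
    to-s nx ex = conn-edge (conn-left (near s∈)) (λ q → nx (_ , nT , q)) (E-sym ex)
    inside : ∀ {q} → q ∈ w ∷ u ∷ qs → C S w q
    inside (here refl) = here w∉
    inside (there (here refl)) = conn-edge w∉ u∉ eu
    inside (there (there q)) = step w∉ eu (qs-in q)
    w-big : Big S w
    w-big = big-conn (conn-edge u∉ w∉ (E-sym eu)) p-big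
    last′ = last-exists w (take j (u ∷ qs))
    last = proj₂ last′
    last-in : C S w (proj₁ last′)
    last-in = inside (take-⊂ (suc j) (w ∷ u ∷ qs) (last-∈ last))
    ww′-nadj : ¬ E w′ u → ¬ E w′ w × w′ ≢ w
    ww′-nadj ne = (λ e″ → ne (proj₁ (at-u (twins nw nw′ (E-sym e″))) eu)) , λ { refl → ne eu }
      where
      at-u : w ≈ w′ → (E w u → E w′ u) × (E w′ u → E w u)
      at-u (inj₁ (R , nR , w∈ , _)) = ⊥-elim (nw (R , nR , w∈))
      at-u (inj₂ (_ , _ , h)) = h uu
    far-off : ∀ {x q} → C T s x → q ∈ qs → ¬ E x q × x ≢ q
    far-off sx q∈ = apart-nbr apart sx (qs-far q∈)
    whole : ¬ E w′ u → IP (w′ ∷ s ∷ w ∷ u ∷ qs)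
    whole ne = cons e′ (λ { (here refl) → proj₁ (ww′-nadj ne) ; (there (here refl)) → ne ; (there (there q)) → proj₁ (far-off (to-s nw′ e′) q) })
      (λ { (here refl) → E-irr e′ ; (there (here refl)) → proj₂ (ww′-nadj ne) refl ; (there (there (here refl))) → nw′ uu
         ; (there (there (there q))) → proj₂ (far-off (to-s nw′ e′) q) refl })
      (cons (E-sym e) (λ { (here refl) e″ → no-U-edge nS s∈ u∉ uu (E-sym e″) ; (there q) → proj₁ (far-off (near s∈) q) })
        (λ { (here refl) → E-irr e ; (there (here refl)) → u∉ s∈ ; (there (there q)) → proj₂ (far-off (near s∈) q) refl })
        (cons eu (λ q → proj₁ (far-off (to-s nw e) q)) (λ { (here refl) → nw uu ; (there q) → proj₂ (far-off (to-s nw e) q) refl }) path))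
    P : ¬ E w′ u → Pk (w′ ∷ s ∷ take (suc j) (w ∷ u ∷ qs))
    P ne = pk (ip-take (2 + j) (whole ne)) (cong (3 +_) (trans (length-take j (u ∷ qs))
             (m≤n⇒m⊓n≡m (≤-trans (n≤1+n j) (≤-trans (n≤1+n _) (≤-trans (≤-reflexive (sym qs-long)) (n≤1+n _)))))))

  same-at : ∀ {S s w w′} → 𝒩 S → s ∈ S → ¬ U w → ¬ U w′ → E w s → E w′ s → C S w w′ → w ≈ w′
  same-at nS s∈ nw nw′ e e′ c = inj₂ (nw , nw′ , λ uu → twins-at nS s∈ nw nw′ e e′ c uu , twins-at nS s∈ nw′ nw e′ e (conn-sym c) uu)

  -- On a walk to `U` the vertex before `U` has a neighbour there, and `off-U-twins` passes this
  -- neighbour back along the walk.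
  U-nbr : ∀ {v} → ¬ U v → ∃ λ s → U s × E v s
  U-nbr {v} nv with sep-nonempty (𝒩-sep (proj₂ some-𝒩))
  ... | s , s∈ = go nv (connected v s)
    where
    go : ∀ {v} → ¬ U v → Conn (λ _ → ⊤) v s → ∃ λ s → U s × E v s
    go nv (here _) = ⊥-elim (nv (_ , proj₂ some-𝒩 , s∈))
    go nv (step {v = w} _ e c) with dec (U w)
    ... | yes uw = w , uw , e
    ... | no nw with go nw c
    ... | t , (T , nT , t∈) , e′ = t , (T , nT , t∈) , Mixed.off-U-twins nT t∈ nw e′ nT t∈ nw nv e′ (E-sym e)

  Off : V → V → Set
  Off v x = ¬ (v ≈ x)

  ≈-module : ∀ {x y z} → x ≈ y → ¬ (x ≈ z) → E z x → E z y
  ≈-module (inj₁ (S , nS , x∈ , y∈)) ne e = is-module nS x∈ y∈ (off-class nS x∈ ne) e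
  ≈-module {z = z} (inj₂ (nx , _ , h)) ne e with dec (U z)
  ... | yes uz = E-sym (proj₁ (h uz) (E-sym e))
  ... | no nz = ⊥-elim (ne (twins nx nz (E-sym e)))

  -- Two neighbours off `U` would be equivalent, and one off `U` forbids the other to be in `U`. For
  -- two in `U`, a missing edge gives an induced path `y, v, x, ...` of the kind excluded by
  -- `no-touch`.
  join-at-U : ∀ {S v x y} → 𝒩 S → v ∈ S → E v x → E v y → C S x y → ¬ (x ≈ y) → E x y
  join-at-U {S} {v} {x} {y} nS v∈ ex ey xy ne with dec (U x) | dec (U y)
  ... | no nx | no ny = ⊥-elim (ne (same-at nS v∈ nx ny (E-sym ex) (E-sym ey) xy))
  ... | no nx | yes uy = ⊥-elim (Mixed.no-U-edge nS v∈ nx (E-sym ex) nS v∈ (conn-right xy) uy (E-sym ey))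
  ... | yes ux | no ny = ⊥-elim (Mixed.no-U-edge nS v∈ ny (E-sym ey) nS v∈ (conn-left xy) ux (E-sym ex))
  ... | yes ux | yes uy = dne λ nE → no-touch nS v∈ (P nE) last (big-conn last-in p-big) (conn-trans (conn-sym xy) last-in)
          (λ q → conn-trans (conn-sym last-in) (inside (take-⊂ (suc j) (x ∷ qs) q)))
    where
    open Beyond (beyond nS v∈ ux (conn-left xy))
    inside : ∀ {q} → q ∈ x ∷ qs → C S x q
    inside (here refl) = here (conn-left xy)
    inside (there q) = qs-in q
    last′ = last-exists x (take j qs)
    last = proj₂ last′
    last-in : C S x (proj₁ last′)
    last-in = inside (take-⊂ (suc j) (x ∷ qs) (last-∈ last))
    vy : C T v y
    vy = conn-edge (conn-left (near v∈)) (off-class nT p∈ ne) ey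
    whole : ¬ E x y → IP (y ∷ v ∷ x ∷ qs)
    whole nE = cons (E-sym ey) (λ { (here refl) e → nE (E-sym e) ; (there q) → proj₁ (apart-nbr apart vy (qs-far q)) })
      (λ { (here refl) → E-irr ey ; (there (here refl)) → ne ≈-refl ; (there (there q)) → proj₂ (apart-nbr apart vy (qs-far q)) refl })
      (cons ex (λ q → proj₁ (apart-nbr apart (near v∈) (qs-far q)))
        (λ { (here refl) → E-irr ex ; (there q) → proj₂ (apart-nbr apart (near v∈) (qs-far q)) refl }) path)
    P : ¬ E x y → Pk (y ∷ v ∷ take (suc j) (x ∷ qs))
    P nE = pk (ip-take (2 + j) (whole nE)) (cong (3 +_) (trans (length-take j qs)
             (m≤n⇒m⊓n≡m (≤-trans (n≤1+n j) (≤-trans (n≤1+n _) (≤-reflexive (sym qs-long)))))))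

  -- A connection from `y` would enter the separator of `x` from a vertex `a`, which is adjacent to
  -- `x` by modularity and not in `U`. Then `same-at` makes `a` equivalent to `v`, whose class the
  -- connection avoids.
  apart-off-U : ∀ {v x y} → ¬ U v → U x → U y → E v x → E v y → ¬ (x ≈ y) → ¬ Conn (Off v) x y
  apart-off-U {v} {x} {y} nv (S , nS , x∈) uy ex ey ne c
    with first-exit (_∉ S) (off-class nS x∈ ne) (λ q → q x∈) (conn-sym c)
  ... | a , b , a∉ , nb , e , ya , _ = proj₁ (conn-right ya) (same-at nS x∈ nv na ex (E-sym (is-module′ (E-sym e))) (step v∉ ey (conn-mono proj₂ ya)))
    where
    v∉ : v ∉ S
    v∉ q = nv (S , nS , q)
    b∈ : b ∈ S
    b∈ = dne nb
    na : ¬ U a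
    na ua = Mixed.no-U-edge nS x∈ nv ex nS b∈ a∉ ua e
    is-module′ : E b a → E x a
    is-module′ e′ = E-sym (is-module nS b∈ x∈ a∉ (E-sym e′))

  U-class : ∀ {v x} → ¬ U v → E v x → ¬ (v ≈ x) → U x
  U-class nv e ne = dne λ nx → ne (twins nv nx e)

  ≈-join : ∀ {v x y} → E v x → ¬ (v ≈ x) → E v y → ¬ (v ≈ y) → Conn (Off v) x y → ¬ (x ≈ y) → E x y
  ≈-join {v} ex nx ey ny c ne with dec (U v)
  ... | yes (S , nS , v∈) = join-at-U nS v∈ ex ey (conn-mono (off-class nS v∈) c) ne
  ... | no nv = ⊥-elim (apart-off-U nv (U-class nv ex nx) (U-class nv ey ny) ex ey ne c)

  -- A second side always exists: at a separator another component with an end, at a class off `U`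
  -- the vertex supplied by `across`.
  ≈-apart : ∀ {v x} → E v x → ¬ (v ≈ x) → ∃ λ y → E v y × ¬ (v ≈ y) × ¬ (x ≈ y) × ¬ Conn (Off v) x y
  ≈-apart {v} {x} ex nx with dec (U v)
  ... | no nv = far-side (U-class nv ex nx)
    where
    far-side : U x → ∃ λ y → E v y × ¬ (v ≈ y) × ¬ (x ≈ y) × ¬ Conn (Off v) x y
    far-side (S , nS , x∈) with Mixed.across nS x∈ nv ex nS x∈ nv ex
    ... | u , uu , u∉ , e = u , E-sym e , v≉u , x≉u , apart-off-U nv (S , nS , x∈) uu ex (E-sym e) x≉u
      where
      v≉u : ¬ (v ≈ u)
      v≉u (inj₁ (T , nT , v∈ , _)) = nv (T , nT , v∈)
      v≉u (inj₂ (_ , nu , _)) = nu uu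
      x≉u : ¬ (x ≈ u)
      x≉u q = u∉ (≈-in nS x∈ q)
  ... | yes (S , nS , v∈) with other-big (𝒩-sep nS) x
  ... | c , bc , nxc with tight (𝒩-sep nS) bc v∈
  ... | y , cy , e = y , E-sym e , (λ q → conn-right cy (≈-in nS v∈ q)) , x≉y , λ d → nxy (conn-mono (off-class nS v∈) d)
    where
    x∉ : x ∉ S
    x∉ = off-class nS v∈ nx
    nxy : ¬ C S x y
    nxy d = nxc (conn-trans d (conn-sym cy))
    x≉y : ¬ (x ≈ y)
    x≉y (inj₁ (T , nT , x∈ , y∈)) = nxy (nested-conn (nested nT nS) x∈ y∈ x∉ (conn-right cy))
    x≉y (inj₂ (nx′ , _ , h)) with Mixed.across nS v∈ nx′ (E-sym ex) nS v∈ nx′ (E-sym ex)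
    ... | u , uu , u∉ , e′ = nxy (step x∉ (E-sym e′) (conn-edge u∉ (conn-right cy) (E-sym (proj₁ (h uu) (E-sym e′)))))

  -- Ramsey again: in an infinite class off `U`, all joined to `s`, a clique could exchange a member
  -- for `s`, or a star centred at `s` a leaf for a vertex behind `s`. Automorphisms fixing `s`
  -- preserve `S`, hence connection off `S`.
  ≈-finite : ∀ v → Finite (v ≈_)
  ≈-finite v with dec (U v)
  ... | yes (S , nS , v∈) = S , λ x q → ≈-in nS v∈ q
  ... | no nv with U-nbr nv
  ... | s , (S , nS , s∈) , e with Mixed.across nS s∈ nv e nS s∈ nv e
  ... | u , uu , u∉ , eu = dne λ nf → absurd (ramsey k (suc (suc j)) (¬fin⇒inf nf))
    where
    open Mixed nS s∈ nv e
    nU : ∀ {w} → v ≈ w → ¬ U w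
    nU (inj₁ (T , nT , v∈ , _)) = ⊥-elim (nv (T , nT , v∈))
    nU (inj₂ (_ , nw , _)) = nw
    nbr : ∀ {w t} → v ≈ w → U t → E v t → E w t
    nbr (inj₁ (T , nT , v∈ , _)) = ⊥-elim (nv (T , nT , v∈))
    nbr (inj₂ (_ , _ , h)) ut = proj₁ (h ut)
    us : U s
    us = S , nS , s∈
    off : ∀ {w} → ¬ U w → w ∉ S
    off nw q = nw (S , nS , q)
    inside : ∀ {w} → v ≈ w → C S v w
    inside q = step (off nv) (E-sym eu) (conn-edge u∉ (off (nU q)) (E-sym (nbr q uu (E-sym eu))))
    absurd : (Σ (Fin k → V) λ f → Clique f × (∀ i → v ≈ f i)) ⊎ (Σ (Fin (suc (suc j)) → V) λ f → Indep f × (∀ i → v ≈ f i)) → ⊥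
    absurd (inj₁ (f , cl , all)) = nU (all (σ zero)) (subst U (on zero) (img-U aut us))
      where open Match (clique-match cs (replace-clique cl λ i → nbr (all i) us e) cl)
    absurd (inj₂ (f , ind , all)) with other-big (𝒩-sep nS) v
    ... | c , bc , nvc with tight (𝒩-sep nS) bc s∈
    ... | y , cy , ey = star-swap (C S) st (replace-leaf st (E-sym ey) λ l → apart-nbr (λ d → nvc (conn-sym d)) cy (inside (all l)))
            us (λ l → nU (all l)) (λ uy → no-U-edge nS s∈ (conn-right cy) uy ey) keeps
            (λ a b → conn-trans (conn-sym (inside (all a))) (inside (all b))) (λ l d → nvc (conn-trans (inside (all l)) (conn-sym (conn-trans cy d))))
      where
      st : _
      st = record { leaves = ind ; spokes = λ l → E-sym (nbr (all l) us e) }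
      keeps : ∀ φ → φ · s ≡ s → ∀ {x y} → C S x y → C S (φ · x) (φ · y)
      keeps φ eq d = conn-mono (λ x∉ x∈ → x∉ (disjoint nS (img-𝒩 φ nS) s∈ (subst (_∈ img φ S) eq (∈-map⁺ (φ ·_) s∈)) x∈)) (img-C φ d)

-- The classes are the separating modules of a graph in which the components left by
-- deleting a class meet its neighbourhood in a set any two of whose classes are joined.
record Blocks (G : Graph) : Set₁ where
  open Graph G
  infix 4 _≈_
  field
    _≈_ : V → V → Set
    ≈-refl : ∀ {x} → x ≈ x
    ≈-sym : ∀ {x y} → x ≈ y → y ≈ x
    ≈-trans : ∀ {x y z} → x ≈ y → y ≈ z → x ≈ z
    ≈-img : ∀ (φ : Aut G) {x y} → x ≈ y → Aut.to φ x ≈ Aut.to φ y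
    ≈-finite : ∀ v → ∃ λ (L : List V) → ∀ x → v ≈ x → x ∈ L
    ≈-module : ∀ {x y z} → x ≈ y → ¬ (x ≈ z) → E z x → E z y
    ≈-join : ∀ {v x y} → E v x → ¬ (v ≈ x) → E v y → ¬ (v ≈ y) → ConnIn G (λ z → ¬ (v ≈ z)) x y → ¬ (x ≈ y) → E x y
    ≈-apart : ∀ {v x} → E v x → ¬ (v ≈ x) → ∃ λ y → E v y × ¬ (v ≈ y) × ¬ (x ≈ y) × ¬ ConnIn G (λ z → ¬ (v ≈ z)) x y

-- Ends of a tree of blocks

module BlockGraph (em : ExcludedMiddle (Level.suc 0ℓ)) (G : Graph) (connected : Connected G) (ρ₀ : Ray G) (blocks : Blocks G) where
  open Paths em G public
  open Blocks blocks public

  Off : V → V → Set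
  Off v x = ¬ (v ≈ x)

  Outer : V → V → Set
  Outer v x = E v x × Off v x

  off-sym : ∀ {v x} → Off v x → Off x v
  off-sym n q = n (≈-sym q)

  off-resp : ∀ {v w x} → v ≈ w → Off v x → Off w x
  off-resp q n r = n (≈-trans q r)

  outer-sym : ∀ {v x} → Outer v x → Outer x v
  outer-sym (e , n) = E-sym e , off-sym n

  outer-≈ : ∀ {v w x} → v ≈ w → Outer v x → Outer w x
  outer-≈ q (e , n) = E-sym (≈-module q n (E-sym e)) , off-resp q n

  abstract
    outer-exists : ∀ v → ∃ λ x → Outer v x
    outer-exists v with ray-avoids ρ₀ (proj₁ (≈-finite v))
    ... | N , f with first-exit (v ≈_) ≈-refl (λ q → f N ≤-refl (proj₂ (≈-finite v) _ q)) (connected v (at ρ₀ N))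
    ... | a , b , va , nvb , e , _ = b , outer-≈ (≈-sym va) (e , λ q → nvb (≈-trans va q))

  -- A neighbour of both joins `x` to `y`; if the first one found lies in the class of `v`,
  -- `≈-apart` gives another.
  class-conn : ∀ {v x y} → x ≈ y → Off v x → Conn (Off v) x y
  class-conn {v} {x} {y} q n with outer-exists x
  ... | a , ea , na with dec (v ≈ a)
  ... | no va = step n ea (conn-edge va (λ r → n (≈-trans r (≈-sym q))) (E-sym (proj₁ (outer-≈ q (ea , na)))))
  ... | yes va with ≈-apart ea na
  ... | b , eb , nb , nab , _ = step n eb (conn-edge (λ r → nab (≈-trans (≈-sym va) r)) (λ r → n (≈-trans r (≈-sym q))) (E-sym (proj₁ (outer-≈ q (eb , nb)))))

  conn-≈ˡ : ∀ {v x y z} → x ≈ y → Off v x → Conn (Off v) x z → Conn (Off v) y z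
  conn-≈ˡ q n c = conn-trans (conn-sym (class-conn q n)) c

  abstract
    entry : ∀ {v y} → Off v y → ∃ λ x → Outer v x × Conn (Off v) y x
    entry {v} {y} n with first-exit (Off v) n (λ h → h ≈-refl) (connected y v)
    ... | a , b , va , nb , e , ya , _ = a , outer-≈ (≈-sym (dne nb)) (E-sym e , λ q → va (≈-trans (dne nb) q)) , conn-mono proj₂ ya

  LivesAt : V → Ray G → V → Set
  LivesAt v = Lives (Off v)

  abstract
    lives-at : ∀ v ρ → ∃ λ x → LivesAt v ρ x
    lives-at v ρ = ray-lives ρ (proj₁ (≈-finite v)) (λ x∉ q → x∉ (proj₂ (≈-finite v) _ q))

  lives-equiv : ∀ {v x ρ ρ′} → EquivRay G ρ ρ′ → LivesAt v ρ x → LivesAt v ρ′ x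
  lives-equiv {v} eq (lv N f) with eq (proj₁ (≈-finite v))
  ... | M , h = lv (N ⊔ M) λ i le → conn-trans (f (N ⊔ M) (m≤m⊔n N M))
          (conn-mono (λ x∉ q → x∉ (proj₂ (≈-finite v) _ q)) (h (N ⊔ M) i (m≤n⊔m N M) (≤-trans (m≤n⊔m N M) le)))

  equiv-refl : ∀ ρ → EquivRay G ρ ρ
  equiv-refl ρ S with ray-avoids ρ S
  ... | N , f = N , λ i l p q → conn-trans (conn-sym (ray-conn ρ N f i p)) (ray-conn ρ N f l q)

  equiv-sym : ∀ {ρ σ} → EquivRay G ρ σ → EquivRay G σ ρ
  equiv-sym eq S with eq S
  ... | N , f = N , λ i l p q → conn-sym (f l i q p)

  ·-walk : ∀ (φ : Aut G) {m u v} → WalkLen G m u v → WalkLen G m (φ · u) (φ · v)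
  ·-walk φ nil = nil
  ·-walk φ (cons e w) = cons (·-E φ _ _ e) (·-walk φ w)

  ·-bounded : ∀ (φ : Aut G) {ρ} → BoundedRecurrent G ρ → BoundedRecurrent G (·-ray φ ρ)
  ·-bounded φ {ρ} (S , (d , diam) , rec) = (λ v → S (bwd φ v)) , (d , diam′) ,
    λ N → proj₁ (rec N) , proj₁ (proj₂ (rec N)) , subst S (sym (bwd-· φ _)) (proj₂ (proj₂ (rec N)))
    where
    diam′ : ∀ u v → S (bwd φ u) → S (bwd φ v) → DistLE G u v d
    diam′ u v su sv with diam _ _ su sv
    ... | m , le , w = m , le , subst₂ (WalkLen G m) (·-bwd φ u) (·-bwd φ v) (·-walk φ w)

  walk-++ : ∀ {m l u v w} → WalkLen G m u v → WalkLen G l v w → WalkLen G (m + l) u w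
  walk-++ nil q = q
  walk-++ (cons e p) q = cons e (walk-++ p q)

  abstract
    walk : ∀ u v → ∃ λ m → WalkLen G m u v
    walk u v = go (connected u v)
      where
      go : ∀ {u v} → Conn (λ _ → ⊤) u v → ∃ λ m → WalkLen G m u v
      go (here _) = 0 , nil
      go (step _ e c) with go c
      ... | m , w = suc m , cons e w

  shift : {I : Set} → (I → I) → ℕ → I → I
  shift nx zero i = i
  shift nx (suc m) i = shift nx m (nx i)

  shift-+ : ∀ {I : Set} (nx : I → I) m l i → shift nx (m + l) i ≡ shift nx l (shift nx m i)
  shift-+ nx zero l i = refl
  shift-+ nx (suc m) l i = shift-+ nx m l (nx i)

  -- A line of classes, each separating the one before from the one after. The index type and its
  -- successor stay open, so the same lemmas serve ℕ and both directions of ℤ.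
  Straight : {I : Set} → (I → I) → (I → V) → Set
  Straight nx q = ∀ i → Outer (q i) (q (nx i)) × ¬ Conn (Off (q (nx i))) (q i) (q (nx (nx i)))

  module Line {I : Set} (nx : I → I) (q : I → V) (straight : Straight nx q) where

    sh : ℕ → I → I
    sh = shift nx

    Right : I → V → Set
    Right i x = Conn (Off (q i)) (q (nx i)) x

    right-class : ∀ {i z} → q (nx i) ≈ z → Right i z
    right-class {i} e = class-conn e (proj₂ (proj₁ (straight i)))

    private
      avoids : ∀ {i z} → Right (nx i) z → Off (q i) z
      avoids {i} r e = proj₂ (straight i) (conn-trans (class-conn e (off-sym (proj₂ (proj₁ (straight i))))) (conn-sym r))

    right-nest : ∀ {i x} → Right (nx i) x → Right i x
    right-nest {i} r = step (proj₂ (proj₁ (straight i))) (proj₁ (proj₁ (straight (nx i)))) (conn-within avoids r)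

    right-mono : ∀ m {i x} → Right (sh m i) x → Right i x
    right-mono zero r = r
    right-mono (suc m) r = right-nest (right-mono m r)

    right-≤ : ∀ {m l i x} → m ≤ l → Right (sh l i) x → Right (sh m i) x
    right-≤ {m} {l} {i} {x} m≤l r = right-mono (l ∸ m) (subst (λ z → Right z x) (trans (cong (λ z → sh z i) (sym (m+[n∸m]≡n m≤l))) (shift-+ nx m (l ∸ m) i)) r)

    not-right : ∀ {i} → ¬ Right i (q i)
    not-right r = conn-right r ≈-refl

    no-skip : ∀ {i x} → Right (nx i) x → ¬ E (q i) x
    no-skip {i} r e = proj₂ (straight i) (conn-sym (conn-snoc r (E-sym e) (off-sym (proj₂ (proj₁ (straight i))))))

    far : ∀ m {i} → Right i (q (sh (suc m) i))
    far zero {i} = right-class ≈-refl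
    far (suc m) = right-nest (far m)

    window : ℕ → I → List V
    window zero i = []
    window (suc m) i = q i ∷ window m (nx i)

    window-right : ∀ m {i z} → z ∈ window m (nx i) → Right i z
    window-right (suc m) (here refl) = right-class ≈-refl
    window-right (suc m) (there z∈) = right-nest (window-right m z∈)

    window-ip : ∀ m i → IP (window (suc m) i)
    window-ip zero i = one
    window-ip (suc m) i = cons (proj₁ (proj₁ (straight i))) (λ z∈ → no-skip (window-right m z∈))
      (λ z∈ → not-right (window-right (suc m) z∈)) (window-ip m (nx i))

    window-length : ∀ m i → length (window m i) ≡ m
    window-length zero i = refl
    window-length (suc m) i = cong suc (window-length m (nx i))

    window-nth : ∀ d {m l i} → l < m → nth d (window m i) l ≡ q (sh l i)
    window-nth d {suc m} {zero} _ = refl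
    window-nth d {suc m} {suc l} (s≤s lt) = window-nth d lt

    -- One edge enters at most one further set of the nested sequence `Right i`, so this sequence
    -- measures distance.
    walk-bound : ∀ {m i u y} → WalkLen G m u y → ¬ Right i u → ¬ Right (sh m i) y
    walk-bound nil nr r = nr r
    walk-bound {suc m} {i} {u} (cons {v = w} e p) nr r = walk-bound p nr′ r
      where
      nr′ : ¬ Right (nx i) w
      nr′ rw with dec (q (nx i) ≈ u)
      ... | yes eq = nr (right-class eq)
      ... | no n = nr (right-nest (conn-snoc rw (E-sym e) n))

    abstract
      not-right-far : ∀ i x → ∃ λ m → ¬ Right (sh m i) x
      not-right-far i x with walk (q i) x
      ... | m , w = m , walk-bound w not-right

    Follows : Ray G → Set
    Follows ρ = ∀ i → LivesAt (q i) ρ (q (nx i))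

    -- All of `S` is within `D + d` of `q i₀`, while the tail of the ray lies beyond the class
    -- `D + d` places along the line.
    follows-unbounded : I → ∀ {ρ} → Follows ρ → ¬ BoundedRecurrent G ρ
    follows-unbounded i₀ {ρ} fol (S , (d , diam) , rec) with rec 0
    ... | n₀ , _ , p∈ with walk (q i₀) (at ρ n₀)
    ... | D , w with fol (sh (D + d) i₀)
    ... | lv N f with rec N
    ... | n , N≤n , y∈ with diam _ _ p∈ y∈
    ... | l , l≤d , w′ = walk-bound (walk-++ w w′) not-right (right-≤ (+-monoʳ-≤ D l≤d) (f n N≤n))

  -- The ray does not leave the block of `v` and `x`: at every class `y` of the block it stays on
  -- the side of `v`.
  record Stuck (ρ : Ray G) (v x : V) : Set where
    field
      stuck-outer : Outer v x
      stuck-lives : LivesAt v ρ x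
      stuck-back : ∀ {y} → Outer v y → Conn (Off v) x y → LivesAt y ρ v

  Block : V → V → V → Set
  Block v x z = Outer v z × Conn (Off v) x z

  block-≈ : ∀ {v x z z′} → z ≈ z′ → Block v x z → Block v x z′
  block-≈ q ((e , n) , c) = outer-sym (outer-≈ q (outer-sym (e , n))) , conn-trans c (class-conn q n)

  block-join : ∀ {v x y z} → Block v x y → Block v x z → Off y z → E y z
  block-join ((e , n) , c) ((e′ , n′) , c′) = ≈-join e n e′ n′ (conn-trans (conn-sym c) c′)

  private
    -- Suppose a tail misses the block, which is first reached from it along an edge `a b`. Since
    -- `b` does not cut the tail off from `v`, the tail also reaches `v` or another member off `b`.
    -- Then `c` or `a`, outside the block, turns out to be adjacent to `v` and so a member.
    visits′ : ∀ {ρ v x} → Stuck ρ v x → ∀ N → ∃ λ i → N ≤ i × Block v x (at ρ i)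
    visits′ {ρ} {v} {x} st N = dne λ none → absurd λ i le b → none (i , le , b)
      where
      open Stuck st
      open Lives stuck-lives
      N′ : ℕ
      N′ = N ⊔ start
      y : V
      y = at ρ N′
      xy : Conn (Off v) x y
      xy = from-start N′ (m≤n⊔m N start)
      Free : V → Set
      Free z = Off v z × ¬ Block v x z
      absurd : (∀ i → N ≤ i → ¬ Block v x (at ρ i)) → ⊥
      absurd never with first-exit (λ z → ¬ Block v x z) (never N′ (m≤m⊔n N start)) (λ h → h (stuck-outer , here (proj₂ stuck-outer))) (conn-sym xy)
      ... | a , b , na , nb , eab , ya , _ = escape (dne nb)
        where
        tail : ∀ i → N′ ≤ i → Conn Free y (at ρ i)
        tail = ray-conn ρ N′ λ i le → conn-right (from-start i (≤-trans (m≤n⊔m N start) le)) , never i (≤-trans (m≤m⊔n N start) le)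
        module _ (Bb : Block v x b) where
          off-b : ∀ {z} → Free z → Off b z
          off-b (_ , nz) q = nz (block-≈ q Bb)
          in-x : ∀ {z} → Conn Free y z → Conn (Off v) x z
          in-x c = conn-trans xy (conn-mono proj₁ c)
          yv : Conn (Off b) y v
          yv = lives-unique (lv N′ λ i le → conn-mono off-b (tail i le)) (stuck-back (proj₁ Bb) (proj₂ Bb))
          close : ∀ {c d} → Conn Free y c → Off b d → ¬ Free d → E c d → ⊥
          close {c} {d} yc bd nfd e with dec (v ≈ d)
          ... | yes vd = proj₂ (conn-right yc) (outer-≈ (≈-sym vd) (E-sym e , λ q → proj₁ (conn-right yc) (≈-trans vd q)) , in-x yc)
          ... | no nvd = na ((Eva , proj₁ fa) , in-x ya)
            where
            fa : Free a
            fa = conn-right ya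
            Bd : Block v x d
            Bd = dne λ n → nfd (nvd , n)
            vab : Conn (Off b) v a
            vab = step (off-sym (proj₂ (proj₁ Bb))) (proj₁ (proj₁ Bd)) (step bd (E-sym e) (conn-mono off-b (conn-trans (conn-sym yc) ya)))
            Eva : E v a
            Eva = ≈-join (E-sym (proj₁ (proj₁ Bb))) (off-sym (proj₂ (proj₁ Bb))) (E-sym eab) (off-b fa) vab (proj₁ fa)
        escape : Block v x b → ⊥
        escape Bb with first-exit Free (conn-right (tail N′ ≤-refl)) (λ f → proj₁ f ≈-refl) (yv Bb)
        ... | c , d , _ , nfd , e , yc , dv = close Bb (conn-mono proj₂ yc) (conn-left dv) nfd e

  abstract
    visits : ∀ {ρ v x} → Stuck ρ v x → ∀ N → ∃ λ i → N ≤ i × Block v x (at ρ i)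
    visits = visits′

  stuck-bounded : ∀ {ρ v x} → Stuck ρ v x → BoundedRecurrent G ρ
  stuck-bounded {v = v} {x} st = Block v x , (2 , λ u w (bu , _) (bw , _) → 2 , ≤-refl , cons (E-sym (proj₁ bu)) (cons (proj₁ bw) nil)) , visits st

  stuck-equiv : ∀ {ρ ρ′ v x} → EquivRay G ρ ρ′ → Stuck ρ v x → Stuck ρ′ v x
  stuck-equiv {ρ} {ρ′} eq st = record { stuck-outer = stuck-outer ; stuck-lives = lives-equiv {ρ = ρ} {ρ′} eq stuck-lives ; stuck-back = λ o c → lives-equiv {ρ = ρ} {ρ′} eq (stuck-back o c) }
    where open Stuck st

  stuck-local : ∀ {ρ v x} → Stuck ρ v x → LocalEnd G ρ
  stuck-local {ρ} st ρ′ eq = stuck-bounded (stuck-equiv {ρ} {ρ′} eq st)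

  FollowsLine : Ray G → Set
  FollowsLine ρ = Σ (ℕ → V) λ q → Σ (Straight suc q) λ st → Line.Follows suc q st ρ

  follows-global : ∀ {ρ} → FollowsLine ρ → GlobalEnd G ρ
  follows-global {ρ} (q , st , fol) ρ′ eq = Line.follows-unbounded suc q st 0 (λ i → lives-equiv {ρ = ρ} {ρ′} eq (fol i))

  module _ (ρ : Ray G) (never : ¬ ∃ λ v → ∃ λ x → Stuck ρ v x) where

    private
      abstract
        -- A ray that is not stuck at `v` leaves the block through some class `y` without settling
        -- on the side of `v` again; iteration gives the line.
        onward : ∀ v → ∃ λ y → Outer v y × LivesAt v ρ y × ¬ LivesAt y ρ v
        onward v = dne λ none → never (v , proj₁ ent , record
          { stuck-outer = proj₁ (proj₂ ent) ; stuck-lives = live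
          ; stuck-back = λ o c → dne λ n → none (_ , o , lives-conn c live , n) })
          where
          y₀ : ∃ λ y → LivesAt v ρ y
          y₀ = lives-at v ρ
          ent : ∃ λ x → Outer v x × Conn (Off v) (proj₁ y₀) x
          ent = entry (lives-left (proj₂ y₀))
          live : LivesAt v ρ (proj₁ ent)
          live = lives-conn (proj₂ (proj₂ ent)) (proj₂ y₀)

      q : ℕ → V
      q zero = at ρ 0
      q (suc i) = proj₁ (onward (q i))

    follows-line : FollowsLine ρ
    follows-line = q , (λ i → proj₁ (proj₂ (onward (q i))) , λ c →
        proj₂ (proj₂ (proj₂ (onward (q i)))) (lives-conn (conn-sym c) (proj₁ (proj₂ (proj₂ (onward (q (suc i)))))))) ,
      λ i → proj₁ (proj₂ (proj₂ (onward (q i))))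

  abstract
    stuck-or-follows : ∀ ρ → (∃ λ v → ∃ λ x → Stuck ρ v x) ⊎ FollowsLine ρ
    stuck-or-follows ρ with dec (∃ λ v → ∃ λ x → Stuck ρ v x)
    ... | yes st = inj₁ st
    ... | no n = inj₂ (follows-line ρ n)

  local-or-global : ∀ ρ → LocalEnd G ρ ⊎ GlobalEnd G ρ
  local-or-global ρ with stuck-or-follows ρ
  ... | inj₁ (_ , _ , st) = inj₁ (stuck-local st)
  ... | inj₂ fol = inj₂ (follows-global fol)

  abstract
    local-stuck : ∀ {ρ} → LocalEnd G ρ → ∃ λ v → ∃ λ x → Stuck ρ v x
    local-stuck {ρ} loc with stuck-or-follows ρ
    ... | inj₁ st = st
    ... | inj₂ fol = ⊥-elim (follows-global fol ρ (equiv-refl ρ) (loc ρ (equiv-refl ρ)))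

  abstract
    global-follows : ∀ {ρ} → GlobalEnd G ρ → FollowsLine ρ
    global-follows {ρ} glob with stuck-or-follows ρ
    ... | inj₁ (_ , _ , st) = ⊥-elim (glob ρ (equiv-refl ρ) (stuck-bounded st))
    ... | inj₂ fol = fol

  module Extend (u v : V) (o : Outer u v) where

    private
      Pair : Set
      Pair = Σ V λ u → Σ V λ v → Outer u v

      abstract
        next : ((u , v , o) : Pair) → ∃ λ w → Outer v w × ¬ Conn (Off v) u w
        next (u , v , o) with ≈-apart (proj₁ (outer-sym o)) (proj₂ (outer-sym o))
        ... | w , e , n , _ , nc = w , (e , n) , nc

      pairs : ℕ → Pair
      pairs zero = u , v , o
      pairs (suc i) = proj₁ (proj₂ (pairs i)) , proj₁ (next (pairs i)) , proj₁ (proj₂ (next (pairs i)))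

    line : ℕ → V
    line i = proj₁ (pairs i)

    line-straight : Straight suc line
    line-straight i = proj₂ (proj₂ (pairs i)) , proj₂ (proj₂ (next (pairs i)))

  right-of : ∀ {q} (st : Straight suc q) {i l} → i < l → Line.Right suc q st i (q l)
  right-of {q} st {i} {l} i<l = subst (λ z → Right i (q z))
    (trans (sh-suc (suc (l ∸ suc i)) i) (trans (cong suc (+-comm (l ∸ suc i) i)) (m+[n∸m]≡n i<l))) (far (l ∸ suc i))
    where
    open Line suc q st
    sh-suc : ∀ m i → sh m i ≡ m + i
    sh-suc zero i = refl
    sh-suc (suc m) i = trans (sh-suc m (suc i)) (+-suc m i)

  line-ray : ∀ q → Straight suc q → Ray G
  line-ray q st = record { seq = q ; inj = inj′ ; adj = λ i → proj₁ (proj₁ (st i)) }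
    where
    open Line suc q st
    apart : ∀ {i l} → i < l → q i ≢ q l
    apart {i} i<l eq = not-right (subst (Right i) (sym eq) (right-of st i<l))
    inj′ : ∀ i l → q i ≡ q l → i ≡ l
    inj′ i l eq with <-cmp i l
    ... | tri< lt _ _ = ⊥-elim (apart lt eq)
    ... | tri≈ _ e _ = e
    ... | tri> _ _ gt = ⊥-elim (apart gt (sym eq))

  global-exists : ∃ λ ρ → GlobalEnd G ρ
  global-exists = line-ray line line-straight , follows-global (line , line-straight , fol)
    where
    v₀ = at ρ₀ 0
    open Extend v₀ (proj₁ (outer-exists v₀)) (proj₂ (outer-exists v₀))
    open Line suc line line-straight
    fol : Follows (line-ray line line-straight)
    fol i = lv (suc i) λ l le → ray-conn (line-ray line line-straight) (suc i) (λ l le → conn-right (right-of line-straight le)) l le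

-- Transitivity on local ends

module LocalEnds (em : ExcludedMiddle (Level.suc 0ℓ)) (G : Graph) (connected : Connected G) (ρ₀ : Ray G) (blocks : Blocks G) where
  open import Data.Fin using (Fin; zero; suc)
  open import Data.List using (tabulate)
  open import Data.List.Membership.Propositional.Properties using (∈-tabulate⁺)
  open BlockGraph em G connected ρ₀ blocks public

  abstract
    class-cover : ∀ (L : List V) → ∃ λ M → ∀ {l z} → l ∈ L → l ≈ z → z ∈ M
    class-cover [] = [] , λ ()
    class-cover (v ∷ L) with class-cover L
    ... | M , h = proj₁ (≈-finite v) ++ M ,
      λ { (here refl) q → ∈-++⁺ˡ (proj₂ (≈-finite v) _ q) ; (there l∈) q → ∈-++⁺ʳ (proj₁ (≈-finite v)) (h l∈ q) }

  abstract
    visits-off : ∀ {ρ v x} → Stuck ρ v x → ∀ N (L : List V) →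
      ∃ λ i → N ≤ i × Block v x (at ρ i) × (∀ {l} → l ∈ L → Off l (at ρ i))
    visits-off {ρ} st N L with class-cover L
    ... | M , cov with ray-avoids ρ M
    ... | N′ , f with visits st (N ⊔ N′)
    ... | i , le , b = i , ≤-trans (m≤m⊔n N N′) le , b , λ l∈ q → f i (≤-trans (m≤n⊔m N N′) le) (cov l∈ q)

  abstract
    transversal : ∀ {ρ v x} → Stuck ρ v x → ∀ m → Σ (Fin m → V) λ f → (∀ i → Block v x (f i)) × (∀ i l → i ≢ l → Off (f i) (f l))
    transversal st zero = (λ ()) , (λ ()) , λ ()
    transversal {ρ} {v} {x} st (suc m) with transversal st m
    ... | f , fb , off with visits-off st 0 (tabulate f)
    ... | n , _ , b , new = at ρ n ◂ f , (λ { zero → b ; (suc i) → fb i }) , off′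
      where
      off′ : ∀ i l → i ≢ l → Off ((at ρ n ◂ f) i) ((at ρ n ◂ f) l)
      off′ zero zero ne = ⊥-elim (ne refl)
      off′ zero (suc l) ne = off-sym (new (∈-tabulate⁺ l))
      off′ (suc i) zero ne = new (∈-tabulate⁺ i)
      off′ (suc i) (suc l) ne = off i l (λ { refl → ne refl })

  ≈-img⁻ : ∀ φ {x y} → φ · x ≈ φ · y → x ≈ y
  ≈-img⁻ φ {x} {y} q = subst₂ _≈_ (bwd-· φ x) (bwd-· φ y) (≈-img (inv φ) q)

  -- Two visits far along the rays are joined through a third member of the block, a late visit of
  -- `σ` in a class other than theirs, so `S` is avoided.
  same-block-equiv : ∀ {v x} ρ σ → (∀ N → ∃ λ i → N ≤ i × Block v x (at ρ i)) →
    (∀ N (L : List V) → ∃ λ i → N ≤ i × Block v x (at σ i) × (∀ {l} → l ∈ L → Off l (at σ i))) → EquivRay G ρ σ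
  same-block-equiv ρ σ vis vis′ S with ray-avoids ρ S | ray-avoids σ S
  ... | N , f | M , g = N ⊔ M , λ i l p q → connect i l (≤-trans (m≤m⊔n N M) p) (≤-trans (m≤n⊔m N M) q)
    where
    connect : ∀ i l → N ≤ i → M ≤ l → Conn (Avoid G S) (at ρ i) (at σ l)
    connect i l p q with vis i
    ... | i′ , i≤i′ , b with vis′ l []
    ... | l′ , l≤l′ , b′ , _ with vis′ M (at ρ i′ ∷ at σ l′ ∷ [])
    ... | m , M≤m , b″ , off = conn-trans (ray-conn ρ i (λ a le → f a (≤-trans p le)) i′ i≤i′)
      (step (f i′ (≤-trans p i≤i′)) (block-join b b″ (off (here refl)))
        (step (g m M≤m) (E-sym (block-join b′ b″ (off (there (here refl)))))
          (conn-sym (ray-conn σ l (λ a le → g a (≤-trans q le)) l′ l≤l′))))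

  -- Two inequivalent vertices `a` and `b` of the block determine it: a vertex adjacent to both is
  -- connected to `w` off `a` through `b`, so `≈-join` joins it to `w`. Hence the image of one block
  -- lands in the other, up to finitely many classes.
  module Carry {m : ℕ} {ρ σ : Ray G} {v x w y : V} (st : Stuck ρ v x) (st′ : Stuck σ w y)
    {f g : Fin (suc (suc m)) → V} (fb : ∀ i → Block v x (f i)) (foff : ∀ i l → i ≢ l → Off (f i) (f l))
    (gb : ∀ i → Block w y (g i)) (mt : Match f g) where

    open Match mt using (aut; on)

    private
      a b : V
      a = aut · f zero
      b = aut · f (suc zero)
      a-block : Block w y a
      a-block = subst (Block w y) (sym (on zero)) (gb _)
      b-block : Block w y b
      b-block = subst (Block w y) (sym (on (suc zero))) (gb _)
      image : ∀ {z} → Block v x z → Off (f zero) z → Off (f (suc zero)) z → Off (bwd aut w) z → Block w y (aut · z)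
      image {z} bz n₀ n₁ nw = (ewz , w≉z) , conn-trans (proj₂ a-block) (conn-edge (proj₂ (proj₁ a-block)) w≉z eaz)
        where
        w≉z : Off w (aut · z)
        w≉z q = nw (≈-img⁻ aut (subst (_≈ aut · z) (sym (·-bwd aut w)) q))
        eaz : E a (aut · z)
        eaz = ·-E aut _ _ (block-join (fb zero) bz n₀)
        ebz : E b (aut · z)
        ebz = ·-E aut _ _ (block-join (fb (suc zero)) bz n₁)
        a≉w : Off a w
        a≉w = off-sym (proj₂ (proj₁ a-block))
        a≉z : Off a (aut · z)
        a≉z q = n₀ (≈-img⁻ aut q)
        ewz : E w (aut · z)
        ewz = ≈-join (E-sym (proj₁ (proj₁ a-block))) a≉w eaz a≉z
                (step a≉w (proj₁ (proj₁ b-block)) (conn-edge (λ q → foff zero (suc zero) (λ ()) (≈-img⁻ aut q)) a≉z ebz)) w≉z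

    image-visits : ∀ N → ∃ λ i → N ≤ i × Block w y (aut · at ρ i)
    image-visits N with visits-off st N (f zero ∷ f (suc zero) ∷ bwd aut w ∷ [])
    ... | i , le , bz , off = i , le , image bz (off (here refl)) (off (there (here refl))) (off (there (there (here refl))))

  local-transitive : ∀ {m} → CSTransitive G (suc (suc m)) → ∀ ρ σ → LocalEnd G ρ → LocalEnd G σ → Σ (Aut G) λ φ → MapsEnd G φ ρ σ
  local-transitive {m} cs ρ σ lρ lσ = between (proj₂ (proj₂ (local-stuck lρ))) (proj₂ (proj₂ (local-stuck lσ)))
    where
    between : ∀ {v x w y} → Stuck ρ v x → Stuck σ w y → Σ (Aut G) λ φ → MapsEnd G φ ρ σ
    between st st′ = Match.aut mt , same-block-equiv (·-ray (Match.aut mt) ρ) σ (Carry.image-visits st st′ fb foff gb mt) (visits-off st′)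
      where
      fb = proj₁ (proj₂ (transversal st (suc (suc m))))
      foff = proj₂ (proj₂ (transversal st (suc (suc m))))
      gb = proj₁ (proj₂ (transversal st′ (suc (suc m))))
      goff = proj₂ (proj₂ (transversal st′ (suc (suc m))))
      mt : Match (proj₁ (transversal st (suc (suc m)))) (proj₁ (transversal st′ (suc (suc m))))
      mt = clique-match cs (λ i l ne → block-join (fb i) (fb l) (foff i l ne)) (λ i l ne → block-join (gb i) (gb l) (goff i l ne))

-- Gluing automorphisms along a double line

module Gluing (em : ExcludedMiddle (Level.suc 0ℓ)) (G : Graph) (connected : Connected G) (ρ₀ : Ray G) (blocks : Blocks G) where
  open import Data.Integer.Base using (ℤ; +_; -[1+_])
  open LocalEnds em G connected ρ₀ blocks public

  -- Defined by cases so that the successor computes on `+ n` and a line over ℕ is literally one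
  -- half of a line over ℤ.
  nx pv : ℤ → ℤ
  nx (+ n) = + suc n
  nx -[1+ zero ] = + zero
  nx -[1+ suc n ] = -[1+ n ]
  pv (+ zero) = -[1+ zero ]
  pv (+ suc n) = + n
  pv -[1+ n ] = -[1+ suc n ]

  nx-pv : ∀ i → nx (pv i) ≡ i
  nx-pv (+ zero) = refl
  nx-pv (+ suc n) = refl
  nx-pv -[1+ n ] = refl

  pv-nx : ∀ i → pv (nx i) ≡ i
  pv-nx (+ n) = refl
  pv-nx -[1+ zero ] = refl
  pv-nx -[1+ suc n ] = refl

  shift-pos : ∀ m n → shift nx m (+ n) ≡ + (m + n)
  shift-pos zero n = refl
  shift-pos (suc m) n = trans (shift-pos m (suc n)) (cong +_ (+-suc m n))

  shift-neg : ∀ m n → shift nx m -[1+ m + n ] ≡ -[1+ n ]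
  shift-neg zero n = refl
  shift-neg (suc m) n = shift-neg m n

  shift-zero : ∀ n → shift nx (suc n) -[1+ n ] ≡ + 0
  shift-zero zero = refl
  shift-zero (suc n) = shift-zero n

  data Order (i l : ℤ) : Set where
    same : i ≡ l → Order i l
    above : ∀ m → shift nx (suc m) i ≡ l → Order i l
    below : ∀ m → shift nx (suc m) l ≡ i → Order i l

  shift-split : ∀ m n → shift nx (suc n + m) -[1+ n ] ≡ + m
  shift-split m n = trans (shift-+ nx (suc n) m -[1+ n ]) (trans (cong (shift nx m) (shift-zero n)) (trans (shift-pos m 0) (cong +_ (+-identityʳ m))))

  gap : ∀ {n m} → n < m → suc (m ∸ suc n) + n ≡ m
  gap {n} {m} lt = trans (cong suc (+-comm (m ∸ suc n) n)) (m+[n∸m]≡n lt)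

  order : ∀ i l → Order i l
  order (+ n) (+ m) with <-cmp n m
  ... | tri< lt _ _ = above (m ∸ suc n) (trans (shift-pos (suc (m ∸ suc n)) n) (cong +_ (gap lt)))
  ... | tri≈ _ refl _ = same refl
  ... | tri> _ _ gt = below (n ∸ suc m) (trans (shift-pos (suc (n ∸ suc m)) m) (cong +_ (gap gt)))
  order (+ n) -[1+ m ] = below (m + n) (shift-split n m)
  order -[1+ n ] (+ m) = above (n + m) (shift-split m n)
  order -[1+ n ] -[1+ m ] with <-cmp n m
  ... | tri< lt _ _ = below (m ∸ suc n) (trans (cong (λ z → shift nx (suc (m ∸ suc n)) -[1+ z ]) (sym (gap lt))) (shift-neg (suc (m ∸ suc n)) n))
  ... | tri≈ _ refl _ = same refl
  ... | tri> _ _ gt = above (n ∸ suc m) (trans (cong (λ z → shift nx (suc (n ∸ suc m)) -[1+ z ]) (sym (gap gt))) (shift-neg (suc (n ∸ suc m)) m))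

  ℤ-induction : (P : ℤ → Set) → P (+ 0) → (∀ {i} → P i → P (nx i)) → (∀ {i} → P (nx i) → P i) → ∀ i → P i
  ℤ-induction P z up down (+ zero) = z
  ℤ-induction P z up down (+ suc n) = up (ℤ-induction P z up down (+ n))
  ℤ-induction P z up down -[1+ zero ] = down z
  ℤ-induction P z up down -[1+ suc n ] = down (ℤ-induction P z up down -[1+ n ])

  other-side : ∀ {u v x} → Outer u v → ¬ Conn (Off v) u x → Conn (Off u) v x
  other-side {u} {v} {x} o n with dec (v ≈ x)
  ... | yes q = class-conn q (proj₂ o)
  ... | no nv with entry nv
  ... | y , (e , vy) , xy = conn-sym (conn-snoc (conn-within away xy) (E-sym e) (proj₂ o))
    where
    away : ∀ {z} → Conn (Off v) x z → Off u z
    away c q = n (conn-sym (conn-trans c (conn-sym (class-conn q (off-sym (proj₂ o))))))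

  -- `atM i` is the class of `q i` with what hangs on it away from the line, `atN i` what lies
  -- strictly between `q i` and `q (nx i)`. These pieces partition the graph.
  data Piece : Set where
    atM atN : ℤ → Piece

  module Double (q : ℤ → V) (st : Straight nx q) where

    back : Straight pv q
    back i = subst (λ z → Outer (q z) (q (pv i))) (nx-pv i) (outer-sym (proj₁ (st (pv i)))) ,
      λ c → proj₂ (st (pv (pv i))) (conn-sym (subst₂ (λ z w → Conn (Off (q z)) (q w) (q (pv (pv i))))
              (sym (nx-pv (pv i))) (sym (trans (cong nx (nx-pv (pv i))) (nx-pv i))) c))

    module F = Line nx q st
    module B = Line pv q back

    Rt Lt : ℤ → V → Set
    Rt = F.Right
    Lt = B.Right

    lt-nx : ∀ {i x} → Conn (Off (q (nx i))) (q i) x → Lt (nx i) x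
    lt-nx {i} {x} = subst (λ z → Conn (Off (q (nx i))) (q z) x) (sym (pv-nx i))

    lt-nx⁻ : ∀ {i x} → Lt (nx i) x → Conn (Off (q (nx i))) (q i) x
    lt-nx⁻ {i} {x} = subst (λ z → Conn (Off (q (nx i))) (q z) x) (pv-nx i)

    exclusive : ∀ {i x} → Rt i x → Lt i x → ⊥
    exclusive {i} {x} r l = proj₂ (back (nx i)) (subst (λ z → Conn (Off (q z)) (q (nx i)) (q (pv z))) (sym (pv-nx i)) (conn-trans r (conn-sym l)))

    rt-or-lt : ∀ i {x} → ¬ Lt (nx i) x → Rt i x
    rt-or-lt i n = other-side (proj₁ (st i)) (n ∘ lt-nx)

    lt-or-rt : ∀ i {x} → ¬ Rt i x → Lt (nx i) x
    lt-or-rt i n = lt-nx (other-side (outer-sym (proj₁ (st i))) n)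

    lt-next : ∀ {i x} → Lt i x → Lt (nx i) x
    lt-next {i} {x} l = B.right-nest (subst (λ z → Lt z x) (sym (pv-nx i)) l)

    lt-shift : ∀ m {i x} → Lt i x → Lt (shift nx m i) x
    lt-shift zero l = l
    lt-shift (suc m) l = lt-shift m (lt-next l)

    data InPiece : Piece → V → Set where
      mid : ∀ {i x} → ¬ Rt i x → ¬ Lt i x → InPiece (atM i) x
      btw : ∀ {i x} → Rt i x → Lt (nx i) x → InPiece (atN i) x

    private
      turn : ∀ m {i x} → Rt i x → ¬ Rt (shift nx m i) x → ∃ λ l → Rt l x × ¬ Rt (nx l) x
      turn zero r n = ⊥-elim (n r)
      turn (suc m) {i} {x} r n with dec (Rt (nx i) x)
      ... | yes r′ = turn m r′ n
      ... | no n′ = i , r , n′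

    abstract
      locate : ∀ x → ∃ λ p → InPiece p x
      locate x with B.not-right-far (+ 0) x
      ... | m , nl with F.not-right-far (pv (shift pv m (+ 0))) x
      ... | m′ , nr with turn m′ (rt-or-lt (pv (shift pv m (+ 0))) (subst (λ z → ¬ Lt z x) (sym (nx-pv (shift pv m (+ 0)))) nl)) nr
      ... | i , r , n with dec (Lt (nx i) x)
      ... | yes l = atN i , btw r l
      ... | no nl′ = atM (nx i) , mid n nl′

    private
      M-above : ∀ m {i l x} → InPiece (atM i) x → shift nx (suc m) i ≡ l → Lt l x
      M-above m {i} (mid nr _) refl = lt-shift m (lt-or-rt i nr)

      M-distinct : ∀ m {i l x} → InPiece (atM i) x → shift nx (suc m) i ≡ l → InPiece (atM l) x → ⊥
      M-distinct m p eq (mid _ nl) = nl (M-above m p eq)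

      N-distinct : ∀ m {i l x} → InPiece (atN i) x → shift nx (suc m) i ≡ l → InPiece (atN l) x → ⊥
      N-distinct m (btw _ l) refl (btw r _) = exclusive (F.right-mono m r) l

    piece-MN : ∀ {i l x} → InPiece (atM i) x → InPiece (atN l) x → ⊥
    piece-MN {i} {l} {x} (mid nr nl) (btw r lt) with order i l
    ... | same refl = nr r
    ... | above m refl = nr (F.right-mono (suc m) r)
    ... | below m refl = nl (lt-shift m lt)

    piece-unique : ∀ {p p′ x} → InPiece p x → InPiece p′ x → p ≡ p′
    piece-unique {atM i} {atN l} a b = ⊥-elim (piece-MN a b)
    piece-unique {atN i} {atM l} a b = ⊥-elim (piece-MN b a)
    piece-unique {atM i} {atM l} a b with order i l
    ... | same refl = refl
    ... | above m eq = ⊥-elim (M-distinct m a eq b)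
    ... | below m eq = ⊥-elim (M-distinct m b eq a)
    piece-unique {atN i} {atN l} a b with order i l
    ... | same refl = refl
    ... | above m eq = ⊥-elim (N-distinct m a eq b)
    ... | below m eq = ⊥-elim (N-distinct m b eq a)

    class-piece : ∀ {i x} → q i ≈ x → InPiece (atM i) x
    class-piece e = mid (λ r → conn-right r e) (λ l → conn-right l e)

    M-boundary : ∀ {i x y} → InPiece (atM i) x → ¬ InPiece (atM i) y → E x y → q i ≈ x
    M-boundary {i} {x} {y} (mid nr nl) ny e = dne λ n → ny
      (mid (λ r → nr (conn-snoc r (E-sym e) n)) (λ l → nl (conn-snoc l (E-sym e) n)))

    private
      lt-skip : ∀ m {i x} → Lt (nx i) x → ¬ E (q (shift nx (suc m) (nx i))) x
      lt-skip m {i} {x} l = B.no-skip (subst (λ z → Lt z x) (sym pv-shift) (lt-shift m l))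
        where
        pv-shift : pv (shift nx (suc m) (nx i)) ≡ shift nx m (nx i)
        pv-shift = trans (cong pv (shift-last m (nx i))) (pv-nx _)
          where
          shift-last : ∀ m i → shift nx (suc m) i ≡ nx (shift nx m i)
          shift-last zero i = refl
          shift-last (suc m) i = shift-last m (nx i)

    -- A vertex between `q l` and `q (nx l)` that is adjacent to one is connected to the other off
    -- the first, so `≈-join` makes it adjacent to both. Hence a piece can be glued in with its ends
    -- exchanged.
    N-boundary : ∀ {i l x y} → q i ≈ x → InPiece (atN l) y → E x y → (i ≡ l ⊎ i ≡ nx l) × E (q l) y × E (q (nx l)) y
    N-boundary {i} {l} {x} {y} ix (btw r lt) exy = at-end (order i l)
      where
      i-off : Off (q i) y
      i-off e = piece-MN (class-piece e) (btw r lt)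
      e : E (q i) y
      e = E-sym (≈-module (≈-sym ix) (λ e′ → i-off (≈-trans ix e′)) (E-sym exy))
      o = st l
      from-left : i ≡ l → E (q l) y × E (q (nx l)) y
      from-left refl = e , ≈-join (proj₁ (proj₁ o)) (proj₂ (proj₁ o)) e i-off r (λ e′ → conn-right lt e′)
      from-right : i ≡ nx l → E (q l) y × E (q (nx l)) y
      from-right refl = ≈-join (proj₁ (outer-sym (proj₁ o))) (proj₂ (outer-sym (proj₁ o))) e i-off (lt-nx⁻ lt) (λ e′ → conn-right r e′) , e
      at-end : Order i l → (i ≡ l ⊎ i ≡ nx l) × E (q l) y × E (q (nx l)) y
      at-end (same eq) = inj₁ eq , from-left eq
      at-end (above m refl) = ⊥-elim (F.no-skip (F.right-mono m r) e)
      at-end (below zero eq) = inj₂ (sym eq) , from-right (sym eq)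
      at-end (below (suc m) refl) = ⊥-elim (lt-skip m lt e)

    line-edge : ∀ {i l} → E (q i) (q l) → i ≢ l → l ≡ nx i ⊎ i ≡ nx l
    line-edge {i} {l} e ne with order i l
    ... | same eq = ⊥-elim (ne eq)
    ... | above zero eq = inj₁ (sym eq)
    ... | above (suc m) refl = ⊥-elim (F.no-skip (F.far m) e)
    ... | below zero eq = inj₂ (sym eq)
    ... | below (suc m) refl = ⊥-elim (F.no-skip (F.far m) (E-sym e))

    N-separate : ∀ {i l x y} → InPiece (atN i) x → InPiece (atN l) y → E x y → i ≡ l
    N-separate {i} {l} {x} {y} (btw r lt) (btw r′ lt′) e with order i l
    ... | same eq = eq
    ... | above m refl = ⊥-elim (split (F.right-mono m r′) lt e)
      where
      split : ∀ {i x y} → Rt i y → Lt i x → ¬ E x y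
      split r l e = exclusive (conn-snoc r (E-sym e) (conn-right l)) l
    ... | below m refl = ⊥-elim (split (F.right-mono m r) lt′ (E-sym e))
      where
      split : ∀ {i x y} → Rt i y → Lt i x → ¬ E x y
      split r l e = exclusive (conn-snoc r (E-sym e) (conn-right l)) l

  conn-img : ∀ φ {v v′ x y} → φ · v ≈ v′ → Conn (Off v) x y → Conn (Off v′) (φ · x) (φ · y)
  conn-img φ e = ·-conn φ (λ n e′ → n (≈-img⁻ φ (≈-trans e e′)))

  ≈-bwd : ∀ φ {x y} → φ · x ≈ y → bwd φ y ≈ x
  ≈-bwd φ {x} {y} e = ≈-sym (subst (_≈ bwd φ y) (bwd-· φ x) (≈-img (inv φ) e))

  -- Every piece may be mapped with its sides exchanged; neighbouring pieces need not agree.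
  record Pieces (q q′ : ℤ → V) : Set where
    field
      gM gN : ℤ → Aut G
      centre : ∀ i → gM i · q i ≈ q′ i
      sides : ∀ i → (gM i · q (pv i) ≈ q′ (pv i) × gM i · q (nx i) ≈ q′ (nx i)) ⊎
                    (gM i · q (pv i) ≈ q′ (nx i) × gM i · q (nx i) ≈ q′ (pv i))
      ends : ∀ i → (gN i · q i ≈ q′ i × gN i · q (nx i) ≈ q′ (nx i)) ⊎ (gN i · q i ≈ q′ (nx i) × gN i · q (nx i) ≈ q′ i)

  inverse-pieces : ∀ {q q′} → Pieces q q′ → Pieces q′ q
  inverse-pieces d = record
    { gM = inv ∘ gM ; gN = inv ∘ gN ; centre = λ i → ≈-bwd (gM i) (centre i)
    ; sides = λ i → [ (λ (a , b) → inj₁ (≈-bwd (gM i) a , ≈-bwd (gM i) b)) , (λ (a , b) → inj₂ (≈-bwd (gM i) b , ≈-bwd (gM i) a)) ]′ (sides i)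
    ; ends = λ i → [ (λ (a , b) → inj₁ (≈-bwd (gN i) a , ≈-bwd (gN i) b)) , (λ (a , b) → inj₂ (≈-bwd (gN i) b , ≈-bwd (gN i) a)) ]′ (ends i) }
    where open Pieces d

  module Glue (q q′ : ℤ → V) (st : Straight nx q) (st′ : Straight nx q′) (d : Pieces q q′) where
    open Pieces d
    module D = Double q st
    module D′ = Double q′ st′

    part : Piece → Aut G
    part (atM i) = gM i
    part (atN i) = gN i

    glue : V → V
    glue x = part (proj₁ (D.locate x)) · x

    side-M : ∀ i {x} → D.Rt i x ⊎ D.Lt i x → D′.Rt i (gM i · x) ⊎ D′.Lt i (gM i · x)
    side-M i {x} s with sides i | s
    ... | inj₁ (a , b) | inj₁ r = inj₁ (conn-≈ˡ b (conn-left (conn-img (gM i) (centre i) r)) (conn-img (gM i) (centre i) r))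
    ... | inj₁ (a , b) | inj₂ l = inj₂ (conn-≈ˡ a (conn-left (conn-img (gM i) (centre i) l)) (conn-img (gM i) (centre i) l))
    ... | inj₂ (a , b) | inj₁ r = inj₂ (conn-≈ˡ b (conn-left (conn-img (gM i) (centre i) r)) (conn-img (gM i) (centre i) r))
    ... | inj₂ (a , b) | inj₂ l = inj₁ (conn-≈ˡ a (conn-left (conn-img (gM i) (centre i) l)) (conn-img (gM i) (centre i) l))

    move-N : ∀ i {x} → D.InPiece (atN i) x → D′.InPiece (atN i) (gN i · x)
    move-N i {x} (D.btw r l) with ends i
    ... | inj₁ (a , b) = D′.btw (conn-≈ˡ b (conn-left (conn-img (gN i) a r)) (conn-img (gN i) a r))
                         (D′.lt-nx (conn-≈ˡ a (conn-left (conn-img (gN i) b (D.lt-nx⁻ l))) (conn-img (gN i) b (D.lt-nx⁻ l))))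
    ... | inj₂ (a , b) = D′.btw (conn-≈ˡ a (conn-left (conn-img (gN i) b (D.lt-nx⁻ l))) (conn-img (gN i) b (D.lt-nx⁻ l)))
                         (D′.lt-nx (conn-≈ˡ b (conn-left (conn-img (gN i) a r)) (conn-img (gN i) a r)))

    off-ends : ∀ {i y} → D′.InPiece (atN i) y → Off (q′ i) y × Off (q′ (nx i)) y
    off-ends p = (λ e → D′.piece-MN (D′.class-piece e) p) , λ e → D′.piece-MN (D′.class-piece e) p

    adj-img : ∀ (φ : Aut G) {x x′ y} → φ · x ≈ x′ → Off x′ (φ · y) → E x y → E x′ (φ · y)
    adj-img φ {x} {x′} {y} a n e = proj₁ (outer-≈ a (·-E φ x y e , off-resp (≈-sym a) n))

    ends-adj : ∀ i {y} → D.InPiece (atN i) y → E (q i) y → E (q (nx i)) y → E (q′ i) (gN i · y) × E (q′ (nx i)) (gN i · y)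
    ends-adj i p e e′ with ends i | off-ends (move-N i p)
    ... | inj₁ (a , b) | n , n′ = adj-img (gN i) a n e , adj-img (gN i) b n′ e′
    ... | inj₂ (a , b) | n , n′ = adj-img (gN i) b n e′ , adj-img (gN i) a n′ e

    on-line : ∀ {i x} → q i ≈ x → q′ i ≈ gM i · x
    on-line {i} e = ≈-trans (≈-sym (centre i)) (≈-img (gM i) e)

    glue-MM : ∀ i l {x y} → D.InPiece (atM i) x → D.InPiece (atM l) y → i ≢ l → E x y → E (gM i · x) (gM l · y)
    glue-MM i l {x} {y} a b ne e = finish (D.line-edge (proj₁ (outer-≈ (≈-sym ly) (outer-sym (outer-≈ (≈-sym ix) (e , nxy))))) (ne ∘ sym))
      where
      distinct : ∀ {i l z} → D.InPiece (atM i) z → D.InPiece (atM l) z → i ≡ l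
      distinct p p′ with D.piece-unique p p′
      ... | refl = refl
      ix : q i ≈ x
      ix = D.M-boundary a (λ p → ne (distinct p b)) e
      ly : q l ≈ y
      ly = D.M-boundary b (λ p → ne (distinct a p)) (E-sym e)
      nxy : Off x y
      nxy r = ne (distinct (D.class-piece (≈-trans ix r)) b)
      join : ∀ {u v u′ v′} → Outer u v → u ≈ u′ → v ≈ v′ → E u′ v′
      join o p p′ = E-sym (proj₁ (outer-≈ p′ (outer-sym (outer-≈ p o))))
      finish : i ≡ nx l ⊎ l ≡ nx i → E (gM i · x) (gM l · y)
      finish (inj₁ eq) = join (subst (λ z → Outer (q′ z) (q′ l)) (sym eq) (outer-sym (proj₁ (st′ l)))) (on-line ix) (on-line ly)
      finish (inj₂ eq) = join (subst (λ z → Outer (q′ i) (q′ z)) (sym eq) (proj₁ (st′ i))) (on-line ix) (on-line ly)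

    glue-MN : ∀ i l {x y} → D.InPiece (atM i) x → D.InPiece (atN l) y → E x y → E (gM i · x) (gN l · y)
    glue-MN i l {x} {y} a b e = finish (D.N-boundary ix b e)
      where
      ix : q i ≈ x
      ix = D.M-boundary a (λ p → D.piece-MN p b) e
      off = off-ends (move-N l b)
      finish : (i ≡ l ⊎ i ≡ nx l) × E (q l) y × E (q (nx l)) y → E (gM i · x) (gN l · y)
      finish (inj₁ refl , u , v) = proj₁ (outer-≈ (on-line ix) (proj₁ (ends-adj l b u v) , proj₁ off))
      finish (inj₂ refl , u , v) = proj₁ (outer-≈ (on-line ix) (proj₂ (ends-adj l b u v) , proj₂ off))

    glue-E : ∀ {x y} → E x y → E (glue x) (glue y)
    glue-E {x} {y} e = go (proj₁ (D.locate x)) (proj₁ (D.locate y)) (proj₂ (D.locate x)) (proj₂ (D.locate y))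
      where
      go : ∀ p p′ → D.InPiece p x → D.InPiece p′ y → E (part p · x) (part p′ · y)
      go (atM i) (atM l) a b with dec (i ≡ l)
      ... | yes refl = ·-E (gM i) _ _ e
      ... | no ne = glue-MM i l a b ne e
      go (atM i) (atN l) a b = glue-MN i l a b e
      go (atN i) (atM l) a b = E-sym (glue-MN l i b a (E-sym e))
      go (atN i) (atN l) a b with D.N-separate a b e
      ... | refl = ·-E (gN i) _ _ e

    glue-at : ∀ p {x} → D.InPiece p x → glue x ≡ part p · x
    glue-at p {x} a = cong (λ z → part z · x) (D.piece-unique (proj₂ (D.locate x)) a)

  module _ {q q′ : ℤ → V} (st : Straight nx q) (st′ : Straight nx q′) (d : Pieces q q′) (d⁻ : Pieces q′ q)
    (part-inv : ∀ p x → Glue.part q′ q st′ st d⁻ p · (Glue.part q q′ st st′ d p · x) ≡ x) where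
    private
      module A = Glue q q′ st st′ d
      module A⁻ = Glue q′ q st′ st d⁻

    moved : ∀ p {x} → A.D.InPiece p x → A.D′.InPiece p (A.part p · x)
    moved (atN i) a = A.move-N i a
    moved (atM i) {x} (A.D.mid nr nl) = A.D′.mid (λ r → absurd (A⁻.side-M i (inj₁ r))) (λ l → absurd (A⁻.side-M i (inj₂ l)))
      where
      absurd : A.D.Rt i (A⁻.part (atM i) · (A.part (atM i) · x)) ⊎ A.D.Lt i (A⁻.part (atM i) · (A.part (atM i) · x)) → ⊥
      absurd (inj₁ r) = nr (subst (A.D.Rt i) (part-inv (atM i) x) r)
      absurd (inj₂ l) = nl (subst (A.D.Lt i) (part-inv (atM i) x) l)

    glue-inv : ∀ x → A⁻.glue (A.glue x) ≡ x
    glue-inv x = trans (A⁻.glue-at p (moved p a)) (part-inv p x)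
      where
      p = proj₁ (A.D.locate x)
      a = proj₂ (A.D.locate x)

  glued : ∀ {q q′} → Straight nx q → Straight nx q′ → Pieces q q′ → Σ (Aut G) λ φ → ∀ i → φ · q i ≈ q′ i
  glued {q} {q′} st st′ d = record
    { to = A.glue ; from = A⁻.glue ; to-from = glue-inv st′ st d⁻ d there-back ; from-to = glue-inv st st′ d d⁻ back-there
    ; pres = λ _ _ → A.glue-E
    ; refl' = λ u v e → subst₂ E (glue-inv st st′ d d⁻ back-there u) (glue-inv st st′ d d⁻ back-there v) (A⁻.glue-E e) } ,
    λ i → subst (_≈ q′ i) (sym (A.glue-at (atM i) (A.D.class-piece ≈-refl))) (Pieces.centre d i)
    where
    d⁻ = inverse-pieces d
    module A = Glue q q′ st st′ d
    module A⁻ = Glue q′ q st′ st d⁻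
    back-there : ∀ p x → A⁻.part p · (A.part p · x) ≡ x
    back-there (atM i) x = bwd-· (Pieces.gM d i) x
    back-there (atN i) x = bwd-· (Pieces.gN d i) x
    there-back : ∀ p x → A.part p · (A⁻.part p · x) ≡ x
    there-back (atM i) x = ·-bwd (Pieces.gM d i) x
    there-back (atN i) x = ·-bwd (Pieces.gN d i) x

-- Transitivity on global ends

module GlobalEnds (em : ExcludedMiddle (Level.suc 0ℓ)) (G : Graph) (connected : Connected G) (ρ₀ : Ray G) (blocks : Blocks G)
  (j : ℕ) (cs : CSTransitive G (suc (suc (suc j)))) where
  open import Data.Integer.Base using (ℤ; +_; -[1+_])
  open import Data.Nat.Tactic.RingSolver using (solve-∀)
  open Gluing em G connected ρ₀ blocks public

  k : ℕ
  k = suc (suc (suc j))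

  nth-map : ∀ (h : V → V) d xs m → nth (h d) (map h xs) m ≡ h (nth d xs m)
  nth-map h d [] m = refl
  nth-map h d (x ∷ xs) zero = refl
  nth-map h d (x ∷ xs) (suc m) = nth-map h d xs m

  Alike : ℕ → (ℤ → V) → (ℤ → V) → ℤ → ℤ → Set
  Alike w q q′ i l = Σ (Aut G) λ φ →
    (∀ m → m < w → φ · q (shift nx m i) ≡ q′ (shift nx m l)) ⊎
    (∀ m m′ → suc (m + m′) ≡ w → φ · q (shift nx m i) ≡ q′ (shift nx m′ l))

  line-alike : ∀ {q q′} → Straight nx q → Straight nx q′ → ∀ i l → Alike k q q′ i l
  line-alike {q} {q′} st st′ i l with path-equiv cs (Line.window-ip nx q st (2 + j) i) (Line.window-ip nx q′ st′ (2 + j) l)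
                                        (Line.window-length nx q st k i) (Line.window-length nx q′ st′ k l)
  ... | φ , inj₁ eq = φ , inj₁ λ m lt → trans (cong (φ ·_) (sym (Line.window-nth nx q st (q i) lt)))
          (trans (sym (nth-map (φ ·_) (q i) (Line.window nx q st k i) m)) (trans (cong (λ xs → nth (φ · q i) xs m) eq) (Line.window-nth nx q′ st′ (φ · q i) lt)))
  ... | φ , inj₂ eq = φ , inj₂ λ m m′ e → trans (cong (φ ·_) (sym (Line.window-nth nx q st (q i) (subst (m <_) e (s≤s (m≤m+n m m′))))))
          (trans (sym (nth-map (φ ·_) (q i) (Line.window nx q st k i) m)) (trans (cong (λ xs → nth (φ · q i) xs m) eq)
            (trans (nth-reverse (φ · q i) (Line.window nx q′ st′ k l) m m′ (trans e (sym (Line.window-length nx q′ st′ k l))))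
                   (Line.window-nth nx q′ st′ (φ · q i) (subst (m′ <_) e (s≤s (m≤n+m m′ m)))))))

  shift-pv : ∀ c i → shift nx c (shift pv c i) ≡ i
  shift-pv zero i = refl
  shift-pv (suc c) i = trans (last (shift pv (suc c) i)) (trans (cong nx (cong (shift nx c) (step-out c i)))
                         (trans (cong nx (swap c (shift pv c i))) (trans (nx-pv _) (shift-pv c i))))
    where
    last : ∀ l → shift nx (suc c) l ≡ nx (shift nx c l)
    last = go c
      where
      go : ∀ c l → shift nx (suc c) l ≡ nx (shift nx c l)
      go zero l = refl
      go (suc c) l = go c (nx l)
    step-out : ∀ c i → shift pv c (pv i) ≡ pv (shift pv c i)
    step-out zero i = refl
    step-out (suc c) i = step-out c (pv i)
    swap : ∀ c l → shift nx c (pv l) ≡ pv (shift nx c l)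
    swap zero l = refl
    swap (suc c) l = trans (cong (shift nx c) (trans (nx-pv l) (sym (pv-nx l)))) (swap c (nx l))

  -- Reversal keeps the middle of a window, so the window of k classes is placed symmetrically, with
  -- `c` extra classes on each side of the part that matters.
  centred : ∀ c w → k ≡ c + (w + c) → ∀ {q q′} → Straight nx q → Straight nx q′ → ∀ i l → Alike w q q′ i l
  centred c w eq {q} {q′} st st′ i l = proj₁ al , reindex (proj₂ al)
    where
    i₀ = shift pv c i
    l₀ = shift pv c l
    al = line-alike st st′ i₀ l₀
    φ = proj₁ al
    place : ∀ m i → shift nx (c + m) (shift pv c i) ≡ shift nx m i
    place m i = trans (shift-+ nx c m (shift pv c i)) (cong (shift nx m) (shift-pv c i))
    reindex : (∀ m → m < k → φ · q (shift nx m i₀) ≡ q′ (shift nx m l₀)) ⊎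
              (∀ m m′ → suc (m + m′) ≡ k → φ · q (shift nx m i₀) ≡ q′ (shift nx m′ l₀)) →
              (∀ m → m < w → φ · q (shift nx m i) ≡ q′ (shift nx m l)) ⊎
              (∀ m m′ → suc (m + m′) ≡ w → φ · q (shift nx m i) ≡ q′ (shift nx m′ l))
    reindex (inj₁ h) = inj₁ λ m lt → subst₂ (λ a b → φ · q a ≡ q′ b) (place m i) (place m l)
      (h (c + m) (subst (c + m <_) (sym eq) (+-monoʳ-< c (≤-trans lt (m≤m+n w c)))))
    reindex (inj₂ h) = inj₂ λ m m′ e → subst₂ (λ a b → φ · q a ≡ q′ b) (place m i) (place m′ l)
      (h (c + m) (c + m′) (trans (arith c m m′) (trans (cong (λ z → c + (z + c)) e) (sym eq))))
      where
      arith : ∀ c m m′ → suc (c + m + (c + m′)) ≡ c + (suc (m + m′) + c)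
      arith = solve-∀

  halves : ∀ m → (∃ λ c → m ≡ c + c) ⊎ (∃ λ c → m ≡ suc (c + c))
  halves zero = inj₁ (0 , refl)
  halves (suc m) with halves m
  ... | inj₁ (c , refl) = inj₂ (c , refl)
  ... | inj₂ (c , refl) = inj₁ (suc c , cong suc (sym (+-suc c c)))

  Pair Triple : Set
  Pair = V × V
  Triple = V × V × V

  SamePair : Pair → Pair → Set
  SamePair (a , b) (a′ , b′) = Σ (Aut G) λ φ → (φ · a ≡ a′ × φ · b ≡ b′) ⊎ (φ · a ≡ b′ × φ · b ≡ a′)

  SameTriple : Triple → Triple → Set
  SameTriple (a , v , b) (a′ , v′ , b′) = Σ (Aut G) λ φ → φ · v ≡ v′ × ((φ · a ≡ a′ × φ · b ≡ b′) ⊎ (φ · a ≡ b′ × φ · b ≡ a′))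

  private
    undo : ∀ (φ : Aut G) {x y} → φ · x ≡ y → bwd φ y ≡ x
    undo φ {x} eq = trans (cong (bwd φ) (sym eq)) (bwd-· φ x)

    chain : ∀ (ψ φ : Aut G) {x y z} → φ · x ≡ y → ψ · y ≡ z → (ψ ⊙ φ) · x ≡ z
    chain ψ φ eq eq′ = trans (cong (ψ ·_) eq) eq′

    Ends : Aut G → V → V → V → V → Set
    Ends φ a b a′ b′ = (φ · a ≡ a′ × φ · b ≡ b′) ⊎ (φ · a ≡ b′ × φ · b ≡ a′)

    ends-sym : ∀ φ {a b a′ b′} → Ends φ a b a′ b′ → Ends (inv φ) a′ b′ a b
    ends-sym φ (inj₁ (x , y)) = inj₁ (undo φ x , undo φ y)
    ends-sym φ (inj₂ (x , y)) = inj₂ (undo φ y , undo φ x)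

    ends-trans : ∀ ψ φ {a b a′ b′ a″ b″} → Ends φ a b a′ b′ → Ends ψ a′ b′ a″ b″ → Ends (ψ ⊙ φ) a b a″ b″
    ends-trans ψ φ (inj₁ (x , y)) (inj₁ (x′ , y′)) = inj₁ (chain ψ φ x x′ , chain ψ φ y y′)
    ends-trans ψ φ (inj₁ (x , y)) (inj₂ (x′ , y′)) = inj₂ (chain ψ φ x x′ , chain ψ φ y y′)
    ends-trans ψ φ (inj₂ (x , y)) (inj₁ (x′ , y′)) = inj₂ (chain ψ φ x y′ , chain ψ φ y x′)
    ends-trans ψ φ (inj₂ (x , y)) (inj₂ (x′ , y′)) = inj₁ (chain ψ φ x y′ , chain ψ φ y x′)

  pair-sym : ∀ {x y} → SamePair x y → SamePair y x
  pair-sym (φ , e) = inv φ , ends-sym φ e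

  pair-trans : ∀ {x y z} → SamePair x y → SamePair y z → SamePair x z
  pair-trans (φ , e) (ψ , e′) = ψ ⊙ φ , ends-trans ψ φ e e′

  triple-sym : ∀ {x y} → SameTriple x y → SameTriple y x
  triple-sym (φ , c , e) = inv φ , undo φ c , ends-sym φ e

  triple-trans : ∀ {x y z} → SameTriple x y → SameTriple y z → SameTriple x z
  triple-trans (φ , c , e) (ψ , c′ , e′) = ψ ⊙ φ , chain ψ φ c c′ , ends-trans ψ φ e e′

  -- Consecutive items have the same unordered pair of types everywhere, so types alternate with
  -- period at most two and two lines agree after a shift by at most one.
  module Align {Item : Set} (_∼_ : Item → Item → Set) (∼-sym : ∀ {x y} → x ∼ y → y ∼ x)
    (∼-trans : ∀ {x y z} → x ∼ y → y ∼ z → x ∼ z) where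

    Coupled : (ℤ → Item) → (ℤ → Item) → Set
    Coupled τ τ′ = ∀ i l → (τ i ∼ τ′ l × τ (nx i) ∼ τ′ (nx l)) ⊎ (τ i ∼ τ′ (nx l) × τ (nx i) ∼ τ′ l)

    period : ∀ {τ} → Coupled τ τ → ∀ i → τ i ∼ τ (nx (nx i))
    period h i with h i (nx i)
    ... | inj₁ (a , b) = ∼-trans a b
    ... | inj₂ (a , _) = a

    propagate : ∀ {τ τ′} → Coupled τ τ → Coupled τ′ τ′ → τ (+ 0) ∼ τ′ (+ 0) → τ (+ 1) ∼ τ′ (+ 1) → ∀ i → τ i ∼ τ′ i
    propagate {τ} {τ′} h h′ z o i = proj₁ (ℤ-induction (λ i → τ i ∼ τ′ i × τ (nx i) ∼ τ′ (nx i)) (z , o)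
      (λ {i} (a , b) → b , ∼-trans (∼-sym (period h i)) (∼-trans a (period h′ i)))
      (λ {i} (a , b) → ∼-trans (period h i) (∼-trans b (∼-sym (period h′ i))) , a) i)

    align : ∀ {τ τ′} → Coupled τ τ → Coupled τ τ′ → Coupled τ′ τ′ → (∀ i → τ i ∼ τ′ i) ⊎ (∀ i → τ i ∼ τ′ (nx i))
    align {τ} {τ′} h c h′ with c (+ 0) (+ 0)
    ... | inj₁ (a , b) = inj₁ (propagate h h′ a b)
    ... | inj₂ (a , b) = inj₂ (propagate {τ′ = τ′ ∘ nx} h (λ i l → h′ (nx i) (nx l)) a (∼-trans b (period h′ (+ 0))))

  pair : (ℤ → V) → ℤ → Pair
  pair q i = q i , q (nx i)

  triple : (ℤ → V) → ℤ → Triple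
  triple q i = q i , q (nx i) , q (nx (nx i))

  -- A triple is indexed by its first class, so the piece around `q i` uses the triple at `pv i`.
  to-pieces : ∀ {q q′} → (∀ i → SamePair (pair q i) (pair q′ i)) → (∀ i → SameTriple (triple q i) (triple q′ i)) → Pieces q q′
  to-pieces {q} {q′} ps ts = record
    { gM = λ i → proj₁ (ts (pv i)) ; gN = λ i → proj₁ (ps i) ; centre = centre′ ; sides = sides′
    ; ends = λ i → [ (λ (a , b) → inj₁ (≡⇒≈ a , ≡⇒≈ b)) , (λ (a , b) → inj₂ (≡⇒≈ a , ≡⇒≈ b)) ]′ (proj₂ (ps i)) }
    where
    ≡⇒≈ : ∀ {x y} → x ≡ y → x ≈ y
    ≡⇒≈ refl = ≈-refl
    centre′ : ∀ i → proj₁ (ts (pv i)) · q i ≈ q′ i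
    centre′ i = subst (λ z → proj₁ (ts (pv i)) · q z ≈ q′ z) (nx-pv i) (≡⇒≈ (proj₁ (proj₂ (ts (pv i)))))
    sides′ : ∀ i → _
    sides′ i = subst (λ z → (proj₁ (ts (pv i)) · q (pv i) ≈ q′ (pv i) × proj₁ (ts (pv i)) · q (nx z) ≈ q′ (nx z)) ⊎
                            (proj₁ (ts (pv i)) · q (pv i) ≈ q′ (nx z) × proj₁ (ts (pv i)) · q (nx z) ≈ q′ (pv i))) (nx-pv i)
                 ([ (λ (a , b) → inj₁ (≡⇒≈ a , ≡⇒≈ b)) , (λ (a , b) → inj₂ (≡⇒≈ a , ≡⇒≈ b)) ]′ (proj₂ (proj₂ (ts (pv i)))))

  module _ (alike : ∀ {q q′} → Straight nx q → Straight nx q′ → ∀ i l → Alike 3 q q′ i l) where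

    -- A triple in the middle stays in place under reversal, so all triples are alike; its two pairs
    -- may be exchanged and need `align`.
    odd-triple : ∀ {q q′} → Straight nx q → Straight nx q′ → ∀ i → SameTriple (triple q i) (triple q′ i)
    odd-triple st st′ i with alike st st′ i i
    ... | φ , inj₁ h = φ , h 1 (s≤s (s≤s z≤n)) , inj₁ (h 0 (s≤s z≤n) , h 2 ≤-refl)
    ... | φ , inj₂ h = φ , h 1 1 refl , inj₂ (h 0 2 refl , h 2 0 refl)

    odd-coupled : ∀ {q q′} → Straight nx q → Straight nx q′ → Align.Coupled SamePair pair-sym pair-trans (pair q) (pair q′)
    odd-coupled st st′ i l with alike st st′ i l
    ... | φ , inj₁ h = inj₁ ((φ , inj₁ (h 0 (s≤s z≤n) , h 1 (s≤s (s≤s z≤n)))) , (φ , inj₁ (h 1 (s≤s (s≤s z≤n)) , h 2 ≤-refl)))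
    ... | φ , inj₂ h = inj₂ ((φ , inj₂ (h 0 2 refl , h 1 1 refl)) , (φ , inj₂ (h 1 1 refl , h 2 0 refl)))

    odd-pieces : ∀ {q q′} → Straight nx q → Straight nx q′ → Pieces q q′ ⊎ Pieces q (q′ ∘ nx)
    odd-pieces {q} {q′} st st′ with Align.align SamePair pair-sym pair-trans (odd-coupled st st) (odd-coupled st st′) (odd-coupled st′ st′)
    ... | inj₁ ps = inj₁ (to-pieces ps (odd-triple st st′))
    ... | inj₂ ps = inj₂ (to-pieces ps (odd-triple st (st′ ∘ nx)))

  module _ (alike : ∀ {q q′} → Straight nx q → Straight nx q′ → ∀ i l → Alike 4 q q′ i l) where

    -- Of four classes the inner pair stays in place, so all pairs are alike; the two triples may be
    -- exchanged and need `align`.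
    even-pair : ∀ {q q′} → Straight nx q → Straight nx q′ → ∀ i → SamePair (pair q i) (pair q′ i)
    even-pair {q} {q′} st st′ i = subst (λ z → SamePair (pair q z) (pair q′ z)) (nx-pv i) (middle (pv i))
      where
      middle : ∀ i → SamePair (pair q (nx i)) (pair q′ (nx i))
      middle i with alike st st′ i i
      ... | φ , inj₁ h = φ , inj₁ (h 1 (s≤s (s≤s z≤n)) , h 2 (s≤s (s≤s (s≤s z≤n))))
      ... | φ , inj₂ h = φ , inj₂ (h 1 2 refl , h 2 1 refl)

    even-coupled : ∀ {q q′} → Straight nx q → Straight nx q′ → Align.Coupled SameTriple triple-sym triple-trans (triple q) (triple q′)
    even-coupled st st′ i l with alike st st′ i l
    ... | φ , inj₁ h = inj₁ ((φ , h 1 (s≤s (s≤s z≤n)) , inj₁ (h 0 (s≤s z≤n) , h 2 (s≤s (s≤s (s≤s z≤n))))) ,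
                             (φ , h 2 (s≤s (s≤s (s≤s z≤n))) , inj₁ (h 1 (s≤s (s≤s z≤n)) , h 3 ≤-refl)))
    ... | φ , inj₂ h = inj₂ ((φ , h 1 2 refl , inj₂ (h 0 3 refl , h 2 1 refl)) , (φ , h 2 1 refl , inj₂ (h 1 2 refl , h 3 0 refl)))

    even-pieces : ∀ {q q′} → Straight nx q → Straight nx q′ → Pieces q q′ ⊎ Pieces q (q′ ∘ nx)
    even-pieces {q} {q′} st st′ with Align.align SameTriple triple-sym triple-trans (even-coupled st st) (even-coupled st st′) (even-coupled st′ st′)
    ... | inj₁ ts = inj₁ (to-pieces (even-pair st st′) ts)
    ... | inj₂ ts = inj₂ (to-pieces (even-pair st (st′ ∘ nx)) ts)

  pieces : ∀ {q q′} → Straight nx q → Straight nx q′ → Pieces q q′ ⊎ Pieces q (q′ ∘ nx)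
  pieces with halves j
  ... | inj₁ (c , eq) = odd-pieces (centred c 3 (trans (cong (λ z → 3 + z) eq) (arith c)))
    where
    arith : ∀ c → 3 + (c + c) ≡ c + (3 + c)
    arith = solve-∀
  ... | inj₂ (c , eq) = even-pieces (centred c 4 (trans (cong (λ z → 3 + z) eq) (arith c)))
    where
    arith : ∀ c → 3 + suc (c + c) ≡ c + (4 + c)
    arith = solve-∀

  module Doubled (a : ℕ → V) (st : Straight suc a) where
    private
      module X = Extend (a 1) (a 0) (outer-sym (proj₁ (st 0)))

    double : ℤ → V
    -- The backward line starts with `a 1, a 0`; these two are present already, hence the offset by
    -- two.
    double (+ n) = a n
    double -[1+ n ] = X.line (suc (suc n))

    double-straight : Straight nx double
    double-straight (+ n) = st n
    double-straight -[1+ zero ] = outer-sym (proj₁ (X.line-straight 1)) , λ c → proj₂ (X.line-straight 0) (conn-sym c)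
    double-straight -[1+ suc zero ] = outer-sym (proj₁ (X.line-straight 2)) , λ c → proj₂ (X.line-straight 1) (conn-sym c)
    double-straight -[1+ suc (suc n) ] = outer-sym (proj₁ (X.line-straight (suc (suc (suc n))))) , λ c → proj₂ (X.line-straight (suc (suc n))) (conn-sym c)

  finally-left : ∀ {a} (st : Straight suc a) (F : List V) → ∃ λ n → ∀ {x} → x ∈ F → ¬ Line.Right suc a st n x
  finally-left st [] = 0 , λ ()
  finally-left {a} st (x ∷ F) with finally-left st F | Line.not-right-far suc a st 0 x
  ... | n , h | m , nr = n ⊔ m , λ { (here refl) r → nr (right-≤′ (m≤n⊔m n m) r) ; (there q) r → h q (right-≤″ (m≤m⊔n n m) r) }
    where
    open Line suc a st
    sh-suc : ∀ m i → sh m i ≡ m + i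
    sh-suc zero i = refl
    sh-suc (suc m) i = trans (sh-suc m (suc i)) (+-suc m i)
    from-0 : ∀ m → sh m 0 ≡ m
    from-0 m = trans (sh-suc m 0) (+-identityʳ m)
    right-≤′ : ∀ {m l y} → m ≤ l → Right l y → Right (sh m 0) y
    right-≤′ {l = l} {y} le r = right-≤ le (subst (λ z → Right z y) (sym (from-0 l)) r)
    right-≤″ : ∀ {m l y} → m ≤ l → Right l y → Right m y
    right-≤″ {m} {l} {y} le r = subst (λ z → Right z y) (from-0 m) (right-≤′ le r)

  -- The connected sets `Right n` eventually miss any finite set, and both rays have tails in each
  -- of them.
  follow-equiv : ∀ {a} (st : Straight suc a) ρ σ → Line.Follows suc a st ρ → Line.Follows suc a st σ → EquivRay G ρ σ
  follow-equiv {a} st ρ σ fρ fσ F with finally-left st F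
  ... | n , free with fρ n | fσ n
  ... | lv N f | lv M g = N ⊔ M , λ i l p q → conn-within (λ c x∈ → free x∈ (conn-trans (f i (≤-trans (m≤m⊔n N M) p)) c))
        (conn-trans (conn-sym (f i (≤-trans (m≤m⊔n N M) p))) (g l (≤-trans (m≤n⊔m N M) q)))

  global-transitive : ∀ ρ σ → GlobalEnd G ρ → GlobalEnd G σ → Σ (Aut G) λ φ → MapsEnd G φ ρ σ
  global-transitive ρ σ gρ gσ = from-lines (global-follows gρ) (global-follows gσ)
    where
    from-lines : FollowsLine ρ → FollowsLine σ → Σ (Aut G) λ φ → MapsEnd G φ ρ σ
    from-lines (a , sa , fa) (b , sb , fb) = choose (pieces A.double-straight B.double-straight)
      where
      module A = Doubled a sa
      module B = Doubled b sb
      carried : ∀ (φ : Aut G) (c : ℕ → V) → (∀ n → φ · a n ≈ c n) → (∀ i → Off (c i) (c (suc i))) → ∀ i → LivesAt (c i) (·-ray φ ρ) (c (suc i))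
      carried φ c h off i = lives-conn (class-conn (h (suc i)) (off-resp₂ (off i))) (·-lives φ (λ n e → n (≈-img⁻ φ (≈-trans (h i) e))) (fa i))
        where
        off-resp₂ : Off (c i) (c (suc i)) → Off (c i) (φ · a (suc i))
        off-resp₂ n e = n (≈-trans e (h (suc i)))
      choose : Pieces A.double B.double ⊎ Pieces A.double (B.double ∘ nx) → Σ (Aut G) λ φ → MapsEnd G φ ρ σ
      choose (inj₁ d) with glued A.double-straight B.double-straight d
      ... | φ , h = φ , follow-equiv sb (·-ray φ ρ) σ (carried φ b (λ n → h (+ n)) (λ i → proj₂ (proj₁ (sb i)))) fb
      choose (inj₂ d) with glued A.double-straight (B.double-straight ∘ nx) d
      ... | φ , h = φ , follow-equiv {b ∘ suc} (sb ∘ suc) (·-ray φ ρ) σ (carried φ (b ∘ suc) (λ n → h (+ n)) (λ i → proj₂ (proj₁ (sb (suc i))))) (fb ∘ suc)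

theorem7p2 : ExcludedMiddle (Level.suc 0ℓ) → (k : ℕ) → 3 ≤ k → (G : Graph) →
    Connected G → CSTransitive G k → MoreThanOneEnd G →
    ((ρ : Ray G) → LocalEnd G ρ ⊎ GlobalEnd G ρ) ×
    ((ρ ρ' : Ray G) → LocalEnd G ρ → LocalEnd G ρ' → Σ (Aut G) λ φ → MapsEnd G φ ρ ρ') ×
    ((ρ ρ' : Ray G) → GlobalEnd G ρ → GlobalEnd G ρ' → Σ (Aut G) λ φ → MapsEnd G φ ρ ρ') ×
    (EndTransitive G ⇔ (¬ Σ (Ray G) λ ρ → LocalEnd G ρ))
theorem7p2 em (suc (suc (suc j))) (s≤s (s≤s (s≤s z≤n))) G connected cs more =
  local-or-global , local-transitive cs , global-transitive , mk⇔ no-local all-global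
  where
  blocks : Blocks G
  -- From here on the separators enter only through the block structure.
  blocks = record { Classes em G more connected j cs }
  open GlobalEnds em G connected (proj₁ more) blocks j cs
  no-local : EndTransitive G → ¬ Σ (Ray G) λ ρ → LocalEnd G ρ
  no-local trans-ends (ρ , loc) with global-exists
  ... | γ , glob with trans-ends ρ γ
  ... | φ , m = glob (·-ray φ ρ) (equiv-sym {·-ray φ ρ} {γ} m) (·-bounded φ {ρ} (loc ρ (equiv-refl ρ)))
  all-global : (¬ Σ (Ray G) λ ρ → LocalEnd G ρ) → EndTransitive G
  all-global none ρ ρ' = global-transitive ρ ρ' (global ρ) (global ρ')
    where
    global : ∀ ρ → GlobalEnd G ρ
    global ρ with local-or-global ρ
    ... | inj₁ loc = ⊥-elim (none (ρ , loc))
    ... | inj₂ glob = glob
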